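{- Let $BH_n$ denote the $n$-dimensional balanced hypercube. (1) For all integers $n,g$ with $2\le g\le 8$ and $n\ge 6-\dfrac{12}{g+1}$, the $g$-extra edge-connectivity of $BH_n$ is $$\lambda_g(BH_n)=2(g+1)n-4g+4.$$ (2) For all integers $n,g$ with $9\le g\le 2n-1$ and $n\ge \dfrac{3e_g(BH_n)}{g+1}$, $$\lambda_g(BH_n)<2(g+1)n-4g+4.$$
   Context: All graphs are finite and simple. For an integer $n\ge 1$, the $n$-dimensional balanced hypercube $BH_n$ is the graph with vertex set $\{(a_0,a_1,\ldots,a_{n-1})\mid a_i\in\{0,1,2,3\},\ 0\le i\le n-1\}$, in which each vertex $(a_0,a_1,\ldots,a_{n-1})$ has exactly the following $2n$ neighbors: (1) the two vertices $((a_0\pm1)\bmod 4,\,a_1,\ldots,a_{n-1})$; and (2) for each $i$ with $1\le i\le n-1$, the two vertices $((a_0\pm1)\bmod 4,\,a_1,\ldots,a_{i-1},\,(a_i+(-1)^{a_0})\bmod 4,\,a_{i+1},\ldots,a_{n-1})$. An edge-cut of a connected graph $G$ is a set $F\subseteq E(G)$ such that $G-F$ (delete the edges of $F$, keep all vertices) is disconnected. For a nonnegative integer $g$, an edge-cut $F$ is a $g$-extra edge-cut if every component of $G-F$ has at least $g+1$ vertices. The $g$-extra edge-connectivity $\lambda_g(G)$ is the minimum cardinality of a $g$-extra edge-cut of $G$, if one exists. For a graph $G$ with at least $g+1$ vertices, $e_g(G)=\max\{|E(G[U])| : U\subseteq V(G),\ |U|=g+1\}$, where $G[U]$ is the subgraph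 of $G$ induced by $U$. -}

module Defs where

open import Data.Fin using (Fin; toℕ)
open import Data.Fin.Patterns using (0F; 1F; 2F; 3F)
open import Data.Fin.Properties using (inj⇒≟; any?; *↔×; 1↔⊤) renaming (_≟_ to _≟ᶠ_)
open import Data.List using (List; []; _∷_; length; filter)
open import Data.List.Relation.Unary.All using (All)
open import Data.List.Relation.Unary.Unique.Propositional using (Unique)
import Data.List.Membership.DecSetoid as DecMembership
import Data.List.Relation.Unary.Unique.Setoid as UniqueSetoid
open import Data.Nat using (ℕ; zero; suc; _+_; _^_; _≤_; NonZero)
open import Data.Nat.DivMod using (_mod_)
open import Data.Product using (Σ; ∃; _×_; _,_; proj₁; proj₂)
open import Data.Product.Function.NonDependent.Propositional using (_×-↔_)
open import Data.Sum using (_⊎_; inj₁; inj₂)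
open import Data.Unit using (tt)
open import Data.Vec using (Vec; []; _∷_; _[_]%=_)
open import Data.Vec.Properties using (≡-dec; updateAt-updateAt-local; updateAt-id)
open import Function.Bundles using (_↔_; mk↔ₛ′)
open import Function.Construct.Composition using (_↔-∘_)
open import Function.Construct.Identity using (↔-id)
open import Function.Construct.Symmetry using (↔-sym)
open import Function.Properties.Inverse using (Inverse⇒Injection)
open import Level using (0ℓ)
open import Relation.Binary using (Rel; Decidable; DecidableEquality; DecSetoid; Setoid; Symmetric; Irreflexive)
open import Relation.Binary.Construct.Closure.ReflexiveTransitive using (Star)
open import Relation.Binary.PropositionalEquality using (_≡_; refl; sym; trans; cong)
open import Relation.Nullary using (¬_; yes; no)
open import Relation.Nullary.Decidable using (_×-dec_; _⊎-dec_)
open import Relation.Unary using (Pred)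

record Graph : Set₁ where
  infix 4 _~_ _~?_
  field
    Vertex   : Set
    finite   : ∃ λ N → Vertex ↔ Fin N
    _~_      : Rel Vertex 0ℓ
    _~?_     : Decidable _~_
    ~-sym    : Symmetric _~_
    ~-irrefl : Irreflexive _≡_ _~_

  _≟_ : DecidableEquality Vertex
  _≟_ = inj⇒≟ (Inverse⇒Injection (proj₂ finite))

  record Edge : Set where
    constructor edge
    field
      {src tgt} : Vertex
      adjacent  : src ~ tgt

  open Edge public

  -- Edges are unordered: (u , v) and (v , u) are the same edge, and the proof
  -- of adjacency is ignored.
  infix 4 _≈_
  _≈_ : Rel Edge 0ℓ
  e ≈ f = (src e ≡ src f × tgt e ≡ tgt f) ⊎ (src e ≡ tgt f × tgt e ≡ src f)

  edgeDecSetoid : DecSetoid 0ℓ 0ℓ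
  edgeDecSetoid = record
    { Carrier = Edge
    ; _≈_     = _≈_
    ; isDecEquivalence = record
      { isEquivalence = record
        { refl  = inj₁ (refl , refl)
        ; sym   = λ { (inj₁ (p , q)) → inj₁ (sym p , sym q)
                    ; (inj₂ (p , q)) → inj₂ (sym q , sym p) }
        ; trans = λ { (inj₁ (p , q)) (inj₁ (r , s)) → inj₁ (trans p r , trans q s)
                    ; (inj₁ (p , q)) (inj₂ (r , s)) → inj₂ (trans p r , trans q s)
                    ; (inj₂ (p , q)) (inj₁ (r , s)) → inj₂ (trans p s , trans q r)
                    ; (inj₂ (p , q)) (inj₂ (r , s)) → inj₁ (trans p s , trans q r) }
        }
      ; _≟_ = λ e f → ((src e ≟ src f) ×-dec (tgt e ≟ tgt f))
                ⊎-dec ((src e ≟ tgt f) ×-dec (tgt e ≟ src f))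
      }
    }

  edgeSetoid : Setoid 0ℓ 0ℓ
  edgeSetoid = DecSetoid.setoid edgeDecSetoid

  open DecMembership edgeDecSetoid public using () renaming (_∈_ to _∈ᴱ_; _∉_ to _∉ᴱ_; _∈?_ to _∈ᴱ?_)

-- A finite set is a duplicate-free list; its cardinality is the length.

record EdgeSet (G : Graph) : Set where
  field
    elements : List (Graph.Edge G)
    unique   : UniqueSetoid.Unique (Graph.edgeSetoid G) elements

  size : ℕ
  size = length elements

record VertexSet (G : Graph) : Set where
  field
    elements : List (Graph.Vertex G)
    unique   : Unique elements

  size : ℕ
  size = length elements

infixl 6 _∖_
_∖_ : (G : Graph) → EdgeSet G → Graph
G ∖ F = record
  { Vertex   = Vertex
  ; finite   = finite
  ; _~_      = λ u v → Σ (u ~ v) λ p → edge p ∉ᴱ elements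
  ; _~?_     = remains?
  ; ~-sym    = λ { (p , p∉F) → ~-sym p , λ q∈F → p∉F (∈-swap p (~-sym p) q∈F) }
  ; ~-irrefl = λ { u≡v (p , _) → ~-irrefl u≡v p }
  }
  where
  open Graph G
  open EdgeSet F
  open import Data.List.Membership.Setoid.Properties using (∈-resp-≈)

  ∈-swap : ∀ {u v} (p : u ~ v) (q : v ~ u) → edge q ∈ᴱ elements → edge p ∈ᴱ elements
  ∈-swap p q = ∈-resp-≈ edgeSetoid {elements} {edge q} {edge p} (inj₂ (refl , refl))

  remains? : Decidable (λ u v → Σ (u ~ v) λ p → edge p ∉ᴱ elements)
  remains? u v with u ~? v
  ... | no ¬p = no λ { (p , _) → ¬p p }
  ... | yes p with edge p ∈ᴱ? elements
  ...   | yes p∈F = no λ { (_ , q∉F) → q∉F p∈F }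
  ...   | no  p∉F = yes (p , p∉F)

Connected : Graph → Set
Connected G = ∀ u v → Star (Graph._~_ G) u v

-- The vertex set of the component of G containing v.
Component : (G : Graph) → Graph.Vertex G → Pred (Graph.Vertex G) 0ℓ
Component G v u = Star (Graph._~_ G) v u

HasAtLeast : (G : Graph) → ℕ → Pred (Graph.Vertex G) 0ℓ → Set
HasAtLeast G k P = ∃ λ (S : VertexSet G) → All P (VertexSet.elements S) × k ≤ VertexSet.size S

IsEdgeCut : (G : Graph) → EdgeSet G → Set
IsEdgeCut G F = Connected G × ¬ Connected (G ∖ F)

IsExtraEdgeCut : (g : ℕ) (G : Graph) → EdgeSet G → Set
IsExtraEdgeCut g G F = IsEdgeCut G F × (∀ v → HasAtLeast (G ∖ F) (suc g) (Component (G ∖ F) v))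

-- λ_g(G) exists and equals k.
IsExtraEdgeConnectivity : (g : ℕ) (G : Graph) → ℕ → Set
IsExtraEdgeConnectivity g G k =
  (∃ λ F → IsExtraEdgeCut g G F × EdgeSet.size F ≡ k) ×
  (∀ F → IsExtraEdgeCut g G F → k ≤ EdgeSet.size F)

-- |E(G[U])|: each adjacent pair is counted once, at its earlier element in the
-- duplicate-free list.
∣E[_]∣ : {G : Graph} → VertexSet G → ℕ
∣E[_]∣ {G} U = count (VertexSet.elements U)
  where
  open Graph G
  count : List Vertex → ℕ
  count []       = 0
  count (u ∷ us) = length (filter (u ~?_) us) + count us

-- e_g(G) = e.
IsMaxInducedEdges : (g : ℕ) (G : Graph) → ℕ → Set
IsMaxInducedEdges g G e =
  (∃ λ (U : VertexSet G) → VertexSet.size U ≡ suc g × ∣E[ U ]∣ ≡ e) ×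
  (∀ (U : VertexSet G) → VertexSet.size U ≡ suc g → ∣E[ U ]∣ ≤ e)

inc dec : Fin 4 → Fin 4
inc a = (toℕ a + 1) mod 4
dec a = (toℕ a + 3) mod 4   -- a - 1 ≡ a + 3 (mod 4)

-- shift a₀ x = x + (-1)^a₀ (mod 4)
shift : Fin 4 → Fin 4 → Fin 4
shift 0F = inc
shift 1F = dec
shift 2F = inc
shift 3F = dec

-- The index i : Fin m of the tail stands for coordinate i + 1.
BHAdj : ∀ {m} → Rel (Vec (Fin 4) (suc m)) 0ℓ
BHAdj (a₀ ∷ as) (b₀ ∷ bs) =
  (b₀ ≡ inc a₀ ⊎ b₀ ≡ dec a₀) ×
  (bs ≡ as ⊎ ∃ λ i → bs ≡ as [ i ]%= shift a₀)

_≟ᵛ_ : ∀ {m} → DecidableEquality (Vec (Fin 4) m)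
_≟ᵛ_ = ≡-dec _≟ᶠ_

BHAdj? : ∀ {m} → Decidable (BHAdj {m})
BHAdj? (a₀ ∷ as) (b₀ ∷ bs) =
  ((b₀ ≟ᶠ inc a₀) ⊎-dec (b₀ ≟ᶠ dec a₀)) ×-dec
  ((bs ≟ᵛ as) ⊎-dec any? (λ i → bs ≟ᵛ (as [ i ]%= shift a₀)))

dec-inc : ∀ x → dec (inc x) ≡ x
dec-inc 0F = refl
dec-inc 1F = refl
dec-inc 2F = refl
dec-inc 3F = refl

inc-dec : ∀ x → inc (dec x) ≡ x
inc-dec 0F = refl
inc-dec 1F = refl
inc-dec 2F = refl
inc-dec 3F = refl

shift-inc : ∀ a x → shift (inc a) (shift a x) ≡ x
shift-inc 0F = dec-inc
shift-inc 1F = inc-dec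
shift-inc 2F = dec-inc
shift-inc 3F = inc-dec

shift-dec : ∀ a x → shift (dec a) (shift a x) ≡ x
shift-dec 0F = dec-inc
shift-dec 1F = inc-dec
shift-dec 2F = dec-inc
shift-dec 3F = inc-dec

undo : ∀ {m} {f h : Fin 4 → Fin 4} → (∀ x → h (f x) ≡ x) →
       (i : Fin m) (as : Vec (Fin 4) m) → as ≡ (as [ i ]%= f) [ i ]%= h
undo hf i as = sym (trans (updateAt-updateAt-local i as (hf _)) (updateAt-id i as))

BHAdj-sym : ∀ {m} → Symmetric (BHAdj {m})
BHAdj-sym {x = a₀ ∷ as} {b₀ ∷ bs} (inj₁ refl , inj₁ refl)       = inj₂ (sym (dec-inc a₀)) , inj₁ refl
BHAdj-sym {x = a₀ ∷ as} {b₀ ∷ bs} (inj₂ refl , inj₁ refl)       = inj₁ (sym (inc-dec a₀)) , inj₁ refl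
BHAdj-sym {x = a₀ ∷ as} {b₀ ∷ bs} (inj₁ refl , inj₂ (i , refl)) = inj₂ (sym (dec-inc a₀)) , inj₂ (i , undo (shift-inc a₀) i as)
BHAdj-sym {x = a₀ ∷ as} {b₀ ∷ bs} (inj₂ refl , inj₂ (i , refl)) = inj₁ (sym (inc-dec a₀)) , inj₂ (i , undo (shift-dec a₀) i as)

≢-inc : ∀ a → ¬ a ≡ inc a
≢-inc 0F ()
≢-inc 1F ()
≢-inc 2F ()
≢-inc 3F ()

≢-dec : ∀ a → ¬ a ≡ dec a
≢-dec 0F ()
≢-dec 1F ()
≢-dec 2F ()
≢-dec 3F ()

BHAdj-irrefl : ∀ {m} → Irreflexive _≡_ (BHAdj {m})
BHAdj-irrefl {x = a₀ ∷ as} refl (inj₁ p , _) = ≢-inc a₀ p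
BHAdj-irrefl {x = a₀ ∷ as} refl (inj₂ p , _) = ≢-dec a₀ p

Vec↔Fin : ∀ m → Vec (Fin 4) m ↔ Fin (4 ^ m)
Vec↔Fin zero    = ↔-sym 1↔⊤ ↔-∘ mk↔ₛ′ (λ _ → tt) (λ _ → []) (λ _ → refl) (λ { [] → refl })
Vec↔Fin (suc m) = ↔-sym *↔× ↔-∘ ((↔-id (Fin 4) ×-↔ Vec↔Fin m) ↔-∘ uncons↔)
  where
  uncons↔ : Vec (Fin 4) (suc m) ↔ (Fin 4 × Vec (Fin 4) m)
  uncons↔ = mk↔ₛ′ (λ { (a ∷ as) → a , as }) (λ { (a , as) → a ∷ as })
                  (λ _ → refl) (λ { (_ ∷ _) → refl })

BH : (n : ℕ) .{{_ : NonZero n}} → Graph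
BH (suc m) = record
  { Vertex   = Vec (Fin 4) (suc m)
  ; finite   = 4 ^ suc m , Vec↔Fin (suc m)
  ; _~_      = BHAdj
  ; _~?_     = BHAdj?
  ; ~-sym    = λ {x} {y} → BHAdj-sym {x = x} {y}
  ; ~-irrefl = BHAdj-irrefl
  }

{-# OPTIONS --safe #-}
module Submission where

-- Vertices with a₀ differing by 2 are twins, so BH_n is an n-regular bipartite graph without
-- 4-cycles in which every vertex is doubled and every edge replaced by a K₂,₂. A vertex set is a
-- weight in {0, 1, 2} on each twin class, and its boundary has 2 n |U| − 2 e(U) edges.
--
-- Lower bound. Removing a vertex of small degree shows e(U) ≤ 2 |U| − 4 for 3 ≤ |U| ≤ 9, and
-- removing one of at most average degree bounds e(U) up to |U| = 14. Larger sets are handled by induction on n: splitting along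
-- a coordinate gives four cyclically arranged copies of BH_(n−1). If two copies are met in neither
-- too few nor too many vertices, the induction hypothesis applies twice; if a nearly empty copy is
-- followed by a nearly full one (or conversely), the edges between them suffice; otherwise all
-- copies but at most one are nearly empty (up to complementation) and their vertices send enough
-- edges out.
--
-- Upper bound. A pair of twins with g − 1 neighbours attains the value for g ≤ 8. For g ≥ 9, a
-- hexagon of twin classes of sizes 2, 2, 2, 2, 1, 1, enlarged by neighbours of one class, spans an
-- extra edge. In (2) the minimum exists because, an extra edge-cut being replaceable by the boundary
-- of one of its components, it is taken over the finitely many vertex subsets.

open import Defs
open import Data.Bool using (Bool; true; false; if_then_else_; not; T) renaming (_≟_ to _≟ᵇ_)
open import Data.Empty using (⊥-elim)
open import Data.Fin using (Fin; zero; suc)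
open import Data.Fin.Patterns using (0F; 1F; 2F; 3F)
open import Data.Fin.Properties using (any?) renaming (_≟_ to _≟ᶠ_)
open import Data.Fin.Subset using (Subset)
open import Data.Fin.Subset.Properties using (anySubset?)
import Data.Nat as ℕ
open import Data.List using (List; []; _∷_; map; _++_; filter; length; allFin; cartesianProduct; cartesianProductWith)
open import Data.List.Properties using (map-∘; map-cong; length-++)
open import Data.List.Membership.Propositional using (_∈_; _∉_; find; lose)
open import Data.List.Membership.Propositional.Properties
  using (∈-∃++; ∈-filter⁺; ∈-filter⁻; ∈-cartesianProductWith⁺; ∈-cartesianProduct⁺; ∈-allFin)
open import Data.List.Relation.Binary.Permutation.Propositional using (_↭_; ↭⇒↭ₛ)
open import Data.List.Relation.Binary.Permutation.Propositional.Properties using (map⁺; ∈-resp-↭) renaming (shift to ↭-shift)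
import Data.List.Relation.Binary.Permutation.Setoid.Properties as Permutation
open import Data.List.Relation.Unary.All as All using (All; []; _∷_)
import Data.List.Relation.Unary.All.Properties as All
open import Data.List.Relation.Unary.AllPairs as AllPairs using (AllPairs; []; _∷_)
open import Data.List.Relation.Unary.Any as Any using (here; there)
open import Data.List.Relation.Unary.Unique.Propositional using (Unique)
import Data.List.Relation.Unary.Unique.Propositional.Properties as Unique
open import Data.Nat hiding (_≟_; _/_)
open import Data.Nat.ListAction using (sum)
open import Data.Nat.ListAction.Properties using (sum-↭)
open import Data.Nat.Properties hiding (_≟_)
open import Data.Nat.Tactic.RingSolver using (solve-∀)
open import Data.Product using (∃; _×_; _,_; proj₁; proj₂)
open import Data.Rational.Unnormalised as ℚᵘ using (_/_)
open import Data.Sum using (_⊎_; inj₁; inj₂; [_,_]′)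
import Data.Sum as Sum
open import Data.Vec using (Vec; []; _∷_; _[_]%=_; lookup; tabulate; replicate)
open import Data.Vec.Properties using (∷-injective; lookup∘tabulate)
open import Function using (_∘_; case_of_; id; flip)
open import Function.Bundles using (Inverse)
open import Relation.Binary using (DecidableEquality; Setoid)
open import Relation.Binary.Construct.Closure.ReflexiveTransitive using (Star; ε; _◅_; _◅◅_; gmap; reverse)
open import Relation.Binary.PropositionalEquality hiding ([_]; setoid)
open import Relation.Binary.PropositionalEquality.Properties using (setoid)
open import Relation.Nullary using (¬_; Dec; yes; no; does; contradiction)
open import Relation.Nullary.Decidable using (_×-dec_; _⊎-dec_; ¬?; _→-dec_; from-yes; decidable-stable; dec-true; dec-false; map′)

-- The constants come from the inductive step. With `K = g + 1` and `l = n − 2` the value in (1) is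
-- `2 K l + 8`. Two copies met in a middling number of vertices yield twice the previous bound, so
-- starting from 8 in dimension 2 the targets in dimensions 3, 4, 5 must not exceed 16, 32, 64.
-- Afterwards `K = 9` stays and the target grows by only 18 per dimension. The switch from edge
-- counting to induction at 15 vertices is dictated by dimension 5: a single middling copy gives 32
-- and the vertices at least `2 * 15` more, which is 62 with nothing to spare. Hence edges must be
-- bounded up to 14 vertices, beyond the linear range. The linear bound stops at 9 because a vertex
-- of degree at most 2 is forced only while one side of the bipartition has weight at most 4. Ten
-- vertices can split as 5 + 5, and the hexagon does so with all degrees at least 3, spanning 17
-- edges instead of 16.

-- Linear inequalities, indicators and finite sums

-- A certificate for linear arithmetic: with the hypotheses added up to `a ≤ b` and an explicit
-- slack `s`, what remains is a semiring identity, which `solve-∀` decides.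
≤-by : ∀ {a b} l r s → a ≤ b → l + b + s ≡ a + r → l ≤ r
≤-by {a} {b} l r s a≤b eq = +-cancelˡ-≤ a l r (begin
  a + l      ≡⟨ +-comm a l ⟩
  l + a      ≤⟨ +-monoʳ-≤ l a≤b ⟩
  l + b      ≤⟨ m≤m+n (l + b) s ⟩
  l + b + s  ≡⟨ eq ⟩
  a + r      ∎)
  where open ≤-Reasoning

≤-check : ∀ {m n} {m≤n : T (m ≤ᵇ n)} → m ≤ n
≤-check {m} {n} {m≤n} = ≤ᵇ⇒≤ m n m≤n

𝟙 : ∀ {P : Set} → Dec P → ℕ
𝟙 d = if does d then 1 else 0

𝟙-yes : ∀ {P : Set} (d : Dec P) → P → 𝟙 d ≡ 1
𝟙-yes d p = cong (if_then 1 else 0) (dec-true d p)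

𝟙-no : ∀ {P : Set} (d : Dec P) → ¬ P → 𝟙 d ≡ 0
𝟙-no d ¬p = cong (if_then 1 else 0) (dec-false d ¬p)

𝟙-positive : ∀ {P : Set} (d : Dec P) → 0 < 𝟙 d → P
𝟙-positive (yes p) _ = p

𝟙≤1 : ∀ {P : Set} (d : Dec P) → 𝟙 d ≤ 1
𝟙≤1 (yes _) = s≤s z≤n
𝟙≤1 (no _)  = z≤n

module _ {A : Set} where

  ∑ : List A → (A → ℕ) → ℕ
  ∑ xs f = sum (map f xs)

  ∑-cong : ∀ xs {f g : A → ℕ} → (∀ x → f x ≡ g x) → ∑ xs f ≡ ∑ xs g
  ∑-cong xs f≗g = cong sum (map-cong f≗g xs)

  ∑-monoᴬ : ∀ {xs} {f g : A → ℕ} → All (λ x → f x ≤ g x) xs → ∑ xs f ≤ ∑ xs g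
  ∑-monoᴬ []       = z≤n
  ∑-monoᴬ (p ∷ ps) = +-mono-≤ p (∑-monoᴬ ps)

  ∑-mono : ∀ xs {f g : A → ℕ} → (∀ x → f x ≤ g x) → ∑ xs f ≤ ∑ xs g
  ∑-mono xs f≤g = ∑-monoᴬ (All.universal f≤g xs)

  ∑-++ : ∀ xs ys (f : A → ℕ) → ∑ (xs ++ ys) f ≡ ∑ xs f + ∑ ys f
  ∑-++ []       ys f = refl
  ∑-++ (x ∷ xs) ys f = trans (cong (f x +_) (∑-++ xs ys f)) (sym (+-assoc (f x) _ _))

  ∑-distrib-+ : ∀ xs (f g : A → ℕ) → ∑ xs (λ x → f x + g x) ≡ ∑ xs f + ∑ xs g
  ∑-distrib-+ []       f g = refl
  ∑-distrib-+ (x ∷ xs) f g = trans (cong (f x + g x +_) (∑-distrib-+ xs f g))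
                                   (interchange (f x) (g x) _ _)
    where
    interchange : ∀ a b c d → a + b + (c + d) ≡ a + c + (b + d)
    interchange = solve-∀

  ∑-*ˡ : ∀ xs c (f : A → ℕ) → ∑ xs (λ x → c * f x) ≡ c * ∑ xs f
  ∑-*ˡ []       c f = sym (*-zeroʳ c)
  ∑-*ˡ (x ∷ xs) c f = trans (cong (c * f x +_) (∑-*ˡ xs c f)) (sym (*-distribˡ-+ c (f x) _))

  ∑-*ʳ : ∀ xs c (f : A → ℕ) → ∑ xs (λ x → f x * c) ≡ ∑ xs f * c
  ∑-*ʳ xs c f = trans (∑-cong xs (λ x → *-comm (f x) c)) (trans (∑-*ˡ xs c f) (*-comm c _))

  ∑-const : ∀ xs c → ∑ xs (λ _ → c) ≡ length xs * c
  ∑-const []       c = refl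
  ∑-const (x ∷ xs) c = cong (c +_) (∑-const xs c)

  ∑-zero : ∀ xs → ∑ xs (λ _ → 0) ≡ 0
  ∑-zero xs = trans (∑-const xs 0) (*-zeroʳ (length xs))

  ∑-positive : ∀ xs (f : A → ℕ) → 0 < ∑ xs f → ∃ λ x → x ∈ xs × 0 < f x
  ∑-positive (x ∷ xs) f 0<∑ with f x in eq
  ... | suc _ = x , here refl , subst (0 <_) (sym eq) (s≤s z≤n)
  ... | zero  with y , y∈xs , 0<fy ← ∑-positive xs f 0<∑ = y , there y∈xs , 0<fy

  ≤-∑ : ∀ {xs x} (f : A → ℕ) → x ∈ xs → f x ≤ ∑ xs f
  ≤-∑ f (here refl)                 = m≤m+n _ _
  ≤-∑ {y ∷ _} f (there x∈xs) = ≤-trans (≤-∑ f x∈xs) (m≤n+m _ (f y))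

  length-filter≡∑ : ∀ {P : A → Set} (P? : ∀ x → Dec (P x)) xs → length (filter P? xs) ≡ ∑ xs (𝟙 ∘ P?)
  length-filter≡∑ P? []       = refl
  length-filter≡∑ P? (x ∷ xs) with P? x
  ... | yes _ = cong suc (length-filter≡∑ P? xs)
  ... | no  _ = length-filter≡∑ P? xs

∑-map : ∀ {A B : Set} (h : A → B) xs (f : B → ℕ) → ∑ (map h xs) f ≡ ∑ xs (f ∘ h)
∑-map h xs f = cong sum (sym (map-∘ xs))

∑-swap : ∀ {A B : Set} (xs : List A) (ys : List B) (f : A → B → ℕ) →
         ∑ xs (λ x → ∑ ys (f x)) ≡ ∑ ys (λ y → ∑ xs (λ x → f x y))
∑-swap []       ys f = sym (∑-zero ys)
∑-swap (x ∷ xs) ys f = trans (cong (∑ ys (f x) +_) (∑-swap xs ys f))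
                             (sym (∑-distrib-+ ys (f x) _))

∑-cartesianProductWith : ∀ {A B C : Set} (h : A → B → C) xs ys (f : C → ℕ) →
  ∑ (cartesianProductWith h xs ys) f ≡ ∑ xs (λ x → ∑ ys (λ y → f (h x y)))
∑-cartesianProductWith h []       ys f = refl
∑-cartesianProductWith h (x ∷ xs) ys f =
  trans (∑-++ (map (h x) ys) _ f)
        (cong₂ _+_ (∑-map (h x) ys f) (∑-cartesianProductWith h xs ys f))

-- Summation over finite types

record Enumeration (A : Set) : Set where
  field
    list     : List A
    complete : ∀ x → x ∈ list
    unique   : Unique list
    _≟_      : DecidableEquality A

  -- Up to permutation the list is `x ∷ ys`, so every sum splits off its term at `x`; the statements
  -- below that single out one index rest on this.
  remove : ∀ x → ∃ λ ys → All (x ≢_) ys × (∀ y → x ≢ y → y ∈ ys) ×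
                 (∀ f → ∑ list f ≡ f x + ∑ ys f)
  remove x with as , bs , eq ← ∈-∃++ (complete x) =
    let π = subst (_↭ x ∷ as ++ bs) (sym eq) (↭-shift x as bs) in
    as ++ bs ,
    AllPairs.head (Permutation.Unique-resp-↭ (setoid A) (↭⇒↭ₛ π) unique) ,
    (λ y x≢y → Any.tail (x≢y ∘ sym) (∈-resp-↭ π (complete y))) ,
    (λ f → sum-↭ (map⁺ f π))

  any-dec : ∀ {P : A → Set} → (∀ x → Dec (P x)) → Dec (∃ P)
  any-dec P? = map′ (λ p → let x , _ , px = find p in x , px) (λ (x , px) → lose (complete x) px)
                    (Any.any? P? list)

  ∑-point : ∀ x (f : A → ℕ) → ∑ list (λ y → 𝟙 (x ≟ y) * f y) ≡ f x
  ∑-point x f with ys , x∉ys , _ , split ← remove x = begin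
    ∑ list (λ y → 𝟙 (x ≟ y) * f y)                      ≡⟨ split _ ⟩
    𝟙 (x ≟ x) * f x + ∑ ys (λ y → 𝟙 (x ≟ y) * f y)
      ≡⟨ cong₂ (λ a b → a * f x + b) (𝟙-yes (x ≟ x) refl) (vanish x∉ys) ⟩
    1 * f x + 0                                         ≡⟨ trans (+-identityʳ _) (*-identityˡ (f x)) ⟩
    f x                                                 ∎
    where
    open ≡-Reasoning
    vanish : ∀ {ys} → All (x ≢_) ys → ∑ ys (λ y → 𝟙 (x ≟ y) * f y) ≡ 0
    vanish []                   = refl
    vanish {y ∷ _} (x≢y ∷ x∉ys) = cong₂ _+_ (cong (_* f y) (𝟙-no (x ≟ y) x≢y)) (vanish x∉ys)

  ∑-other : ∀ x (f : A → ℕ) → f x < ∑ list f → ∃ λ y → x ≢ y × 0 < f y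
  ∑-other x f fx<∑ with ys , x∉ys , _ , split ← remove x =
    let y , y∈ys , 0<fy = ∑-positive ys f (+-cancelˡ-< (f x) 0 _
          (subst₂ _<_ (sym (+-identityʳ (f x))) (split f) fx<∑))
    in y , All.lookup x∉ys y∈ys , 0<fy

  +-≤-∑ : ∀ x y (f : A → ℕ) → x ≢ y → f x + f y ≤ ∑ list f
  +-≤-∑ x y f x≢y with ys , _ , other , split ← remove x =
    subst (f x + f y ≤_) (sym (split f)) (+-monoʳ-≤ (f x) (≤-∑ f (other y x≢y)))

  -- Tailored to the absence of 4-cycles: the exceptional index will be the unique common neighbour
  -- of two vertices.
  ∑-mono-except : ∀ x {f g : A → ℕ} c → f x ≤ g x + c → (∀ y → x ≢ y → f y ≤ g y) →
                  ∑ list f ≤ ∑ list g + c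
  ∑-mono-except x {f} {g} c fx≤ f≤g with ys , x∉ys , _ , split ← remove x = begin
    ∑ list f             ≡⟨ split f ⟩
    f x + ∑ ys f         ≤⟨ +-mono-≤ fx≤ (∑-monoᴬ (All.map (f≤g _) x∉ys)) ⟩
    g x + c + ∑ ys g     ≡⟨ swap (g x) c (∑ ys g) ⟩
    g x + ∑ ys g + c     ≡⟨ cong (_+ c) (sym (split g)) ⟩
    ∑ list g + c         ∎
    where
    open ≤-Reasoning
    swap : ∀ a b c → a + b + c ≡ a + c + b
    swap = solve-∀

  decrement : A → (A → ℕ) → A → ℕ
  decrement x f y = f y ∸ 𝟙 (x ≟ y)

  decrement-+ : ∀ x f → 0 < f x → ∀ y → f y ≡ 𝟙 (x ≟ y) + decrement x f y
  decrement-+ x f 0<fx y with x ≟ y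
  ... | yes refl = sym (m+[n∸m]≡n 0<fx)
  ... | no  _    = refl

  decrement-≤ : ∀ x f y → decrement x f y ≤ f y
  decrement-≤ x f y = m∸n≤m (f y) (𝟙 (x ≟ y))

  ∑-decrement : ∀ x f → 0 < f x → (w : A → ℕ) →
                ∑ list (λ y → f y * w y) ≡ w x + ∑ list (λ y → decrement x f y * w y)
  ∑-decrement x f 0<fx w = begin
    ∑ list (λ y → f y * w y)
      ≡⟨ ∑-cong list (λ y → trans (cong (_* w y) (decrement-+ x f 0<fx y))
                                  (*-distribʳ-+ (w y) (𝟙 (x ≟ y)) _)) ⟩
    ∑ list (λ y → 𝟙 (x ≟ y) * w y + decrement x f y * w y)
      ≡⟨ ∑-distrib-+ list _ _ ⟩
    ∑ list (λ y → 𝟙 (x ≟ y) * w y) + ∑ list (λ y → decrement x f y * w y)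
      ≡⟨ cong (_+ ∑ list (λ y → decrement x f y * w y)) (∑-point x w) ⟩
    w x + ∑ list (λ y → decrement x f y * w y) ∎
    where open ≡-Reasoning

  ∑-decrement₁ : ∀ x f → 0 < f x → ∑ list f ≡ suc (∑ list (decrement x f))
  ∑-decrement₁ x f 0<fx = begin
    ∑ list f                                        ≡⟨ ∑-cong list (λ y → sym (*-identityʳ (f y))) ⟩
    ∑ list (λ y → f y * 1)                          ≡⟨ ∑-decrement x f 0<fx (λ _ → 1) ⟩
    suc (∑ list (λ y → decrement x f y * 1))        ≡⟨ cong suc (∑-cong list (λ y → *-identityʳ _)) ⟩
    suc (∑ list (decrement x f))                    ∎
    where open ≡-Reasoning

  -- A discrete intermediate value principle: units are removed one at a time. It later chooses a
  -- prescribed number of neighbours of a twin class.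
  intermediate : ∀ b k → k ≤ ∑ list b → ∃ λ f → (∀ x → f x ≤ b x) × ∑ list f ≡ k
  intermediate b k k≤ = go (∑ list b ∸ k) b (sym (m∸n+n≡m k≤))
    where
    go : ∀ d b → ∑ list b ≡ d + k → ∃ λ f → (∀ x → f x ≤ b x) × ∑ list f ≡ k
    go zero    b eq = b , (λ _ → ≤-refl) , eq
    go (suc d) b eq
      with x , _ , 0<bx ← ∑-positive list b (subst (0 <_) (sym eq) (s≤s z≤n))
      with f , f≤ , ∑f ← go d (decrement x b) (suc-injective (trans (sym (∑-decrement₁ x b 0<bx)) eq))
      = f , (λ y → ≤-trans (f≤ y) (decrement-≤ x b y)) , ∑f

-- Incidence structures without 4-cycles

module _ where
  open Enumeration

  -- Incidence takes values in ℕ so that degrees and edge numbers are plain sums that can be swapped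
  -- and split.
  record Incidence : Set₁ where
    field
      {L R}    : Set
      left     : Enumeration L
      right    : Enumeration R
      incident : L → R → ℕ
      ≤1       : ∀ t s → incident t s ≤ 1
      C₄-free  : ∀ {t t′ s s′} → 0 < incident t s → 0 < incident t s′ →
                 0 < incident t′ s → 0 < incident t′ s′ → t ≡ t′ ⊎ s ≡ s′

  open Incidence

  infix 10 _ᵀ
  -- Lets each argument be written for left vertices only.
  _ᵀ : Incidence → Incidence
  I ᵀ = record
    { left = right I ; right = left I ; incident = flip (incident I) ; ≤1 = flip (≤1 I)
    ; C₄-free = λ p q r s → Sum.swap (C₄-free I p r q s) }

  -- The weight of a vertex is the number of its copies in a vertex set of the graph in which
  -- every vertex of the incidence graph is replaced by two twins.

  degree : (I : Incidence) → (R I → ℕ) → L I → ℕ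
  degree I o t = ∑ (list (right I)) λ s → o s * incident I t s

  edges : (I : Incidence) → (L I → ℕ) → (R I → ℕ) → ℕ
  edges I e o = ∑ (list (left I)) λ t → e t * degree I o t

  weight : (I : Incidence) → (L I → ℕ) → (R I → ℕ) → ℕ
  weight I e o = ∑ (list (left I)) e + ∑ (list (right I)) o

  edges-ᵀ : ∀ I e o → edges I e o ≡ edges (I ᵀ) o e
  edges-ᵀ I e o = begin
    ∑ Ls (λ t → e t * ∑ Rs (λ s → o s * incident I t s))
      ≡⟨ ∑-cong Ls (λ t → sym (∑-*ˡ Rs (e t) _)) ⟩
    ∑ Ls (λ t → ∑ Rs (λ s → e t * (o s * incident I t s)))
      ≡⟨ ∑-swap Ls Rs _ ⟩
    ∑ Rs (λ s → ∑ Ls (λ t → e t * (o s * incident I t s)))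
      ≡⟨ ∑-cong Rs (λ s → trans (∑-cong Ls (λ t → exchange (e t) (o s) _)) (∑-*ˡ Ls (o s) _)) ⟩
    ∑ Rs (λ s → o s * ∑ Ls (λ t → e t * incident I t s)) ∎
    where
    open ≡-Reasoning
    Ls = list (left I)
    Rs = list (right I)
    exchange : ∀ a b c → a * (b * c) ≡ b * (a * c)
    exchange = solve-∀

  0<* : ∀ a {b} → 0 < a * b → 0 < a × 0 < b
  0<* (suc a) {suc b} _ = s≤s z≤n , s≤s z≤n
  0<* (suc a) {zero} 0<a*0 = contradiction (subst (0 <_) (*-zeroʳ a) 0<a*0) λ ()

  module _ (I : Incidence) where

    common-neighbour-unique : ∀ {t t′ s y} → t ≢ t′ → s ≢ y → 0 < incident I t s → 0 < incident I t′ s →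
                              incident I t y + incident I t′ y ≤ 1
    common-neighbour-unique {t} {t′} {s} {y} t≢t′ s≢y ts t′s with 0 <? incident I t y | 0 <? incident I t′ y
    ... | no ¬ty | _       = subst (λ a → a + incident I t′ y ≤ 1) (sym (n≤0⇒n≡0 (≮⇒≥ ¬ty))) (≤1 I t′ y)
    ... | yes _  | no ¬t′y = subst (_≤ 1) (sym (trans (cong (incident I t y +_) (n≤0⇒n≡0 (≮⇒≥ ¬t′y))) (+-identityʳ _))) (≤1 I t y)
    ... | yes ty | yes t′y = ⊥-elim ([ t≢t′ , s≢y ]′ (C₄-free I ts ty t′s t′y))

    -- Every right vertex other than `s` is adjacent to at most one of `t` and `t′`, so only `o s`
    -- can be counted twice.
    degree-sum-≤ : ∀ o {t t′ s} → t ≢ t′ → 0 < incident I t s → 0 < incident I t′ s →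
                   degree I o t + degree I o t′ ≤ ∑ (list (right I)) o + o s
    degree-sum-≤ o {t} {t′} {s} t≢t′ ts t′s =
      subst (_≤ _) (∑-distrib-+ (list (right I)) _ _)
        (∑-mono-except (right I) s (o s) (+-mono-≤ (times {o s} (≤1 I t s)) (times {o s} (≤1 I t′ s)))
          (λ y s≢y → subst (_≤ o y) (*-distribˡ-+ (o y) (incident I t y) (incident I t′ y))
            (times (common-neighbour-unique t≢t′ s≢y ts t′s))))
      where
      times : ∀ {a b} → b ≤ 1 → a * b ≤ a
      times {a} {b} b≤1 = subst (a * b ≤_) (*-identityʳ a) (*-monoʳ-≤ a b≤1)

    degree-≤ : ∀ o t → degree I o t ≤ ∑ (list (right I)) o
    degree-≤ o t = ∑-mono (list (right I)) λ s → subst (o s * incident I t s ≤_) (*-identityʳ (o s)) (*-monoʳ-≤ (o s) (≤1 I t s))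

    neighbour : ∀ o {t} → 0 < degree I o t → ∃ λ s → 0 < o s × 0 < incident I t s
    neighbour o {t} 0<d with s , _ , 0<os ← ∑-positive (list (right I)) _ 0<d = s , 0<* (o s) 0<os

    other-neighbour : ∀ o {t} s → o s ≤ 2 → 3 ≤ degree I o t → ∃ λ y → s ≢ y × 0 < o y × 0 < incident I t y
    other-neighbour o {t} s os≤2 3≤d
      with y , s≢y , 0<oy ← ∑-other (right I) s (λ y → o y * incident I t y)
             (≤-trans (s≤s (≤-trans (*-mono-≤ os≤2 (≤1 I t s)) ≤-refl)) 3≤d)
      = y , s≢y , 0<* (o y) 0<oy

    degree-≥-pair : ∀ o t {s y} → s ≢ y → 0 < incident I t s → 0 < incident I t y → o s + o y ≤ degree I o t
    degree-≥-pair o t {s} {y} s≢y ts ty = ≤-trans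
      (+-mono-≤ (times {o s} ts) (times {o y} ty)) (+-≤-∑ (right I) s y (λ z → o z * incident I t z) s≢y)
      where
      times : ∀ {a b} → 0 < b → a ≤ a * b
      times {a} {b} 0<b = subst (_≤ a * b) (*-identityʳ a) (*-monoʳ-≤ a 0<b)

  -- Edges spanned by at most 14 vertices

  record Bounded (I : Incidence) (e : L I → ℕ) (o : R I → ℕ) : Set where
    constructor bounded
    field
      left≤2  : ∀ t → e t ≤ 2
      right≤2 : ∀ s → o s ≤ 2

  open Bounded

  bounded-ᵀ : ∀ {I e o} → Bounded I e o → Bounded (I ᵀ) o e
  bounded-ᵀ (bounded p q) = bounded q p

  SomeDegree : (I : Incidence) → (L I → ℕ) → (R I → ℕ) → (ℕ → Set) → Set
  SomeDegree I e o P = (∃ λ t → 0 < e t × P (degree I o t)) ⊎ (∃ λ s → 0 < o s × P (degree (I ᵀ) e s))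

  someDegree? : ∀ I e o {P : ℕ → Set} → (∀ d → Dec (P d)) → Dec (SomeDegree I e o P)
  someDegree? I e o P? = any-dec (left I) (λ t → (0 <? e t) ×-dec P? _) ⊎-dec
                         any-dec (right I) (λ s → (0 <? o s) ×-dec P? _)

  -- Two left vertices with a common neighbour s have no other one, so their degrees add up to
  -- at most 4 + o s ≤ 6; hence every neighbour has weight 2, and two neighbours give degree 4.
  degrees≥3⇒weight>4 : ∀ I {e o} → Bounded I e o →
    (∀ t → 0 < e t → 3 ≤ degree I o t) → (∀ s → 0 < o s → 3 ≤ degree (I ᵀ) e s) →
    ∑ (list (right I)) o ≤ 4 → ∀ t → ¬ 0 < e t
  degrees≥3⇒weight>4 I {e} {o} b degL degR ∑o≤4 t 0<et
    with s , 0<os , ts ← neighbour I o (≤-trans (s≤s z≤n) (degL t 0<et))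
    with y , s≢y , 0<oy , ty ← other-neighbour I o s (right≤2 b s) (degL t 0<et)
    = contradiction (≤-trans (+-monoˡ-≤ 3 deg≥4) (≤-trans (key ts 0<os) (+-monoʳ-≤ 4 (right≤2 b s))))
                    (<⇒≱ ≤-refl)
    where
    key : ∀ {s} → 0 < incident I t s → 0 < o s → degree I o t + 3 ≤ 4 + o s
    key {s} ts 0<os
      with t′ , t≢t′ , 0<et′ , t′s ← other-neighbour (I ᵀ) e t (left≤2 b t) (degR s 0<os)
      = ≤-trans (+-monoʳ-≤ _ (degL t′ 0<et′))
          (≤-trans (degree-sum-≤ I o t≢t′ ts t′s) (+-monoˡ-≤ (o s) ∑o≤4))
    weight2 : ∀ {s} → 0 < incident I t s → 0 < o s → 2 ≤ o s
    weight2 ts 0<os = +-cancelˡ-≤ 4 2 _ (≤-trans (+-monoˡ-≤ 3 (degL t 0<et)) (key ts 0<os))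
    deg≥4 : 4 ≤ degree I o t
    deg≥4 = ≤-trans (+-mono-≤ (weight2 ts 0<os) (weight2 ty 0<oy)) (degree-≥-pair I o t s≢y ts ty)

  -- If all degrees were at least 3, `degrees≥3⇒weight>4` and its transpose would put weight at
  -- least 5 on each side, 10 in all.
  degree≤2-exists : ∀ I {e o} → Bounded I e o → 0 < weight I e o → weight I e o ≤ 9 →
                    SomeDegree I e o (_≤ 2)
  degree≤2-exists I {e} {o} b 0<w w≤9 = decidable-stable (someDegree? I e o (_≤? 2)) λ none →
    let degL = λ t 0<et → ≰⇒> λ d≤2 → none (inj₁ (t , 0<et , d≤2))
        degR = λ s 0<os → ≰⇒> λ d≤2 → none (inj₂ (s , 0<os , d≤2))
        t , 0<et = leftVertex degR
        s , 0<os , _ = neighbour I o (≤-trans (s≤s z≤n) (degL t 0<et))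
    in case ∑ Rs o ≤? 4 of λ where
      (yes ∑o≤4) → degrees≥3⇒weight>4 I b degL degR ∑o≤4 t 0<et
      (no  ∑o≰4) → degrees≥3⇒weight>4 (I ᵀ) (bounded-ᵀ b) degR degL
                     (+-cancelʳ-≤ 5 (∑ Ls e) 4 (≤-trans (+-monoʳ-≤ _ (≰⇒> ∑o≰4)) w≤9)) s 0<os
    where
    Ls = list (left I)
    Rs = list (right I)
    leftVertex : (∀ s → 0 < o s → 3 ≤ degree (I ᵀ) e s) → ∃ λ t → 0 < e t
    leftVertex degR with 0 <? ∑ Ls e
    ... | yes 0<∑e = let t , _ , 0<et = ∑-positive Ls e 0<∑e in t , 0<et
    ... | no  0≮∑e =
      let s , _ , 0<os = ∑-positive Rs o (subst (λ n → 0 < n + ∑ Rs o) (n≤0⇒n≡0 (≮⇒≥ 0≮∑e)) 0<w)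
          t , 0<et , _ = neighbour (I ᵀ) e (≤-trans (s≤s z≤n) (degR s 0<os))
      in t , 0<et

  -- A vertex of the heavier side has all its neighbours on the lighter side, which carries at most
  -- half of the weight.
  degree≤half-left : ∀ I {e o} c → ∑ (list (right I)) o ≤ ∑ (list (left I)) e → 0 < weight I e o →
                     weight I e o ≤ suc (c + c) → ∃ λ t → 0 < e t × degree I o t ≤ c
  degree≤half-left I {e} {o} c o≤e 0<w w≤ =
    let t , _ , 0<et = ∑-positive (list (left I)) e (≰⇒> λ e≤0 →
          <⇒≱ 0<w (+-mono-≤ e≤0 (≤-trans o≤e e≤0)))
    in t , 0<et , ≤-trans (degree-≤ I o t)
         (≮⇒≥ λ c<o → <⇒≱ (+-mono-≤ (≤-trans c<o o≤e) c<o) (subst (weight I e o ≤_) (sym (+-suc c c)) w≤))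

  degree≤half-exists : ∀ I e o c → 0 < weight I e o → weight I e o ≤ suc (c + c) → SomeDegree I e o (_≤ c)
  degree≤half-exists I e o c 0<w w≤ with ≤-total (∑ (list (right I)) o) (∑ (list (left I)) e)
  ... | inj₁ o≤e = inj₁ (degree≤half-left I c o≤e 0<w w≤)
  ... | inj₂ e≤o = inj₂ (degree≤half-left (I ᵀ) {o} {e} c e≤o (subst (0 <_) comm 0<w) (subst (_≤ suc (c + c)) comm w≤))
    where
    comm = +-comm (∑ (list (left I)) e) (∑ (list (right I)) o)

  -- The weighted degrees of both sides add up to twice the number of edges, so they cannot all
  -- exceed the average. Multiplying by the weight avoids division.
  ≤average-exists : ∀ I e o → 0 < weight I e o →
                    SomeDegree I e o (λ d → weight I e o * d ≤ 2 * edges I e o)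
  ≤average-exists I e o 0<w = decidable-stable (someDegree? I e o (λ d → w * d ≤? 2 * q)) λ none →
    let above = λ {d} (¬p : ¬ w * d ≤ 2 * q) → ≰⇒> ¬p
        l = sum-above I e o (λ t 0<et → above λ p → none (inj₁ (t , 0<et , p)))
        r = subst (∑ (list (right I)) o * suc (2 * q) ≤_) (cong (w *_) (sym (edges-ᵀ I e o)))
              (sum-above (I ᵀ) o e (λ s 0<os → above λ p → none (inj₂ (s , 0<os , p))))
    in <⇒≱ (*-monoʳ-< w {{>-nonZero 0<w}} (n<1+n (2 * q)))
         (subst₂ _≤_ (sym (*-distribʳ-+ (suc (2 * q)) (∑ (list (left I)) e) (∑ (list (right I)) o))) (twice w q) (+-mono-≤ l r))
    where
    w = weight I e o
    q = edges I e o
    twice : ∀ w q → w * q + w * q ≡ w * (2 * q)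
    twice = solve-∀
    exchange : ∀ a b c → a * (b * c) ≡ b * (a * c)
    exchange = solve-∀
    sum-above : ∀ I e o → (∀ t → 0 < e t → suc (2 * q) ≤ w * degree I o t) →
                ∑ (list (left I)) e * suc (2 * q) ≤ w * edges I e o
    sum-above I e o above = begin
      ∑ Ls e * suc (2 * q)                       ≡⟨ sym (∑-*ʳ Ls _ e) ⟩
      ∑ Ls (λ t → e t * suc (2 * q))             ≤⟨ ∑-mono Ls times ⟩
      ∑ Ls (λ t → e t * (w * degree I o t))      ≡⟨ ∑-cong Ls (λ t → exchange (e t) w _) ⟩
      ∑ Ls (λ t → w * (e t * degree I o t))      ≡⟨ ∑-*ˡ Ls w _ ⟩
      w * edges I e o                            ∎
      where
      open ≤-Reasoning
      Ls = list (left I)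
      times : ∀ t → e t * suc (2 * q) ≤ e t * (w * degree I o t)
      times t with e t | above t
      ... | zero  | _ = z≤n
      ... | suc k | p = *-monoʳ-≤ (suc k) (p (s≤s z≤n))

  record Removal (I : Incidence) (e : L I → ℕ) (o : R I → ℕ) (P : ℕ → Set) : Set where
    field
      {e′}     : L I → ℕ
      {o′}     : R I → ℕ
      {d}      : ℕ
      small    : P d
      bounded′ : Bounded I e o → Bounded I e′ o′
      weight≡  : weight I e o ≡ suc (weight I e′ o′)
      edges≡   : edges I e o ≡ d + edges I e′ o′

  removal : ∀ I e o {P} → SomeDegree I e o P → Removal I e o P
  removal I e o (inj₁ (t , 0<et , p)) = record
    { small = p
    ; bounded′ = λ b → bounded (λ x → ≤-trans (decrement-≤ (left I) t e x) (left≤2 b x)) (right≤2 b)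
    ; weight≡ = cong (_+ ∑ (list (right I)) o) (∑-decrement₁ (left I) t e 0<et)
    ; edges≡ = ∑-decrement (left I) t e 0<et (degree I o)
    }
  removal I e o (inj₂ (s , 0<os , p)) = record
    { small = p
    ; bounded′ = λ b → bounded (left≤2 b) (λ x → ≤-trans (decrement-≤ (right I) s o x) (right≤2 b x))
    ; weight≡ = trans (cong (∑ (list (left I)) e +_) (∑-decrement₁ (right I) s o 0<os)) (+-suc (∑ (list (left I)) e) _)
    ; edges≡ = trans (edges-ᵀ I e o)
        (trans (∑-decrement (right I) s o 0<os (degree (I ᵀ) e))
               (cong (degree (I ᵀ) e s +_) (sym (edges-ᵀ I e (decrement (right I) s o)))))
    }

  -- The values up to 14 bound the number of edges spanned by k vertices; the others are junk.
  maxEdges : ℕ → ℕ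
  maxEdges 2  = 1
  maxEdges 3  = 2
  maxEdges 4  = 4
  maxEdges 5  = 6
  maxEdges 6  = 8
  maxEdges 7  = 10
  maxEdges 8  = 12
  maxEdges 9  = 14
  maxEdges 10 = 17
  maxEdges 11 = 20
  maxEdges 12 = 24
  maxEdges 13 = 28
  maxEdges 14 = 32
  maxEdges _  = 0

  -- Induction by deleting one vertex of small degree. Its existence comes from the lighter side up
  -- to weight 3, from the absence of 4-cycles for weights 4 to 9, and from averaging for weights 10
  -- to 14.
  edges≤maxEdges : ∀ k → k ≤ 14 → ∀ I {e o} → Bounded I e o → weight I e o ≡ k → edges I e o ≤ maxEdges k
  edges≤maxEdges zero _ I {e} {o} b w≡0 = ≤-trans
    (∑-mono (list (left I)) (λ t → *-monoˡ-≤ (degree I o t)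
      (≤-trans (≤-∑ e (complete (left I) t)) (≤-trans (m≤m+n _ _) (≤-reflexive w≡0)))))
    (≤-reflexive (∑-zero (list (left I))))
  edges≤maxEdges (suc k) k<14 I {e} {o} b w≡ = step k k<14 refl
    where
    w>0 : 0 < weight I e o
    w>0 = subst (0 <_) (sym w≡) (s≤s z≤n)

    extend : ∀ c {P : ℕ → Set} → SomeDegree I e o P →
             (∀ {d q} → P d → edges I e o ≡ d + q → q ≤ maxEdges k → d ≤ c) →
             c + maxEdges k ≤ maxEdges (suc k) → edges I e o ≤ maxEdges (suc k)
    extend c {P} v d≤c c≤ =
      let IH = edges≤maxEdges k (≤-trans (n≤1+n k) k<14) I (bounded′ b) (suc-injective (trans (sym weight≡) w≡))
      in ≤-trans (≤-reflexive edges≡) (≤-trans (+-mono-≤ (d≤c small edges≡ IH) IH) c≤)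
      where open Removal (removal I e o {P} v)

    half : ∀ c → k ≤ c + c → c + maxEdges k ≤ maxEdges (suc k) → edges I e o ≤ maxEdges (suc k)
    half c k≤ = extend c (degree≤half-exists I e o c w>0 (subst (_≤ suc (c + c)) (sym w≡) (s≤s k≤))) (λ p _ _ → p)

    two : k ≤ 8 → 2 + maxEdges k ≤ maxEdges (suc k) → edges I e o ≤ maxEdges (suc k)
    two k≤8 = extend 2 (degree≤2-exists I b w>0 (subst (_≤ 9) (sym w≡) (s≤s k≤8))) (λ p _ _ → p)

    -- Deleting a vertex of degree `d` leaves `q ≤ maxEdges k` edges, so `(k′ + 2) d ≤ 2 (d + q)`
    -- gives `k′ d ≤ 2 maxEdges k`, which excludes `d > c`.
    average : ∀ c {k′} → k ≡ suc k′ → 2 * maxEdges k < k′ * suc c → c + maxEdges k ≤ maxEdges (suc k) →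
              edges I e o ≤ maxEdges (suc k)
    average c {k′} k≡ M< = extend c (≤average-exists I e o w>0) λ {d} {q} p q≡ q≤ → ≮⇒≥ λ c<d →
      <⇒≱ M< (≤-trans (*-monoʳ-≤ k′ c<d)
        (+-cancelˡ-≤ (2 * d) _ _ (begin
          2 * d + k′ * d            ≡⟨ distrib k′ d ⟩
          suc (suc k′) * d          ≡⟨ cong (_* d) (sym (trans w≡ (cong suc k≡))) ⟩
          weight I e o * d          ≤⟨ p ⟩
          2 * edges I e o           ≡⟨ cong (2 *_) q≡ ⟩
          2 * (d + q)               ≤⟨ *-monoʳ-≤ 2 (+-monoʳ-≤ d q≤) ⟩
          2 * (d + maxEdges k)      ≡⟨ *-distribˡ-+ 2 d _ ⟩
          2 * d + 2 * maxEdges k    ∎)))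
      where
      open ≤-Reasoning
      distrib : ∀ k d → 2 * d + k * d ≡ suc (suc k) * d
      distrib = solve-∀

    step : ∀ j → j < 14 → k ≡ j → edges I e o ≤ maxEdges (suc k)
    step 0  _ refl = half 0 ≤-check ≤-check
    step 1  _ refl = half 1 ≤-check ≤-check
    step 2  _ refl = half 1 ≤-check ≤-check
    step 3  _ refl = two ≤-check ≤-check
    step 4  _ refl = two ≤-check ≤-check
    step 5  _ refl = two ≤-check ≤-check
    step 6  _ refl = two ≤-check ≤-check
    step 7  _ refl = two ≤-check ≤-check
    step 8  _ refl = two ≤-check ≤-check
    step 9  _ refl = average 3 refl ≤-check ≤-check
    step 10 _ refl = average 3 refl ≤-check ≤-check
    step 11 _ refl = average 4 refl ≤-check ≤-check
    step 12 _ refl = average 4 refl ≤-check ≤-check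
    step 13 _ refl = average 4 refl ≤-check ≤-check
    step (suc (suc (suc (suc (suc (suc (suc (suc (suc (suc (suc (suc (suc (suc _)))))))))))))) j<14 _ =
      contradiction j<14 (≤⇒≯ (m≤m+n 14 _))

-- The quotient of the balanced hypercube by twins

fin4 : Enumeration (Fin 4)
fin4 = record { list = allFin 4 ; complete = ∈-allFin ; unique = Unique.allFin⁺ 4 ; _≟_ = _≟ᶠ_ }

allVecs : ∀ m → List (Vec (Fin 4) m)
allVecs zero    = [] ∷ []
allVecs (suc m) = cartesianProductWith _∷_ (allFin 4) (allVecs m)

∈-allVecs : ∀ {m} (u : Vec (Fin 4) m) → u ∈ allVecs m
∈-allVecs []      = here refl
∈-allVecs (a ∷ u) = ∈-cartesianProductWith⁺ _∷_ (∈-allFin a) (∈-allVecs u)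

allVecs-unique : ∀ m → Unique (allVecs m)
allVecs-unique zero    = [] ∷ []
allVecs-unique (suc m) = Unique.cartesianProductWith⁺ _∷_ ∷-injective (Unique.allFin⁺ 4) (allVecs-unique m)

vecs : ∀ m → Enumeration (Vec (Fin 4) m)
vecs m = record { list = allVecs m ; complete = ∈-allVecs ; unique = allVecs-unique m ; _≟_ = _≟ᵛ_ }

Σ₄ : (Fin 4 → ℕ) → ℕ
Σ₄ = ∑ (allFin 4)

Σᵛ : ∀ {m} → (Vec (Fin 4) m → ℕ) → ℕ
Σᵛ {m} = ∑ (allVecs m)

Σᵛ-∷ : ∀ {m} (f : Vec (Fin 4) (suc m) → ℕ) → Σᵛ f ≡ Σ₄ λ a → Σᵛ λ u → f (a ∷ u)
Σᵛ-∷ {m} = ∑-cartesianProductWith _∷_ (allFin 4) (allVecs m)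

Σᵛ-const : ∀ m c → Σᵛ {m} (λ _ → c) ≡ 4 ^ m * c
Σᵛ-const zero    c = refl
Σᵛ-const (suc m) c = begin
  Σᵛ {suc m} (λ _ → c)                      ≡⟨ Σᵛ-∷ {m} (λ _ → c) ⟩
  Σ₄ (λ _ → Σᵛ {m} (λ _ → c))               ≡⟨ ∑-const (allFin 4) (Σᵛ {m} (λ _ → c)) ⟩
  4 * Σᵛ {m} (λ _ → c)                      ≡⟨ cong (4 *_) (Σᵛ-const m c) ⟩
  4 * (4 ^ m * c)                           ≡⟨ sym (*-assoc 4 (4 ^ m) c) ⟩
  4 ^ suc m * c                             ∎
  where open ≡-Reasoning

-- Twin classes of opposite parity are adjacent iff their tails t (even class) and s (odd class)
-- satisfy Near t s.
Near : ∀ {m} → Vec (Fin 4) m → Vec (Fin 4) m → Set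
Near t s = s ≡ t ⊎ ∃ λ i → s ≡ t [ i ]%= inc

near? : ∀ {m} (t s : Vec (Fin 4) m) → Dec (Near t s)
near? t s = (s ≟ᵛ t) ⊎-dec any? (λ i → s ≟ᵛ (t [ i ]%= inc))

Near-∷⁻ : ∀ {m a b} {u v : Vec (Fin 4) m} → Near (a ∷ u) (b ∷ v) → (a ≡ b × Near u v) ⊎ (inc a ≡ b × u ≡ v)
Near-∷⁻ (inj₁ refl)           = inj₁ (refl , inj₁ refl)
Near-∷⁻ (inj₂ (zero  , refl)) = inj₂ (refl , refl)
Near-∷⁻ (inj₂ (suc i , refl)) = inj₁ (refl , inj₂ (i , refl))

Near-∷⁺ : ∀ {m a b} {u v : Vec (Fin 4) m} → (a ≡ b × Near u v) ⊎ (inc a ≡ b × u ≡ v) → Near (a ∷ u) (b ∷ v)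
Near-∷⁺ (inj₁ (refl , inj₁ refl))       = inj₁ refl
Near-∷⁺ (inj₁ (refl , inj₂ (i , refl))) = inj₂ (suc i , refl)
Near-∷⁺ (inj₂ (refl , refl))            = inj₂ (zero , refl)

inc²-≢ : ∀ a → a ≢ inc (inc a)
inc²-≢ 0F ()
inc²-≢ 1F ()
inc²-≢ 2F ()
inc²-≢ 3F ()

-- Each incidence either stays in its layer or crosses to the next one, keeping the rest of the
-- tail. If all four stay, induct on the tail. Two crossings at a common vertex lead to the same
-- vertex. All other patterns would make a first coordinate equal to itself plus 1 or plus 2 modulo
-- 4.
Near-C₄-free : ∀ {m} {t t′ s s′ : Vec (Fin 4) m} →
               Near t s → Near t s′ → Near t′ s → Near t′ s′ → t ≡ t′ ⊎ s ≡ s′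
Near-C₄-free {t = []} {[]} _ _ _ _ = inj₁ refl
Near-C₄-free {t = a ∷ _} {_ ∷ _} {_ ∷ _} {_ ∷ _} ts ts′ t′s t′s′
  with Near-∷⁻ ts | Near-∷⁻ ts′ | Near-∷⁻ t′s | Near-∷⁻ t′s′
... | inj₁ (refl , p)    | inj₁ (refl , q)    | inj₁ (refl , r)    | inj₁ (refl , w)    =
  Sum.map (cong (_ ∷_)) (cong (_ ∷_)) (Near-C₄-free p q r w)
... | inj₁ (refl , _)    | inj₁ (refl , _)    | inj₁ (refl , _)    | inj₂ (x , _)       = ⊥-elim (≢-inc _ (sym x))
... | inj₁ (refl , _)    | inj₁ (refl , _)    | inj₂ (x , _)       | inj₁ (refl , _)    = ⊥-elim (≢-inc _ (sym x))
... | inj₁ (refl , _)    | inj₁ (refl , _)    | inj₂ (refl , refl) | inj₂ (_ , refl)    = inj₂ refl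
... | inj₁ (refl , _)    | inj₂ (refl , refl) | inj₁ (refl , _)    | inj₁ (x , _)       = ⊥-elim (≢-inc _ x)
... | inj₁ (refl , _)    | inj₂ (refl , refl) | inj₁ (refl , _)    | inj₂ (_ , refl)    = inj₁ refl
... | inj₁ (refl , _)    | inj₂ (refl , _)    | inj₂ (refl , _)    | inj₁ (x , _)       = ⊥-elim (inc²-≢ _ x)
... | inj₁ (refl , _)    | inj₂ (refl , _)    | inj₂ (refl , _)    | inj₂ (x , _)       = ⊥-elim (≢-inc _ x)
... | inj₂ (refl , _)    | inj₁ (refl , _)    | inj₁ (refl , _)    | inj₁ (x , _)       = ⊥-elim (≢-inc _ (sym x))
... | inj₂ (refl , _)    | inj₁ (refl , _)    | inj₁ (refl , _)    | inj₂ (x , _)       = ⊥-elim (inc²-≢ _ (sym x))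
... | inj₂ (refl , refl) | inj₁ (refl , _)    | inj₂ (x , refl)    | inj₁ (refl , _)    = inj₁ refl
... | inj₂ (refl , _)    | inj₁ (refl , _)    | inj₂ (x , _)       | inj₂ (y , _)       =
  ⊥-elim (≢-inc _ (trans (sym y) x))
... | inj₂ (refl , refl) | inj₂ (refl , refl) | inj₁ (refl , _)    | inj₁ (_ , _)       = inj₂ refl
... | inj₂ (refl , _)    | inj₂ (refl , _)    | inj₁ (refl , _)    | inj₂ (x , _)       = ⊥-elim (≢-inc _ (sym x))
... | inj₂ (refl , _)    | inj₂ (refl , _)    | inj₂ (x , _)       | inj₁ (y , _)       =
  ⊥-elim (≢-inc _ (trans y (sym x)))
... | inj₂ (refl , refl) | inj₂ (refl , refl) | inj₂ (x , refl)    | inj₂ (_ , _)       = inj₂ refl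

tails : ℕ → Incidence
tails m = record
  { left = vecs m ; right = vecs m ; incident = λ t s → 𝟙 (near? t s) ; ≤1 = λ t s → 𝟙≤1 (near? t s)
  ; C₄-free = λ p q r w → Near-C₄-free (𝟙-positive (near? _ _) p) (𝟙-positive (near? _ _) q)
                                       (𝟙-positive (near? _ _) r) (𝟙-positive (near? _ _) w) }

𝟙-exclusive-⊎ : ∀ {P A B C D : Set} (p : Dec P) (a : Dec A) (b : Dec B) (c : Dec C) (d : Dec D) →
  (P → (A × B) ⊎ (C × D)) → ((A × B) ⊎ (C × D) → P) → ¬ (A × C) → 𝟙 p ≡ 𝟙 a * 𝟙 b + 𝟙 c * 𝟙 d
𝟙-exclusive-⊎ p (yes a) _ (yes c) _ _ _ ¬ac = ⊥-elim (¬ac (a , c))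
𝟙-exclusive-⊎ p (yes a) (yes b) (no ¬c) _ _ from _ = 𝟙-yes p (from (inj₁ (a , b)))
𝟙-exclusive-⊎ p (yes a) (no ¬b) (no ¬c) _ to _ _ = 𝟙-no p ([ ¬b ∘ proj₂ , ¬c ∘ proj₁ ]′ ∘ to)
𝟙-exclusive-⊎ p (no ¬a) _ (yes c) (yes d) _ from _ = 𝟙-yes p (from (inj₂ (c , d)))
𝟙-exclusive-⊎ p (no ¬a) _ (yes c) (no ¬d) to _ _ = 𝟙-no p ([ ¬a ∘ proj₁ , ¬d ∘ proj₂ ]′ ∘ to)
𝟙-exclusive-⊎ p (no ¬a) _ (no ¬c) _ to _ _ = 𝟙-no p ([ ¬a ∘ proj₁ , ¬c ∘ proj₁ ]′ ∘ to)

incident-∷ : ∀ {m} a b (u v : Vec (Fin 4) m) →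
  𝟙 (near? (a ∷ u) (b ∷ v)) ≡ 𝟙 (a ≟ᶠ b) * 𝟙 (near? u v) + 𝟙 (inc a ≟ᶠ b) * 𝟙 (u ≟ᵛ v)
incident-∷ a b u v = 𝟙-exclusive-⊎ (near? (a ∷ u) (b ∷ v)) (a ≟ᶠ b) (near? u v) (inc a ≟ᶠ b) (u ≟ᵛ v)
  Near-∷⁻ Near-∷⁺ (λ (a≡b , inca≡b) → ≢-inc a (trans a≡b (sym inca≡b)))

-- An even class has exactly one neighbour outside its own layer, with the same remaining tail in
-- the next layer. This is the recursive structure behind `degree-of-even` and `cut-∷`.
∑-neighbours-∷ : ∀ {m} a (u : Vec (Fin 4) m) (f : Vec (Fin 4) (suc m) → ℕ) →
  Σᵛ (λ s → 𝟙 (near? (a ∷ u) s) * f s) ≡ Σᵛ (λ v → 𝟙 (near? u v) * f (a ∷ v)) + f (inc a ∷ u)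
∑-neighbours-∷ {m} a u f = begin
  Σᵛ (λ s → 𝟙 (near? (a ∷ u) s) * f s)
    ≡⟨ Σᵛ-∷ {m} _ ⟩
  Σ₄ (λ b → Σᵛ λ v → 𝟙 (near? (a ∷ u) (b ∷ v)) * f (b ∷ v))
    ≡⟨ ∑-cong (allFin 4) (λ b → trans (∑-cong vs (λ v → expand b v))
         (∑-distrib-+ vs (λ v → 𝟙 (a ≟ᶠ b) * same b v) (λ v → 𝟙 (inc a ≟ᶠ b) * next b v))) ⟩
  Σ₄ (λ b → Σᵛ (λ v → 𝟙 (a ≟ᶠ b) * same b v) + Σᵛ (λ v → 𝟙 (inc a ≟ᶠ b) * next b v))
    ≡⟨ ∑-cong (allFin 4) (λ b → cong₂ _+_ (∑-*ˡ vs (𝟙 (a ≟ᶠ b)) (same b)) (∑-*ˡ vs (𝟙 (inc a ≟ᶠ b)) (next b))) ⟩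
  Σ₄ (λ b → 𝟙 (a ≟ᶠ b) * Σᵛ (same b) + 𝟙 (inc a ≟ᶠ b) * Σᵛ (next b))
    ≡⟨ ∑-distrib-+ (allFin 4) (λ b → 𝟙 (a ≟ᶠ b) * Σᵛ (same b)) (λ b → 𝟙 (inc a ≟ᶠ b) * Σᵛ (next b)) ⟩
  Σ₄ (λ b → 𝟙 (a ≟ᶠ b) * Σᵛ (same b)) + Σ₄ (λ b → 𝟙 (inc a ≟ᶠ b) * Σᵛ (next b))
    ≡⟨ cong₂ _+_ (∑-point fin4 a (Σᵛ ∘ same)) (trans (∑-point fin4 (inc a) (Σᵛ ∘ next)) (∑-point (vecs m) u (λ v → f (inc a ∷ v)))) ⟩
  Σᵛ (λ v → 𝟙 (near? u v) * f (a ∷ v)) + f (inc a ∷ u) ∎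
  where
  open ≡-Reasoning
  open Enumeration using (∑-point)
  vs = allVecs m
  same next : Fin 4 → Vec (Fin 4) m → ℕ
  same b v = 𝟙 (near? u v) * f (b ∷ v)
  next b v = 𝟙 (u ≟ᵛ v) * f (b ∷ v)
  regroup : ∀ p q r t x → (p * q + r * t) * x ≡ p * (q * x) + r * (t * x)
  regroup = solve-∀
  expand : ∀ b v → 𝟙 (near? (a ∷ u) (b ∷ v)) * f (b ∷ v) ≡ 𝟙 (a ≟ᶠ b) * same b v + 𝟙 (inc a ≟ᶠ b) * next b v
  expand b v = trans (cong (_* f (b ∷ v)) (incident-∷ a b u v))
                     (regroup (𝟙 (a ≟ᶠ b)) (𝟙 (near? u v)) (𝟙 (inc a ≟ᶠ b)) (𝟙 (u ≟ᵛ v)) (f (b ∷ v)))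

degree-of-even : ∀ {m} (t : Vec (Fin 4) m) → Σᵛ (λ s → 𝟙 (near? t s)) ≡ suc m
degree-of-even []      = refl
degree-of-even {suc m} (a ∷ u) = begin
  Σᵛ (λ s → 𝟙 (near? (a ∷ u) s))            ≡⟨ ∑-cong (allVecs (suc m)) (λ s → sym (*-identityʳ (𝟙 (near? (a ∷ u) s)))) ⟩
  Σᵛ (λ s → 𝟙 (near? (a ∷ u) s) * 1)        ≡⟨ ∑-neighbours-∷ a u (λ _ → 1) ⟩
  Σᵛ (λ v → 𝟙 (near? u v) * 1) + 1          ≡⟨ cong (_+ 1) (∑-cong (allVecs m) (λ v → *-identityʳ (𝟙 (near? u v)))) ⟩
  Σᵛ (λ v → 𝟙 (near? u v)) + 1              ≡⟨ cong (_+ 1) (degree-of-even u) ⟩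
  suc m + 1                                 ≡⟨ +-comm (suc m) 1 ⟩
  suc (suc m)                               ∎
  where open ≡-Reasoning

degree-of-odd : ∀ {m} (s : Vec (Fin 4) m) → Σᵛ (λ t → 𝟙 (near? t s)) ≡ suc m
degree-of-odd []          = refl
degree-of-odd {suc m} (b ∷ v) = begin
  Σᵛ (λ t → 𝟙 (near? t (b ∷ v)))
    ≡⟨ Σᵛ-∷ {m} _ ⟩
  Σ₄ (λ a → Σᵛ λ u → 𝟙 (near? (a ∷ u) (b ∷ v)))
    ≡⟨ ∑-cong (allFin 4) (λ a → trans (∑-cong vs (λ u → incident-∷ a b u v))
         (trans (∑-distrib-+ vs (λ u → 𝟙 (a ≟ᶠ b) * 𝟙 (near? u v)) (λ u → 𝟙 (inc a ≟ᶠ b) * 𝟙 (u ≟ᵛ v)))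
                (cong₂ _+_ (∑-*ˡ vs (𝟙 (a ≟ᶠ b)) (λ u → 𝟙 (near? u v))) (∑-*ˡ vs (𝟙 (inc a ≟ᶠ b)) (λ u → 𝟙 (u ≟ᵛ v)))))) ⟩
  Σ₄ (λ a → 𝟙 (a ≟ᶠ b) * Σᵛ (λ u → 𝟙 (near? u v)) + 𝟙 (inc a ≟ᶠ b) * Σᵛ (λ u → 𝟙 (u ≟ᵛ v)))
    ≡⟨ ∑-cong (allFin 4) (λ a → cong₂ _+_ (cong (𝟙 (a ≟ᶠ b) *_) (degree-of-odd v))
         (trans (cong (𝟙 (inc a ≟ᶠ b) *_) one) (*-identityʳ (𝟙 (inc a ≟ᶠ b))))) ⟩
  Σ₄ (λ a → 𝟙 (a ≟ᶠ b) * suc m + 𝟙 (inc a ≟ᶠ b))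
    ≡⟨ four b ⟩
  suc (suc m) ∎
  where
  open ≡-Reasoning
  vs = allVecs m
  𝟙-sym : ∀ u → 𝟙 (u ≟ᵛ v) ≡ 𝟙 (v ≟ᵛ u) * 1
  𝟙-sym u with v ≟ᵛ u
  ... | yes v≡u = 𝟙-yes (u ≟ᵛ v) (sym v≡u)
  ... | no v≢u  = 𝟙-no (u ≟ᵛ v) (v≢u ∘ sym)
  one : Σᵛ (λ u → 𝟙 (u ≟ᵛ v)) ≡ 1
  one = trans (∑-cong vs 𝟙-sym) (Enumeration.∑-point (vecs m) v (λ _ → 1))
  last : ∀ m → 1 * suc m + 0 + 1 ≡ suc (suc m)
  last = solve-∀
  first : ∀ m → 1 + (1 * suc m + 0 + 0) ≡ suc (suc m)
  first = solve-∀
  -- The layers contributing are `b` and its predecessor; only for `b = 0F` does the predecessor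
  -- come later in the list, hence the two shapes of the sum.
  four : ∀ b → Σ₄ (λ a → 𝟙 (a ≟ᶠ b) * suc m + 𝟙 (inc a ≟ᶠ b)) ≡ suc (suc m)
  four 0F = last m
  four 1F = first m
  four 2F = first m
  four 3F = first m

-- The number of separated pairs among the four edges between two adjacent twin classes, a and b
-- being the numbers of chosen twins.
κ : ℕ → ℕ → ℕ
κ a b = a * (2 ∸ b) + b * (2 ∸ a)

κ-edges : ∀ {a b} → a ≤ 2 → b ≤ 2 → κ a b + 2 * (a * b) ≡ 2 * (a + b)
κ-edges {0} {0} _ _ = refl
κ-edges {0} {1} _ _ = refl
κ-edges {0} {2} _ _ = refl
κ-edges {1} {0} _ _ = refl
κ-edges {1} {1} _ _ = refl
κ-edges {1} {2} _ _ = refl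
κ-edges {2} {0} _ _ = refl
κ-edges {2} {1} _ _ = refl
κ-edges {2} {2} _ _ = refl
κ-edges {suc (suc (suc _))} (s≤s (s≤s ())) _
κ-edges {_} {suc (suc (suc _))} _ (s≤s (s≤s ()))

κ-complement : ∀ {a b} → a ≤ 2 → b ≤ 2 → κ (2 ∸ a) (2 ∸ b) ≡ κ a b
κ-complement {a} {b} a≤2 b≤2 =
  trans (cong₂ (λ x y → (2 ∸ a) * x + (2 ∸ b) * y) (m∸[m∸n]≡n b≤2) (m∸[m∸n]≡n a≤2))
        (rearrange (2 ∸ a) b (2 ∸ b) a)
  where
  rearrange : ∀ x b y a → x * b + y * a ≡ a * y + b * x
  rearrange = solve-∀

κ-sym : ∀ a b → κ a b ≡ κ b a
κ-sym a b = +-comm (a * (2 ∸ b)) _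

-- By `κ-edges` this amounts to `2 a b ≤ 4 b`. Summed over classes, it makes a change of weight
-- between consecutive layers cost boundary edges.
κ-difference : ∀ {a b} → a ≤ 2 → b ≤ 2 → 2 * a ≤ κ a b + 2 * b
κ-difference {a} {b} a≤2 b≤2 = ≤-by (2 * a) (κ a b + 2 * b) 0
  (*-monoʳ-≤ 2 (*-monoˡ-≤ b a≤2))
  (trans (left a b) (trans (cong (_+ 2 * b) (sym (κ-edges a≤2 b≤2))) (right (κ a b) a b)))
  where
  left : ∀ a b → 2 * a + 2 * (2 * b) + 0 ≡ 2 * (a + b) + 2 * b
  left = solve-∀
  right : ∀ k a b → k + 2 * (a * b) + 2 * b ≡ 2 * (a * b) + (k + 2 * b)
  right = solve-∀

cut : ∀ m → (Vec (Fin 4) m → ℕ) → (Vec (Fin 4) m → ℕ) → ℕ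
cut m e o = Σᵛ λ t → Σᵛ λ s → 𝟙 (near? t s) * κ (e t) (o s)

module _ {m : ℕ} where

  private
    Vs = allVecs m

  open Bounded

  -- Every chosen vertex has `2 (m + 1)` edges; a boundary edge is met from one chosen end and a
  -- spanned edge from both.
  cut-edges : ∀ {e o} → Bounded (tails m) e o →
              cut m e o + 2 * edges (tails m) e o ≡ 2 * suc m * weight (tails m) e o
  cut-edges {e} {o} b = begin
    cut m e o + 2 * edges (tails m) e o
      ≡⟨ cong (cut m e o +_) (sym edges₂) ⟩
    cut m e o + Σᵛ (λ t → Σᵛ λ s → 2 * (e t * (o s * 𝟙 (near? t s))))
      ≡⟨ sym (∑₂-distrib-+ cut₂ edge₂) ⟩
    Σᵛ (λ t → Σᵛ λ s → 𝟙 (near? t s) * κ (e t) (o s) + 2 * (e t * (o s * 𝟙 (near? t s))))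
      ≡⟨ ∑-cong Vs (λ t → ∑-cong Vs (λ s → pointwise (𝟙 (near? t s)) (e t) (o s) (left≤2 b t) (right≤2 b s))) ⟩
    Σᵛ (λ t → Σᵛ λ s → 2 * e t * 𝟙 (near? t s) + 2 * o s * 𝟙 (near? t s))
      ≡⟨ ∑₂-distrib-+ (λ t s → 2 * e t * 𝟙 (near? t s)) (λ t s → 2 * o s * 𝟙 (near? t s)) ⟩
    Σᵛ (λ t → Σᵛ λ s → 2 * e t * 𝟙 (near? t s)) + Σᵛ (λ t → Σᵛ λ s → 2 * o s * 𝟙 (near? t s))
      ≡⟨ cong₂ _+_ (∑-cong Vs (λ t → trans (∑-*ˡ Vs (2 * e t) (λ s → 𝟙 (near? t s))) (cong (2 * e t *_) (degree-of-even t))))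
                   (trans (∑-swap Vs Vs _) (∑-cong Vs (λ s →
                     trans (∑-*ˡ Vs (2 * o s) (λ t → 𝟙 (near? t s))) (cong (2 * o s *_) (degree-of-odd s))))) ⟩
    Σᵛ (λ t → 2 * e t * suc m) + Σᵛ (λ s → 2 * o s * suc m)
      ≡⟨ cong₂ _+_ (factor e) (factor o) ⟩
    2 * Σᵛ e * suc m + 2 * Σᵛ o * suc m
      ≡⟨ collect (Σᵛ e) (Σᵛ o) m ⟩
    2 * suc m * (Σᵛ e + Σᵛ o) ∎
    where
    open ≡-Reasoning
    ∑₂-distrib-+ : ∀ (f g : Vec (Fin 4) m → Vec (Fin 4) m → ℕ) →
      Σᵛ (λ t → Σᵛ λ s → f t s + g t s) ≡ Σᵛ (λ t → Σᵛ (f t)) + Σᵛ (λ t → Σᵛ (g t))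
    ∑₂-distrib-+ f g = trans (∑-cong Vs (λ t → ∑-distrib-+ Vs (f t) (g t))) (∑-distrib-+ Vs _ _)
    cut₂ edge₂ : Vec (Fin 4) m → Vec (Fin 4) m → ℕ
    cut₂ t s = 𝟙 (near? t s) * κ (e t) (o s)
    edge₂ t s = 2 * (e t * (o s * 𝟙 (near? t s)))
    edges₂ : Σᵛ (λ t → Σᵛ λ s → 2 * (e t * (o s * 𝟙 (near? t s)))) ≡ 2 * edges (tails m) e o
    edges₂ = trans (∑-cong Vs (λ t → trans (∑-*ˡ Vs 2 _) (cong (2 *_) (∑-*ˡ Vs (e t) _)))) (∑-*ˡ Vs 2 _)
    factor : ∀ f → Σᵛ (λ t → 2 * f t * suc m) ≡ 2 * Σᵛ f * suc m
    factor f = trans (∑-*ʳ Vs (suc m) (λ t → 2 * f t)) (cong (_* suc m) (∑-*ˡ Vs 2 f))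
    collect : ∀ x y m → 2 * x * suc m + 2 * y * suc m ≡ 2 * suc m * (x + y)
    collect = solve-∀
    expandˡ : ∀ i k x y → i * k + 2 * (x * (y * i)) ≡ i * (k + 2 * (x * y))
    expandˡ = solve-∀
    expandʳ : ∀ i x y → i * (2 * (x + y)) ≡ 2 * x * i + 2 * y * i
    expandʳ = solve-∀
    pointwise : ∀ i x y → x ≤ 2 → y ≤ 2 → i * κ x y + 2 * (x * (y * i)) ≡ 2 * x * i + 2 * y * i
    pointwise i x y x≤2 y≤2 = trans (expandˡ i (κ x y) x y)
      (trans (cong (i *_) (κ-edges x≤2 y≤2)) (expandʳ i x y))

  complement : (Vec (Fin 4) m → ℕ) → Vec (Fin 4) m → ℕ
  complement f t = 2 ∸ f t

  bounded-complement : ∀ e o → Bounded (tails m) (complement e) (complement o)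
  bounded-complement e o = bounded (λ t → m∸n≤m 2 (e t)) (λ s → m∸n≤m 2 (o s))

  cut-complement : ∀ {e o} → Bounded (tails m) e o → cut m (complement e) (complement o) ≡ cut m e o
  cut-complement b = ∑-cong Vs λ t → ∑-cong Vs λ s →
    cong (𝟙 (near? t s) *_) (κ-complement (left≤2 b t) (right≤2 b s))

  Σᵛ-complement : ∀ f → (∀ t → f t ≤ 2) → Σᵛ f + Σᵛ (complement f) ≡ 4 ^ m * 2
  Σᵛ-complement f f≤2 = trans (sym (∑-distrib-+ Vs f (complement f)))
    (trans (∑-cong Vs (λ t → m+[n∸m]≡n (f≤2 t))) (Σᵛ-const m 2))

  crossing : (Vec (Fin 4) m → ℕ) → (Vec (Fin 4) m → ℕ) → ℕ
  crossing f g = Σᵛ λ u → κ (f u) (g u)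

  crossing-sym : ∀ f g → crossing f g ≡ crossing g f
  crossing-sym f g = ∑-cong Vs λ u → κ-sym (f u) (g u)

  crossing-≥ : ∀ f g → (∀ t → f t ≤ 2) → (∀ t → g t ≤ 2) → 2 * Σᵛ f ≤ crossing f g + 2 * Σᵛ g
  crossing-≥ f g f≤2 g≤2 = subst₂ _≤_ (∑-*ˡ Vs 2 f)
    (trans (∑-distrib-+ Vs (λ u → κ (f u) (g u)) (λ u → 2 * g u)) (cong (crossing f g +_) (∑-*ˡ Vs 2 g)))
    (∑-mono Vs (λ u → κ-difference (f≤2 u) (g≤2 u)))

layer : ∀ {m} → (Vec (Fin 4) (suc m) → ℕ) → Fin 4 → Vec (Fin 4) m → ℕ
layer f a u = f (a ∷ u)

cut-∷ : ∀ {m} e o → cut (suc m) e o ≡ Σ₄ λ a → cut m (layer e a) (layer o a) + crossing (layer e a) (layer o (inc a))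
cut-∷ {m} e o = begin
  cut (suc m) e o
    ≡⟨ Σᵛ-∷ {m} _ ⟩
  Σ₄ (λ a → Σᵛ λ u → Σᵛ λ s → 𝟙 (near? (a ∷ u) s) * κ (e (a ∷ u)) (o s))
    ≡⟨ ∑-cong (allFin 4) (λ a → trans (∑-cong Vs (λ u → ∑-neighbours-∷ a u (λ s → κ (e (a ∷ u)) (o s))))
                                      (∑-distrib-+ Vs (inner a) (λ u → κ (layer e a u) (layer o (inc a) u)))) ⟩
  Σ₄ (λ a → cut m (layer e a) (layer o a) + crossing (layer e a) (layer o (inc a))) ∎
  where
  open ≡-Reasoning
  Vs = allVecs m
  inner : Fin 4 → Vec (Fin 4) m → ℕ
  inner a u = Σᵛ λ v → 𝟙 (near? u v) * κ (layer e a u) (layer o a v)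

-- Isoperimetry

-- A layer of a vertex set has E even and O odd vertices out of h each, E′ and O′ missing ones, and
-- some boundary edges inside the layer; y boundary edges join two consecutive layers.
record Layer (h : ℕ) : Set where
  field
    E O E′ O′ inside : ℕ
    E+E′≡h : E + E′ ≡ h
    O+O′≡h : O + O′ ≡ h

  mass : ℕ
  mass = E + O

open Layer public using (mass; inside)

-- Even classes of `l` are matched with odd classes of `l′`, each matched pair being a K₂,₂, so `y`
-- is at least twice the difference of the two counts.
record Consecutive {h} (l l′ : Layer h) (y : ℕ) : Set where
  constructor consecutive
  open Layer hiding (inside; mass)
  field
    drop : 2 * E l ≤ y + 2 * O l′
    rise : 2 * O l′ ≤ y + 2 * E l

record Cycle (h : ℕ) : Set where
  field
    l₀ l₁ l₂ l₃ : Layer h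
    y₀ y₁ y₂ y₃ : ℕ
    c₀ : Consecutive l₀ l₁ y₀
    c₁ : Consecutive l₁ l₂ y₁
    c₂ : Consecutive l₂ l₃ y₂
    c₃ : Consecutive l₃ l₀ y₃

total : ∀ {h} → Cycle h → ℕ
total c = (inside l₀ + y₀) + ((inside l₁ + y₁) + ((inside l₂ + y₂) + (inside l₃ + y₃)))
  where open Cycle c

masses : ∀ {h} → Cycle h → ℕ
masses c = mass l₀ + (mass l₁ + (mass l₂ + mass l₃))
  where open Cycle c

rotate : ∀ {h} → Cycle h → Cycle h
rotate c = record { l₀ = l₁ ; l₁ = l₂ ; l₂ = l₃ ; l₃ = l₀ ; y₀ = y₁ ; y₁ = y₂ ; y₂ = y₃ ; y₃ = y₀
                  ; c₀ = c₁ ; c₁ = c₂ ; c₂ = c₃ ; c₃ = c₀ }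
  where open Cycle c

private
  rotate-sum : ∀ a b c d → b + (c + (d + a)) ≡ a + (b + (c + d))
  rotate-sum = solve-∀

total-rotate : ∀ {h} (c : Cycle h) → total (rotate c) ≡ total c
total-rotate c = rotate-sum (inside l₀ + y₀) (inside l₁ + y₁) (inside l₂ + y₂) (inside l₃ + y₃)
  where open Cycle c

masses-rotate : ∀ {h} (c : Cycle h) → masses (rotate c) ≡ masses c
masses-rotate c = rotate-sum (mass l₀) (mass l₁) (mass l₂) (mass l₃)
  where open Cycle c

complementᴸ : ∀ {h} → Layer h → Layer h
complementᴸ l = record { E = E′ ; O = O′ ; E′ = E ; O′ = O ; inside = inside l
                       ; E+E′≡h = trans (+-comm E′ E) E+E′≡h ; O+O′≡h = trans (+-comm O′ O) O+O′≡h }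
  where open Layer l using (E; O; E′; O′; E+E′≡h; O+O′≡h)

consecutive-complement : ∀ {h} {l l′ : Layer h} {y} → Consecutive l l′ y → Consecutive (complementᴸ l) (complementᴸ l′) y
consecutive-complement {h} {l} {l′} {y} (consecutive drop rise) = consecutive
  (≤-by (2 * E′ l) (y + 2 * O′ l′) 0 rise (reorder (E l) (E′ l) (O l′) (O′ l′) y (trans (E+E′≡h l) (sym (O+O′≡h l′)))))
  (≤-by (2 * O′ l′) (y + 2 * E′ l) 0 drop (reorder (O l′) (O′ l′) (E l) (E′ l) y (trans (O+O′≡h l′) (sym (E+E′≡h l)))))
  where
  open Layer hiding (inside; mass)
  reorder : ∀ a a′ b b′ y → a + a′ ≡ b + b′ → 2 * a′ + (y + 2 * a) + 0 ≡ 2 * b + (y + 2 * b′)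
  reorder a a′ b b′ y eq = trans (left a a′ y) (trans (cong (λ k → 2 * k + y) eq) (right b b′ y))
    where
    left : ∀ a a′ y → 2 * a′ + (y + 2 * a) + 0 ≡ 2 * (a + a′) + y
    left = solve-∀
    right : ∀ b b′ y → 2 * (b + b′) + y ≡ 2 * b + (y + 2 * b′)
    right = solve-∀

complementᶜ : ∀ {h} → Cycle h → Cycle h
complementᶜ c = record
  { l₀ = complementᴸ l₀ ; l₁ = complementᴸ l₁ ; l₂ = complementᴸ l₂ ; l₃ = complementᴸ l₃
  ; y₀ = y₀ ; y₁ = y₁ ; y₂ = y₂ ; y₃ = y₃
  ; c₀ = consecutive-complement c₀ ; c₁ = consecutive-complement c₁
  ; c₂ = consecutive-complement c₂ ; c₃ = consecutive-complement c₃ }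
  where open Cycle c

-- τ is the gain of a nearly empty layer beyond the two boundary edges per vertex that compensate
-- for emptying it.
module LayerBound
  {h T T′ K τ : ℕ}
  (two-middle : T ≤ T′ + T′)
  (change     : T ≤ h + h)
  -- `k` is the mass of the middle layer and `r` that of the three others, each below `K`; hence the
  -- 3. Masses below 15 are left to `maxEdges`.
  (one-middle : ∀ k r → 15 ≤ k + r → r + 3 ≤ 3 * K → T ≤ T′ + 2 * k + τ * r)
  (no-middle  : ∀ k → 15 ≤ k → k + 4 ≤ 4 * K → T ≤ (2 + τ) * k)
  where

  record Low (l : Layer h) : Set where
    constructor low
    field
      few   : mass l < K
      bound : (2 + τ) * mass l ≤ inside l

  data Kind (l : Layer h) : Set where
    middle : T′ ≤ inside l → Kind l
    empty  : Low l → Kind l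
    full   : Low (complementᴸ l) → Kind l

  open Cycle

  rotated : (c : Cycle h) → T ≤ total (rotate c) → T ≤ total c
  rotated c = subst (T ≤_) (total-rotate c)

  rotated² : (c : Cycle h) → T ≤ total (rotate (rotate c)) → T ≤ total c
  rotated² c p = rotated c (rotated (rotate c) p)

  rotated³ : (c : Cycle h) → T ≤ total (rotate (rotate (rotate c))) → T ≤ total c
  rotated³ c p = rotated c (rotated² (rotate c) p)

  masses-rotate-≥ : ∀ {k} (c : Cycle h) → k ≤ masses c → k ≤ masses (rotate c)
  masses-rotate-≥ {k} c = subst (k ≤_) (sym (masses-rotate c))

  private
    pick₂ : ∀ {a b} p q r s t u → T ≤ a + b → a ≤ p → b ≤ q → T ≤ (p + r) + ((q + s) + (t + u))
    pick₂ {a} {b} p q r s t u T≤ a≤p b≤q = ≤-by T ((p + r) + ((q + s) + (t + u))) (r + s + t + u)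
      (≤-trans T≤ (+-mono-≤ a≤p b≤q)) (eq T p q r s t u)
      where
      eq : ∀ T p q r s t u → T + (p + q) + (r + s + t + u) ≡ T + ((p + r) + ((q + s) + (t + u)))
      eq = solve-∀

  middle₀₁ : ∀ (c : Cycle h) → T′ ≤ inside (l₀ c) → T′ ≤ inside (l₁ c) → T ≤ total c
  middle₀₁ c p q = pick₂ (inside (l₀ c)) (inside (l₁ c)) (y₀ c) (y₁ c) (inside (l₂ c) + y₂ c) (inside (l₃ c) + y₃ c) two-middle p q

  middle₀₂ : ∀ (c : Cycle h) → T′ ≤ inside (l₀ c) → T′ ≤ inside (l₂ c) → T ≤ total c
  middle₀₂ c p q = subst (T ≤_) (eq (inside (l₀ c) + y₀ c) (inside (l₁ c) + y₁ c) (inside (l₂ c) + y₂ c) (inside (l₃ c) + y₃ c))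
    (pick₂ (inside (l₀ c)) (inside (l₂ c)) (y₀ c) (y₂ c) (inside (l₁ c) + y₁ c) (inside (l₃ c) + y₃ c) two-middle p q)
    where
    eq : ∀ a b c d → a + (c + (b + d)) ≡ a + (b + (c + d))
    eq = solve-∀

  -- If `l` were empty and `l′` full, `rise` alone would give `2 h`. Each even vertex present in `l`
  -- and each odd one missing from `l′` costs 2, and the boundary edges inside the two layers repay
  -- it.
  low-change : ∀ {l l′ : Layer h} {y} → Consecutive l l′ y → Low l → Low (complementᴸ l′) → h + h ≤ inside l + y + inside l′
  low-change {l} {l′} {y} (consecutive _ rise) (low _ p) (low _ q) = ≤-by (h + h) (inside l + y + inside l′)
    (2 * O l + τ * (E l + O l) + 2 * E′ l′ + τ * (E′ l′ + O′ l′))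
    (+-mono-≤ p (+-mono-≤ q rise))
    (trans (cong (λ k → k + k + B + s) (sym (O+O′≡h l′)))
      (eq (E l) (O l) (O l′) (E′ l′) (O′ l′) (inside l) y (inside l′) τ))
    where
    open Layer hiding (inside; mass)
    B s : ℕ
    B = inside l + (inside l′ + (y + 2 * E l))
    s = 2 * O l + τ * (E l + O l) + 2 * E′ l′ + τ * (E′ l′ + O′ l′)
    eq : ∀ e o o₁ e′ o′ x y z τ →
      o₁ + o′ + (o₁ + o′) + (x + (z + (y + 2 * e))) + (2 * o + τ * (e + o) + 2 * e′ + τ * (e′ + o′)) ≡
      (2 + τ) * (e + o) + ((2 + τ) * (e′ + o′) + 2 * o₁) + (x + y + z)
    eq = solve-∀

  empty-full : ∀ (c : Cycle h) → Low (l₀ c) → Low (complementᴸ (l₁ c)) → T ≤ total c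
  empty-full c p q = ≤-trans change (≤-trans (low-change (c₀ c) p q) (≤-by _ (total c) _ ≤-refl
    (eq (inside (l₀ c)) (y₀ c) (inside (l₁ c)) (y₁ c) (inside (l₂ c) + y₂ c + (inside (l₃ c) + y₃ c)))))
    where
    eq : ∀ a b c d e → a + b + c + 0 + (d + e) ≡ 0 + (a + b + (c + d + e))
    eq = solve-∀

  full-empty : ∀ (c : Cycle h) → Low (complementᴸ (l₀ c)) → Low (l₁ c) → T ≤ total c
  -- Complementing twice keeps the numbers but not the proof fields definitionally, so the `Low`
  -- record is repacked.
  full-empty c p (low f b) = empty-full (complementᶜ c) p (low f b)

  -- The two crossings at the middle layer contribute `2 E₀ − 2 O₁` and `2 O₀ − 2 E₃`. Two of the
  -- `2 + τ` edges per vertex of the other layers absorb the negative terms, which leaves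
  -- `2 k + τ r` beyond `T′`.
  middle-empty : ∀ (c : Cycle h) → 15 ≤ masses c → T′ ≤ inside (l₀ c) → Low (l₁ c) → Low (l₂ c) → Low (l₃ c) → T ≤ total c
  middle-empty c m≥15 p (low f₁ b₁) (low f₂ b₂) (low f₃ b₃) = ≤-trans
    (one-middle (mass (l₀ c)) (mass (l₁ c) + (mass (l₂ c) + mass (l₃ c))) m≥15
      (subst₂ _≤_ (count (mass (l₁ c)) (mass (l₂ c)) (mass (l₃ c))) (triple K) (+-mono-≤ f₁ (+-mono-≤ f₂ f₃))))
    (≤-by (T′ + 2 * mass (l₀ c) + τ * (mass (l₁ c) + (mass (l₂ c) + mass (l₃ c)))) (total c)
      (2 * E (l₁ c) + 2 * mass (l₂ c) + 2 * O (l₃ c) + (y₁ c + y₂ c))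
      (+-mono-≤ p (+-mono-≤ (Consecutive.drop (c₀ c)) (+-mono-≤ (Consecutive.rise (c₃ c))
        (+-mono-≤ b₁ (+-mono-≤ b₂ b₃)))))
      (eq T′ τ (E (l₀ c)) (O (l₀ c)) (E (l₁ c)) (O (l₁ c)) (mass (l₂ c)) (E (l₃ c)) (O (l₃ c))
          (inside (l₀ c)) (inside (l₁ c)) (inside (l₂ c)) (inside (l₃ c)) (y₀ c) (y₁ c) (y₂ c) (y₃ c)))
    where
    open Layer hiding (inside; mass)
    count : ∀ a b c → suc a + (suc b + suc c) ≡ a + (b + c) + 3
    count = solve-∀
    triple : ∀ k → k + (k + k) ≡ 3 * k
    triple = solve-∀
    eq : ∀ T′ τ e₀ o₀ e₁ o₁ m₂ e₃ o₃ x₀ x₁ x₂ x₃ y₀ y₁ y₂ y₃ →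
      T′ + 2 * (e₀ + o₀) + τ * (e₁ + o₁ + (m₂ + (e₃ + o₃)))
        + (x₀ + (y₀ + 2 * o₁ + (y₃ + 2 * e₃ + (x₁ + (x₂ + x₃)))))
        + (2 * e₁ + 2 * m₂ + 2 * o₃ + (y₁ + y₂))
      ≡ T′ + (2 * e₀ + (2 * o₀ + ((2 + τ) * (e₁ + o₁) + ((2 + τ) * m₂ + (2 + τ) * (e₃ + o₃)))))
        + (x₀ + y₀ + (x₁ + y₁ + (x₂ + y₂ + (x₃ + y₃))))
    eq = solve-∀

  empty-empty : ∀ (c : Cycle h) → 15 ≤ masses c → Low (l₀ c) → Low (l₁ c) → Low (l₂ c) → Low (l₃ c) → T ≤ total c
  empty-empty c m≥15 (low f₀ b₀) (low f₁ b₁) (low f₂ b₂) (low f₃ b₃) = ≤-trans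
    (no-middle (masses c) m≥15
      (subst₂ _≤_ (count (mass (l₀ c)) (mass (l₁ c)) (mass (l₂ c)) (mass (l₃ c))) (quadruple K)
        (+-mono-≤ f₀ (+-mono-≤ f₁ (+-mono-≤ f₂ f₃)))))
    (≤-by ((2 + τ) * masses c) (total c) (y₀ c + y₁ c + y₂ c + y₃ c)
      (+-mono-≤ b₀ (+-mono-≤ b₁ (+-mono-≤ b₂ b₃)))
      (eq τ (mass (l₀ c)) (mass (l₁ c)) (mass (l₂ c)) (mass (l₃ c))
          (inside (l₀ c)) (inside (l₁ c)) (inside (l₂ c)) (inside (l₃ c)) (y₀ c) (y₁ c) (y₂ c) (y₃ c)))
    where
    count : ∀ a b c d → suc a + (suc b + (suc c + suc d)) ≡ a + (b + (c + d)) + 4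
    count = solve-∀
    quadruple : ∀ k → k + (k + (k + k)) ≡ 4 * k
    quadruple = solve-∀
    eq : ∀ τ m₀ m₁ m₂ m₃ x₀ x₁ x₂ x₃ y₀ y₁ y₂ y₃ →
      (2 + τ) * (m₀ + (m₁ + (m₂ + m₃))) + (x₀ + (x₁ + (x₂ + x₃))) + (y₀ + y₁ + y₂ + y₃)
      ≡ (2 + τ) * m₀ + ((2 + τ) * m₁ + ((2 + τ) * m₂ + (2 + τ) * m₃))
        + (x₀ + y₀ + (x₁ + y₁ + (x₂ + y₂ + (x₃ + y₃))))
    eq = solve-∀

  middle₀ : ∀ (c : Cycle h) → 15 ≤ masses c → 15 ≤ masses (complementᶜ c) →
            T′ ≤ inside (l₀ c) → Kind (l₁ c) → Kind (l₂ c) → Kind (l₃ c) → T ≤ total c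
  middle₀ c _ _ p (middle q) _ _ = middle₀₁ c p q
  middle₀ c _ _ p _ (middle q) _ = middle₀₂ c p q
  middle₀ c _ _ p _ _ (middle q) = rotated³ c (middle₀₁ (rotate (rotate (rotate c))) q p)
  middle₀ c _ _ p (empty q) (full r) _ = rotated c (empty-full (rotate c) q r)
  middle₀ c _ _ p (full q) (empty r) _ = rotated c (full-empty (rotate c) q r)
  middle₀ c _ _ p (empty _) (empty r) (full w) = rotated² c (empty-full (rotate (rotate c)) r w)
  middle₀ c _ _ p (full _) (full r) (empty w) = rotated² c (full-empty (rotate (rotate c)) r w)
  middle₀ c a _ p (empty q) (empty r) (empty w) = middle-empty c a p q r w
  middle₀ c _ b p (full q) (full r) (full w) = middle-empty (complementᶜ c) b p q r w

  -- Without a middle layer, either two consecutive layers are of opposite kinds or all four are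
  -- alike; rotation and complementation reduce these cases to `empty-full` and `empty-empty`.
  layer-bound : ∀ (c : Cycle h) → 15 ≤ masses c → 15 ≤ masses (complementᶜ c) →
                Kind (l₀ c) → Kind (l₁ c) → Kind (l₂ c) → Kind (l₃ c) → T ≤ total c
  layer-bound c a b (middle p) k₁ k₂ k₃ = middle₀ c a b p k₁ k₂ k₃
  layer-bound c a b k₀ (middle p) k₂ k₃ = rotated c
    (middle₀ (rotate c) (masses-rotate-≥ c a) (masses-rotate-≥ (complementᶜ c) b) p k₂ k₃ k₀)
  layer-bound c a b k₀ k₁ (middle p) k₃ = rotated² c
    (middle₀ (rotate c′) (masses-rotate-≥ c′ (masses-rotate-≥ c a))
       (masses-rotate-≥ (complementᶜ c′) (masses-rotate-≥ (complementᶜ c) b)) p k₃ k₀ k₁)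
    where c′ = rotate c
  layer-bound c a b k₀ k₁ k₂ (middle p) = rotated³ c
    (middle₀ (rotate c″) (masses-rotate-≥ c″ (masses-rotate-≥ c′ (masses-rotate-≥ c a)))
       (masses-rotate-≥ (complementᶜ c″) (masses-rotate-≥ (complementᶜ c′) (masses-rotate-≥ (complementᶜ c) b)))
       p k₀ k₁ k₂)
    where
    c′ = rotate c
    c″ = rotate c′
  layer-bound c _ _ (empty p) (full q) _ _ = empty-full c p q
  layer-bound c _ _ (full p) (empty q) _ _ = full-empty c p q
  layer-bound c _ _ (empty _) (empty p) (full q) _ = rotated c (empty-full (rotate c) p q)
  layer-bound c _ _ (full _) (full p) (empty q) _ = rotated c (full-empty (rotate c) p q)
  layer-bound c _ _ (empty _) (empty _) (empty p) (full q) = rotated² c (empty-full (rotate (rotate c)) p q)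
  layer-bound c _ _ (full _) (full _) (full p) (empty q) = rotated² c (full-empty (rotate (rotate c)) p q)
  layer-bound c a _ (empty p) (empty q) (empty r) (empty w) = empty-empty c a p q r w
  layer-bound c _ b (full p) (full q) (full r) (full w) = empty-empty (complementᶜ c) b p q r w

-- Induction on the dimension

weight-complement : ∀ {m e o} → Bounded (tails m) e o →
  weight (tails m) e o + weight (tails m) (complement e) (complement o) ≡ 4 ^ suc m
weight-complement {m} {e} {o} b = trans (regroup (Σᵛ e) (Σᵛ o) (Σᵛ (complement e)) (Σᵛ (complement o)))
  (trans (cong₂ _+_ (Σᵛ-complement e (left≤2 b)) (Σᵛ-complement o (right≤2 b))) (four (4 ^ m)))
  where
  open Bounded
  regroup : ∀ a b c d → a + b + (c + d) ≡ a + c + (b + d)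
  regroup = solve-∀
  four : ∀ p → p * 2 + p * 2 ≡ 4 * p
  four = solve-∀

Isoperimetric : (m K T : ℕ) → Set
Isoperimetric m K T = ∀ {e o} → Bounded (tails m) e o → K ≤ weight (tails m) e o →
                      K ≤ weight (tails m) (complement e) (complement o) → T ≤ cut m e o

small-cut : ∀ {m e o k T} → Bounded (tails m) e o → weight (tails m) e o ≡ k → k ≤ 14 →
            T + 2 * maxEdges k ≤ 2 * suc m * k → T ≤ cut m e o
small-cut {m} {e} {o} {k} {T} b w≡k k≤14 T≤ = ≤-by T (cut m e o) 0
  (+-mono-≤ T≤ (*-monoʳ-≤ 2 (edges≤maxEdges k k≤14 (tails m) b w≡k)))
  (trans (cong (λ d → T + (d + 2 * maxEdges k) + 0) (trans (cong (2 * suc m *_) (sym w≡k)) (sym (cut-edges b))))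
         (eq T (cut m e o) (edges (tails m) e o) (maxEdges k)))
  where
  eq : ∀ T c q M → T + (c + 2 * q + 2 * M) + 0 ≡ T + 2 * M + 2 * q + c
  eq = solve-∀

-- Edge counting handles a set of fewer than `K₀` vertices, and a large set with such a complement
-- as well, because both have the same boundary.
refine : ∀ {m K K₀ T T₀} → Isoperimetric m K₀ T₀ → T ≤ T₀ → K₀ ≤ 15 →
         (∀ k → K ≤ k → k < K₀ → T + 2 * maxEdges k ≤ 2 * suc m * k) → Isoperimetric m K T
refine {m} {K} {K₀} iso T≤T₀ K₀≤15 small {e} {o} b K≤w K≤w′
  with weight (tails m) e o <? K₀ | weight (tails m) (complement e) (complement o) <? K₀
... | yes w< | _      = small-cut b refl (s≤s⁻¹ (≤-trans w< K₀≤15)) (small _ K≤w w<)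
... | no _   | yes w< = subst (_ ≤_) (cut-complement b)
  (small-cut (bounded-complement e o) refl (s≤s⁻¹ (≤-trans w< K₀≤15)) (small _ K≤w′ w<))
... | no w≮  | no w′≮ = ≤-trans T≤T₀ (iso b (≮⇒≥ w≮) (≮⇒≥ w′≮))

module Step
  {m T T′ K τ : ℕ}
  (two-middle : T ≤ T′ + T′)
  (change     : T ≤ 4 ^ m * 2 + 4 ^ m * 2)
  (one-middle : ∀ k r → 15 ≤ k + r → r + 3 ≤ 3 * K → T ≤ T′ + 2 * k + τ * r)
  (no-middle  : ∀ k → 15 ≤ k → k + 4 ≤ 4 * K → T ≤ (2 + τ) * k)
  (K≤15       : K ≤ 15)
  -- Through `small-cut`, fewer than `K` vertices of a layer send at least `2 + τ` edges each, on
  -- average, to the rest of that layer.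
  (small      : ∀ {k} → k < K → (2 + τ) * k + 2 * maxEdges k ≤ 2 * suc m * k)
  (iso        : Isoperimetric m K T′)
  where

  open LayerBound {4 ^ m * 2} {T} {T′} {K} {τ} two-middle change one-middle no-middle
  open Bounded

  step : Isoperimetric (suc m) 15 T
  step {e} {o} b w≥ w′≥ = subst (T ≤_) total≡ (layer-bound cycle
    (subst (15 ≤_) (masses≡ e o) w≥) (subst (15 ≤_) (masses≡ (complement e) (complement o)) w′≥)
    (kind 0F) (kind 1F) (kind 2F) (kind 3F))
    where
    b′ : ∀ a → Bounded (tails m) (layer e a) (layer o a)
    b′ a = bounded (λ t → left≤2 b (a ∷ t)) (λ s → right≤2 b (a ∷ s))

    l : Fin 4 → Layer (4 ^ m * 2)
    l a = record
      { E = Σᵛ (layer e a) ; O = Σᵛ (layer o a) ; inside = cut m (layer e a) (layer o a)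
      ; E′ = Σᵛ (complement (layer e a)) ; O′ = Σᵛ (complement (layer o a))
      ; E+E′≡h = Σᵛ-complement (layer e a) (left≤2 (b′ a))
      ; O+O′≡h = Σᵛ-complement (layer o a) (right≤2 (b′ a)) }

    y : Fin 4 → ℕ
    y a = crossing (layer e a) (layer o (inc a))

    next : ∀ a → Consecutive (l a) (l (inc a)) (y a)
    next a = consecutive
      (crossing-≥ (layer e a) (layer o (inc a)) (left≤2 (b′ a)) (right≤2 (b′ (inc a))))
      (subst (λ c → 2 * Σᵛ (layer o (inc a)) ≤ c + 2 * Σᵛ (layer e a))
        (crossing-sym (layer o (inc a)) (layer e a))
        (crossing-≥ (layer o (inc a)) (layer e a) (right≤2 (b′ (inc a))) (left≤2 (b′ a))))

    cycle : Cycle (4 ^ m * 2)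
    cycle = record { l₀ = l 0F ; l₁ = l 1F ; l₂ = l 2F ; l₃ = l 3F ; y₀ = y 0F ; y₁ = y 1F ; y₂ = y 2F ; y₃ = y 3F
                   ; c₀ = next 0F ; c₁ = next 1F ; c₂ = next 2F ; c₃ = next 3F }

    drop-zero : ∀ a b c d → a + (b + (c + (d + 0))) ≡ a + (b + (c + d))
    drop-zero = solve-∀

    total≡ : total cycle ≡ cut (suc m) e o
    total≡ = sym (trans (cut-∷ e o)
      (drop-zero (inside (l 0F) + y 0F) (inside (l 1F) + y 1F) (inside (l 2F) + y 2F) (inside (l 3F) + y 3F)))

    masses≡ : ∀ e o → weight (tails (suc m)) e o ≡
      weight (tails m) (layer e 0F) (layer o 0F) + (weight (tails m) (layer e 1F) (layer o 1F) +
      (weight (tails m) (layer e 2F) (layer o 2F) + weight (tails m) (layer e 3F) (layer o 3F)))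
    masses≡ e o = trans (cong₂ _+_ (Σᵛ-∷ e) (Σᵛ-∷ o))
      (interleave (E 0F) (E 1F) (E 2F) (E 3F) (O 0F) (O 1F) (O 2F) (O 3F))
      where
      E O : Fin 4 → ℕ
      E a = Σᵛ (layer e a)
      O a = Σᵛ (layer o a)
      interleave : ∀ a b c d a′ b′ c′ d′ →
        a + (b + (c + (d + 0))) + (a′ + (b′ + (c′ + (d′ + 0)))) ≡ a + a′ + (b + b′ + (c + c′ + (d + d′)))
      interleave = solve-∀

    kind : ∀ a → Kind (l a)
    kind a with weight (tails m) (layer e a) (layer o a) <? K
              | weight (tails m) (complement (layer e a)) (complement (layer o a)) <? K
    ... | yes w< | _      = empty (low w< (small-cut (b′ a) refl (s≤s⁻¹ (≤-trans w< K≤15)) (small w<)))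
    ... | no _   | yes w< = full (low w< (subst ((2 + τ) * weight (tails m) (complement (layer e a)) (complement (layer o a)) ≤_) (cut-complement (b′ a))
      (small-cut (bounded-complement (layer e a) (layer o a)) refl (s≤s⁻¹ (≤-trans w< K≤15)) (small w<))))
    ... | no w≮  | no w′≮ = middle (iso (b′ a) (≮⇒≥ w≮) (≮⇒≥ w′≮))

private
  -- Fewer than nine vertices have average degree at most 3. In dimension `5 + j` this leaves
  -- `7 + 2 j` boundary edges per vertex, which is where `τ = 5 + 2 j` comes from.
  linear-edges : ∀ {k} → k < 9 → 2 * maxEdges k ≤ 3 * k
  linear-edges = from-yes (allUpTo? (λ k → 2 * maxEdges k ≤? 3 * k) 9)

-- There are only 16 vertices, so a set of more than 9 has a complement of at most 6, and edge
-- counting always applies.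
isoperimetric₁ : Isoperimetric 1 3 8
isoperimetric₁ {e} {o} b w≥ w′≥ with weight (tails 1) e o ≤? 9
... | yes w≤9 = small-cut b refl (≤-trans w≤9 ≤-check) (bound (s≤s w≤9) w≥)
  where
  bound : ∀ {k} → k < 10 → 3 ≤ k → 8 + 2 * maxEdges k ≤ 4 * k
  bound = from-yes (allUpTo? (λ k → (3 ≤? k) →-dec (8 + 2 * maxEdges k ≤? 4 * k)) 10)
... | no w≰9 = subst (8 ≤_) (cut-complement b)
  (small-cut (bounded-complement e o) refl (≤-trans w′≤6 ≤-check) (bound (s≤s w′≤6) w′≥))
  where
  bound : ∀ {k} → k < 7 → 3 ≤ k → 8 + 2 * maxEdges k ≤ 4 * k
  bound = from-yes (allUpTo? (λ k → (3 ≤? k) →-dec (8 + 2 * maxEdges k ≤? 4 * k)) 7)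
  w′≤6 : weight (tails 1) (complement e) (complement o) ≤ 6
  w′≤6 = +-cancelˡ-≤ 10 _ 6 (≤-trans (+-monoˡ-≤ _ (≰⇒> w≰9)) (≤-reflexive (weight-complement b)))

-- Both `two-middle` and `change` hold with equality, `16 = 8 + 8`. Four nearly empty layers have at
-- most 2 vertices each and cannot reach 15, so `no-middle` is vacuous.
isoperimetric₂ : Isoperimetric 2 4 16
isoperimetric₂ = refine {T = 16} (Step.step {1} {16} {8} {3} {0} ≤-check ≤-check one (λ k p q → ⊥-elim (none p q)) ≤-check
    (λ {k} → from-yes (allUpTo? (λ k → 2 * k + 2 * maxEdges k ≤? 4 * k) 3) {k}) isoperimetric₁)
  ≤-refl ≤-refl
  λ k 4≤k k<15 → from-yes (allUpTo? (λ k → (4 ≤? k) →-dec (16 + 2 * maxEdges k ≤? 6 * k)) 15) k<15 4≤k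
  where
  none : ∀ {k} → 15 ≤ k → ¬ k + 4 ≤ 12
  none p q = <⇒≱ {12} {19} ≤-check (≤-trans (+-monoˡ-≤ 4 p) q)
  one : ∀ k r → 15 ≤ k + r → r + 3 ≤ 9 → 16 ≤ 8 + 2 * k + 0 * r
  one k r p q = ≤-by 16 (8 + 2 * k + 0 * r) 10 (+-mono-≤ (*-monoʳ-≤ 2 p) (*-monoʳ-≤ 2 q)) (eq k r)
    where
    eq : ∀ k r → 16 + (2 * (k + r) + 2 * 9) + 10 ≡ 2 * 15 + 2 * (r + 3) + (8 + 2 * k + 0 * r)
    eq = solve-∀

isoperimetric₃ : Isoperimetric 3 6 32
isoperimetric₃ = refine {T = 32} (Step.step {2} {32} {16} {4} {1} ≤-check ≤-check one (λ k p q → ⊥-elim (none p q)) ≤-check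
    (λ {k} → from-yes (allUpTo? (λ k → 3 * k + 2 * maxEdges k ≤? 6 * k) 4) {k}) isoperimetric₂)
  ≤-refl ≤-refl
  λ k 6≤k k<15 → from-yes (allUpTo? (λ k → (6 ≤? k) →-dec (32 + 2 * maxEdges k ≤? 8 * k)) 15) k<15 6≤k
  where
  none : ∀ {k} → 15 ≤ k → ¬ k + 4 ≤ 16
  none p q = <⇒≱ {16} {19} ≤-check (≤-trans (+-monoˡ-≤ 4 p) q)
  one : ∀ k r → 15 ≤ k + r → r + 3 ≤ 12 → 32 ≤ 16 + 2 * k + 1 * r
  one k r p q = ≤-by 32 (16 + 2 * k + 1 * r) 5 (+-mono-≤ (*-monoʳ-≤ 2 p) q) (eq k r)
    where
    eq : ∀ k r → 32 + (2 * (k + r) + 12) + 5 ≡ 2 * 15 + (r + 3) + (16 + 2 * k + 1 * r)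
    eq = solve-∀

-- `large` gives the bound from 15 vertices on, and `refine` lowers the threshold to 9, as the next
-- dimension requires. The target then grows by 18, less than the `2 * 15` available in
-- `one-middle`.
isoperimetric₄ : ∀ j → Isoperimetric (4 + j) 9 (62 + 18 * j)
isoperimetric₄ j = refine (large j) ≤-refl ≤-refl small
  where
  small : ∀ k → 9 ≤ k → k < 15 → 62 + 18 * j + 2 * maxEdges k ≤ 2 * suc (4 + j) * k
  small k 9≤k k<15 = ≤-by (62 + 18 * j + 2 * maxEdges k) (2 * suc (4 + j) * k) 0
    (+-mono-≤ (table k<15 9≤k) (*-monoʳ-≤ (2 * j) 9≤k)) (eq j k (maxEdges k))
    where
    table : ∀ {k} → k < 15 → 9 ≤ k → 62 + 2 * maxEdges k ≤ 10 * k
    table = from-yes (allUpTo? (λ k → (9 ≤? k) →-dec (62 + 2 * maxEdges k ≤? 10 * k)) 15)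
    eq : ∀ j k M → 62 + 18 * j + 2 * M + (10 * k + 2 * j * k) + 0 ≡ 62 + 2 * M + 2 * j * 9 + 2 * suc (4 + j) * k
    eq = solve-∀
  large : ∀ j → Isoperimetric (4 + j) 15 (62 + 18 * j)
  large zero = Step.step {3} {62} {32} {6} {3} ≤-check ≤-check one all ≤-check
    (λ {k} → from-yes (allUpTo? (λ k → 5 * k + 2 * maxEdges k ≤? 8 * k) 6) {k}) isoperimetric₃
    where
    -- Sharp for `k = 15` and `r = 0`: `32 + 2 * 15 = 62`. This fixes the threshold 15.
    one : ∀ k r → 15 ≤ k + r → _ → 62 ≤ 32 + 2 * k + 3 * r
    one k r p _ = ≤-by 62 (32 + 2 * k + 3 * r) r (*-monoʳ-≤ 2 p) (eq k r)
      where
      eq : ∀ k r → 62 + 2 * (k + r) + r ≡ 2 * 15 + (32 + 2 * k + 3 * r)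
      eq = solve-∀
    all : ∀ k → 15 ≤ k → _ → 62 ≤ 5 * k
    all k p _ = ≤-trans ≤-check (*-monoʳ-≤ 5 p)
  large (suc j) = Step.step {4 + j} {62 + 18 * suc j} {62 + 18 * j} {9} {5 + 2 * j} two change one all ≤-check
    near (isoperimetric₄ j)
    where
    two : 62 + 18 * suc j ≤ 62 + 18 * j + (62 + 18 * j)
    two = ≤-by (62 + 18 * suc j) (62 + 18 * j + (62 + 18 * j)) (44 + 18 * j) (z≤n {0}) (eq j)
      where
      eq : ∀ j → 62 + 18 * suc j + 0 + (44 + 18 * j) ≡ 0 + (62 + 18 * j + (62 + 18 * j))
      eq = solve-∀
    change : 62 + 18 * suc j ≤ 4 ^ (4 + j) * 2 + 4 ^ (4 + j) * 2
    change = go j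
      where
      go : ∀ j → 62 + 18 * suc j ≤ 4 ^ (4 + j) * 2 + 4 ^ (4 + j) * 2
      go zero    = ≤-check
      go (suc j) = ≤-by (62 + 18 * suc (suc j)) (4 * p * 2 + 4 * p * 2) (8 * p + 62 + 18 * j) (*-monoʳ-≤ 2 (go j)) (eq p j)
        where
        p = 4 ^ (4 + j)
        eq : ∀ p j → 62 + 18 * suc (suc j) + 2 * (p * 2 + p * 2) + (8 * p + 62 + 18 * j) ≡ 2 * (62 + 18 * suc j) + (4 * p * 2 + 4 * p * 2)
        eq = solve-∀
    one : ∀ k r → 15 ≤ k + r → _ → 62 + 18 * suc j ≤ 62 + 18 * j + 2 * k + (5 + 2 * j) * r
    one k r p _ = ≤-by (62 + 18 * suc j) (62 + 18 * j + 2 * k + (5 + 2 * j) * r) (12 + (3 + 2 * j) * r) (*-monoʳ-≤ 2 p) (eq j k r)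
      where
      eq : ∀ j k r → 62 + 18 * suc j + 2 * (k + r) + (12 + (3 + 2 * j) * r) ≡ 2 * 15 + (62 + 18 * j + 2 * k + (5 + 2 * j) * r)
      eq = solve-∀
    all : ∀ k → 15 ≤ k → _ → 62 + 18 * suc j ≤ (7 + 2 * j) * k
    all k p _ = ≤-by (62 + 18 * suc j) ((7 + 2 * j) * k) (25 + 12 * j) (*-monoʳ-≤ (7 + 2 * j) p) (eq j k)
      where
      eq : ∀ j k → 62 + 18 * suc j + (7 + 2 * j) * k + (25 + 12 * j) ≡ (7 + 2 * j) * 15 + (7 + 2 * j) * k
      eq = solve-∀
    near : ∀ {k} → k < 9 → (7 + 2 * j) * k + 2 * maxEdges k ≤ 2 * suc (4 + j) * k
    near {k} k<9 = ≤-by ((7 + 2 * j) * k + 2 * maxEdges k) (2 * suc (4 + j) * k) 0 (linear-edges k<9) (eq j k (maxEdges k))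
      where
      eq : ∀ j k M → (7 + 2 * j) * k + 2 * M + 3 * k + 0 ≡ 2 * M + 2 * suc (4 + j) * k
      eq = solve-∀

-- The largest order K for which the bound 2 K l + 8 is needed in dimension l + 2.
reach : ℕ → ℕ
reach 0 = 3
reach 1 = 4
reach 2 = 6
reach _ = 9

-- Smaller `K` follow from `reach l`: for the orders `k` in between, `8 + 2 maxEdges k ≤ 4 k` and
-- `2 K l ≤ 2 k l` add up to the claim.
isoperimetric : ∀ l K → 3 ≤ K → K ≤ reach l → Isoperimetric (suc l) K (2 * K * l + 8)
isoperimetric l K 3≤K K≤r = from l (base l) K≤r
  where
  value : ℕ → ℕ
  value l = 2 * reach l * l + 8
  base : ∀ l → Isoperimetric (suc l) (reach l) (value l)
  base 0 = isoperimetric₁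
  base 1 = isoperimetric₂
  base 2 = isoperimetric₃
  base (suc (suc (suc j))) = subst (Isoperimetric (4 + j) 9) (eq j) (isoperimetric₄ j)
    where
    eq : ∀ j → 62 + 18 * j ≡ 2 * 9 * (3 + j) + 8
    eq = solve-∀
  reach≤9 : ∀ l → reach l ≤ 9
  reach≤9 0 = ≤-check
  reach≤9 1 = ≤-check
  reach≤9 2 = ≤-check
  reach≤9 (suc (suc (suc _))) = ≤-refl
  from : ∀ l → Isoperimetric (suc l) (reach l) (value l) → K ≤ reach l → Isoperimetric (suc l) K (2 * K * l + 8)
  from l iso K≤r = refine iso (+-monoˡ-≤ 8 (*-monoˡ-≤ l (*-monoʳ-≤ 2 K≤r))) (≤-trans (reach≤9 l) ≤-check)
    λ k K≤k k<r → ≤-by (2 * K * l + 8 + 2 * maxEdges k) (2 * suc (suc l) * k) 0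
      (+-mono-≤ (table (≤-trans k<r (reach≤9 l)) (≤-trans 3≤K K≤k)) (*-monoˡ-≤ l (*-monoʳ-≤ 2 K≤k)))
      (eq K k l (maxEdges k))
    where
    table : ∀ {k} → k < 9 → 3 ≤ k → 8 + 2 * maxEdges k ≤ 4 * k
    table = from-yes (allUpTo? (λ k → (3 ≤? k) →-dec (8 + 2 * maxEdges k ≤? 4 * k)) 9)
    eq : ∀ K k l M → 2 * K * l + 8 + 2 * M + (4 * k + 2 * k * l) + 0 ≡ 8 + 2 * M + 2 * K * l + 2 * suc (suc l) * k
    eq = solve-∀

-- Components and boundaries in finite graphs

module _ {A : Set} (_≈_ : A → A → Set) (≈-sym : ∀ {x y} → x ≈ y → y ≈ x)
         (≈-trans : ∀ {x y z} → x ≈ y → y ≈ z → x ≈ z) where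

  delete : ∀ {x ys} → Any.Any (x ≈_) ys → ∃ λ zs → length ys ≡ suc (length zs) ×
           (∀ {y} → ¬ x ≈ y → Any.Any (y ≈_) ys → Any.Any (y ≈_) zs)
  delete {x} {z ∷ zs} (here x≈z) = zs , refl , λ x≉y → λ where
    (here y≈z) → contradiction (≈-trans x≈z (≈-sym y≈z)) x≉y
    (there p)  → p
  delete {x} {z ∷ ys} (there x∈ys) with zs , eq , keep ← delete x∈ys =
    z ∷ zs , cong suc eq , λ x≉y → λ where
      (here y≈z) → here y≈z
      (there p)  → there (keep x≉y p)

  -- The pigeonhole principle for an arbitrary symmetric transitive relation, since edges are
  -- compared up to orientation.
  length-⊆ : ∀ {xs ys} → AllPairs (λ x y → ¬ x ≈ y) xs → All (λ x → Any.Any (x ≈_) ys) xs → length xs ≤ length ys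
  length-⊆ []           []           = z≤n
  length-⊆ (x∉xs ∷ xs!) (x∈ys ∷ xs⊆) with zs , eq , keep ← delete x∈ys =
    subst (_ ≤_) (sym eq) (s≤s (length-⊆ xs! (All.zipWith (λ (x≉y , y∈ys) → keep x≉y y∈ys) (x∉xs , xs⊆))))

length-unique-⊆ : ∀ {A : Set} {xs ys : List A} → Unique xs → All (_∈ ys) xs → length xs ≤ length ys
length-unique-⊆ = length-⊆ _≡_ sym trans

module _ {A : Set} (V : Enumeration A) where
  open Enumeration V

  count : (A → Bool) → ℕ
  count U = ∑ list λ v → 𝟙 (U v ≟ᵇ true)

  length-≤-count : ∀ U {xs} → Unique xs → All (λ v → U v ≡ true) xs → length xs ≤ count U
  length-≤-count U xs! all = subst (_ ≤_) (length-filter≡∑ (λ v → U v ≟ᵇ true) list)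
    (length-unique-⊆ xs! (All.map (λ {v} Uv → ∈-filter⁺ (λ v → U v ≟ᵇ true) (complete v) Uv) all))

  _∈?_ : ∀ x xs → Dec (x ∈ xs)
  x ∈? xs = Any.any? (x ≟_) xs

  all-dec : ∀ {P : A → Set} → (∀ x → Dec (P x)) → Dec (∀ x → P x)
  all-dec P? = map′ (λ ¬∃ x → decidable-stable (P? x) λ ¬Px → ¬∃ (x , ¬Px)) (λ ∀P (x , ¬Px) → ¬Px (∀P x))
                    (¬? (any-dec (λ x → ¬? (P? x))))

least : ∀ {Q : ℕ → Set} → (∀ k → Dec (Q k)) → ∀ k₀ → Q k₀ → ∃ λ k → Q k × k ≤ k₀ × (∀ j → Q j → k ≤ j)
least Q? zero     q = 0 , q , z≤n , λ _ _ → z≤n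
least Q? (suc k₀) q with Q? 0
... | yes q₀ = 0 , q₀ , z≤n , λ _ _ → z≤n
... | no ¬q₀ = let k , qk , k≤ , minimal = least (λ j → Q? (suc j)) k₀ q in
  suc k , qk , s≤s k≤ , λ { zero q₀ → contradiction q₀ ¬q₀ ; (suc j) qj → s≤s (minimal j qj) }

module Reachability (H : Graph) (V : Enumeration (Graph.Vertex H)) where
  open Graph H using (Vertex; _~_; _~?_)
  open Enumeration V hiding (_≟_)

  record ComponentList (v : Vertex) : Set where
    field
      elements : List Vertex
      unique!  : Unique elements
      sound    : All (Star _~_ v) elements
      covers   : ∀ u → Star _~_ v u → u ∈ elements

  private
    -- Each round adds a new vertex adjacent to `S`. As `S` has no repetitions, the invariant
    -- relating `fuel` to the number of vertices prevents running out before `S` is closed.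
    grow : ∀ {v} fuel S → Unique S → All (Star _~_ v) S → v ∈ S → length list ≤ length S + fuel → ComponentList v
    grow {v} fuel S S! reach v∈S N≤
      with any-dec (λ y → ¬? (_∈?_ V y S) ×-dec Any.any? (_~? y) S)
    ... | no closed = record { elements = S ; unique! = S! ; sound = reach ; covers = λ u p → stay p v∈S }
      where
      stay : ∀ {x u} → Star _~_ x u → x ∈ S → u ∈ S
      stay ε x∈S = x∈S
      stay (_◅_ {j = y} x~y p) x∈S = stay p (decidable-stable (_∈?_ V y S)
        λ y∉S → closed (y , y∉S , lose x∈S x~y))
    grow {v} zero S S! reach v∈S N≤ | yes (y , y∉S , _) =
      contradiction (subst (length list ≤_) (+-identityʳ _) N≤)
        (<⇒≱ (length-unique-⊆ {xs = y ∷ S} (All.¬Any⇒All¬ S y∉S ∷ S!) (All.universal complete _)))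
    grow {v} (suc fuel) S S! reach v∈S N≤ | yes (y , y∉S , adj) with x , x∈S , x~y ← find adj =
      grow fuel (y ∷ S) (All.¬Any⇒All¬ S y∉S ∷ S!) ((All.lookup reach x∈S ◅◅ (x~y ◅ ε)) ∷ reach) (there v∈S)
        (subst (length list ≤_) (+-suc _ fuel) N≤)

  component : ∀ v → ComponentList v
  component v = grow (length list) (v ∷ []) ([] ∷ []) (ε ∷ []) (here refl) (n≤1+n _)

  open ComponentList

  reachable? : ∀ v u → Dec (Star _~_ v u)
  reachable? v u = map′ (All.lookup (sound (component v))) (covers (component v) u) (_∈?_ V u (elements (component v)))

  connected? : Dec (Connected H)
  connected? = all-dec V λ v → all-dec V λ u → reachable? v u

  hasAtLeast? : ∀ k v → Dec (HasAtLeast H k (Component H v))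
  hasAtLeast? k v = map′
    (λ k≤ → record { elements = elements (component v) ; unique = unique! (component v) } , sound (component v) , k≤)
    (λ (S , all , k≤) → ≤-trans k≤ (length-unique-⊆ (VertexSet.unique S) (All.map (covers (component v) _) all)))
    (k ≤? length (elements (component v)))

module Boundary (G : Graph) (V : Enumeration (Graph.Vertex G))
  (even : Graph.Vertex G → Bool) (bipartite : ∀ u v → Graph._~_ G u v → even v ≡ not (even u)) where

  open Graph G using (Vertex; _~_; _~?_; ~-sym; Edge; edge; src; tgt; _∈ᴱ_; _∉ᴱ_; _∈ᴱ?_; edgeSetoid) renaming (_≈_ to _≈ᴱ_)
  open Enumeration V hiding (_≟_)
  open EdgeSet using (size) renaming (elements to edgeList)

  -- Fixing the even end as the first one lists each unordered edge exactly once.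
  Separated : (Vertex → Bool) → Vertex × Vertex → Set
  Separated U (u , v) = even u ≡ true × u ~ v × U u ≢ U v

  separated? : ∀ U uv → Dec (Separated U uv)
  separated? U (u , v) = (even u ≟ᵇ true) ×-dec ((u ~? v) ×-dec ¬? (U u ≟ᵇ U v))

  module _ {U : Vertex → Bool} where

    toEdge : ∀ {uv} → Separated U uv → Edge
    toEdge (_ , u~v , _) = edge u~v

    toEdges : ∀ {uvs} → All (Separated U) uvs → List Edge
    toEdges = All.reduce toEdge

    toEdge-injective : ∀ {uv xy} (p : Separated U uv) (q : Separated U xy) → toEdge p ≈ᴱ toEdge q → uv ≡ xy
    toEdge-injective p q (inj₁ (refl , refl)) = refl
    toEdge-injective (eu , u~v , _) (ev , _) (inj₂ (refl , refl)) =
      case trans (sym ev) (trans (bipartite _ _ u~v) (cong not eu)) of λ ()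

    toEdges-unique : ∀ {uvs} → Unique uvs → (ps : All (Separated U) uvs) → AllPairs (λ e f → ¬ e ≈ᴱ f) (toEdges ps)
    toEdges-unique []          []       = []
    toEdges-unique (x∉ ∷ uvs!) (p ∷ ps) = distinct x∉ ps ∷ toEdges-unique uvs! ps
      where
      distinct : ∀ {xys} → All (_ ≢_) xys → (qs : All (Separated U) xys) → All (λ e → ¬ toEdge p ≈ᴱ e) (toEdges qs)
      distinct []         []       = []
      distinct (≢q ∷ ≢qs) (q ∷ qs) = (≢q ∘ toEdge-injective p q) ∷ distinct ≢qs qs

    length-toEdges : ∀ {uvs} (ps : All (Separated U) uvs) → length (toEdges ps) ≡ length uvs
    length-toEdges []       = refl
    length-toEdges (p ∷ ps) = cong suc (length-toEdges ps)

    toEdges-separated : ∀ {uvs} (ps : All (Separated U) uvs) → All (λ e → U (src e) ≢ U (tgt e)) (toEdges ps)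
    toEdges-separated []                   = []
    toEdges-separated ((_ , _ , U≢) ∷ ps) = U≢ ∷ toEdges-separated ps

    ∈-toEdges : ∀ {uvs u v} (ps : All (Separated U) uvs) → (u , v) ∈ uvs → (u~v : u ~ v) → edge u~v ∈ᴱ toEdges ps
    ∈-toEdges (p ∷ ps) (here refl) u~v = here (inj₁ (refl , refl))
    ∈-toEdges (p ∷ ps) (there x∈)  u~v = there (∈-toEdges ps x∈ u~v)

  separatedPairs : (Vertex → Bool) → List (Vertex × Vertex)
  separatedPairs U = filter (separated? U) (cartesianProduct list list)

  boundary : (Vertex → Bool) → EdgeSet G
  boundary U = record
    { elements = toEdges (All.all-filter (separated? U) (cartesianProduct list list))
    ; unique   = toEdges-unique (Unique.filter⁺ (separated? U) (Unique.cartesianProduct⁺ unique unique)) _ }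

  size-boundary : ∀ U → size (boundary U) ≡ ∑ list λ u → ∑ list λ v → 𝟙 (separated? U (u , v))
  size-boundary U = begin
    size (boundary U)                                  ≡⟨ length-toEdges {U} (All.all-filter (separated? U) (cartesianProduct list list)) ⟩
    length (separatedPairs U)                          ≡⟨ length-filter≡∑ (separated? U) (cartesianProduct list list) ⟩
    ∑ (cartesianProduct list list) (𝟙 ∘ separated? U)  ≡⟨ ∑-cartesianProductWith _,_ list list (𝟙 ∘ separated? U) ⟩
    ∑ list (λ u → ∑ list λ v → 𝟙 (separated? U (u , v))) ∎
    where open ≡-Reasoning

  ∈-boundary⁻ : ∀ U {u v} (u~v : u ~ v) → edge u~v ∈ᴱ edgeList (boundary U) → U u ≢ U v
  ∈-boundary⁻ U u~v e∈ Uu≡Uv = All.lookupWith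
    (λ { U≢ (inj₁ (refl , refl)) → U≢ Uu≡Uv ; U≢ (inj₂ (refl , refl)) → U≢ (sym Uu≡Uv) })
    (toEdges-separated (All.all-filter (separated? U) (cartesianProduct list list))) e∈

  ∈-boundary⁺ : ∀ U {u v} (u~v : u ~ v) → U u ≢ U v → edge u~v ∈ᴱ edgeList (boundary U)
  ∈-boundary⁺ U {u} {v} u~v U≢ with even u in eq
  ... | true  = ∈-toEdges _ (∈-filter⁺ (separated? U) (∈-cartesianProduct⁺ (complete u) (complete v)) (eq , u~v , U≢)) u~v
  ... | false = Any.map (λ { (inj₁ (p , q)) → inj₂ (q , p) ; (inj₂ (p , q)) → inj₁ (q , p) })
    (∈-toEdges _ (∈-filter⁺ (separated? U) (∈-cartesianProduct⁺ (complete v) (complete u))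
      (trans (bipartite _ _ u~v) (cong not eq) , ~-sym u~v , U≢ ∘ sym)) (~-sym u~v))

  infix 4 _~[_]_
  _~[_]_ : Vertex → (Vertex → Bool) → Vertex → Set
  u ~[ U ] v = Graph._~_ (G ∖ boundary U) u v

  same-side : ∀ {U u v} → u ~ v → U u ≡ U v → u ~[ U ] v
  same-side {U} u~v eq = u~v , λ e∈ → ∈-boundary⁻ U u~v e∈ eq

  Star-preserves : ∀ {U u v} → Star _~[ U ]_ u v → U u ≡ U v
  Star-preserves ε = refl
  Star-preserves {U} (_◅_ {i} {j} (u~v , e∉) p) =
    trans (decidable-stable (U i ≟ᵇ U j) (λ U≢ → e∉ (∈-boundary⁺ U u~v U≢))) (Star-preserves p)

  extraEdgeCut? : Connected G → ∀ g F → Dec (IsExtraEdgeCut g G F)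
  extraEdgeCut? conn g F = map′ (λ (p , q) → (conn , p) , q) (λ ((_ , p) , q) → p , q)
    (¬? (Reachability.connected? (G ∖ F) V) ×-dec all-dec V (Reachability.hasAtLeast? (G ∖ F) V (suc g)))

  record Part (g : ℕ) (F : EdgeSet G) : Set where
    field
      members  : List Vertex
      large    : suc g ≤ length members
      distinct : Unique members
      other    : List Vertex
      large′    : suc g ≤ length other
      distinct′ : Unique other
      disjoint  : All (_∉ members) other
      closed    : ∀ {u v} → Graph._~_ (G ∖ F) u v → (u ∈ members → v ∈ members) × (v ∈ members → u ∈ members)

  -- One component of G ∖ F, and vertices of another one.
  part : ∀ {g F} → IsExtraEdgeCut g G F → Part g F
  part {g} {F} ((_ , disconnected) , extra)
    with any-dec (λ v → any-dec λ u → ¬? (Reachability.reachable? (G ∖ F) V v u))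
  ... | no none = contradiction (λ v u → decidable-stable (Reachability.reachable? (G ∖ F) V v u)
                                           λ ¬p → none (v , u , ¬p)) disconnected
  ... | yes (v , u , v↛u) = record
    { members = elements C ; distinct = unique! C
    ; large = let S , all , k≤ = extra v in
        ≤-trans k≤ (length-unique-⊆ (VertexSet.unique S) (All.map (covers C _) all))
    ; other = VertexSet.elements (proj₁ (extra u)) ; distinct′ = VertexSet.unique (proj₁ (extra u))
    ; large′ = proj₂ (proj₂ (extra u))
    ; disjoint = All.map (λ u→x x∈C → v↛u (All.lookup (sound C) x∈C ◅◅ reverse sym′ u→x)) (proj₁ (proj₂ (extra u)))
    ; closed = λ x~y → (λ x∈C → covers C _ (All.lookup (sound C) x∈C ◅◅ (x~y ◅ ε)))
                     , (λ y∈C → covers C _ (All.lookup (sound C) y∈C ◅◅ (sym′ x~y ◅ ε)))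
    }
    where
    C = Reachability.component (G ∖ F) V v
    open Reachability.ComponentList
    sym′ : ∀ {x y} → Graph._~_ (G ∖ F) x y → Graph._~_ (G ∖ F) y x
    sym′ = Graph.~-sym (G ∖ F)

  Indicates : (Vertex → Bool) → List Vertex → Set
  Indicates U S = ∀ v → U v ≡ does (_∈?_ V v S)

  module _ {U S} (U≗S : Indicates U S) where

    member⇒true : ∀ {v} → v ∈ S → U v ≡ true
    member⇒true {v} v∈S = trans (U≗S v) (dec-true (_∈?_ V v S) v∈S)

    non-member⇒false : ∀ {v} → v ∉ S → U v ≡ false
    non-member⇒false {v} v∉S = trans (U≗S v) (dec-false (_∈?_ V v S) v∉S)

  module _ {g F} (isCut : IsExtraEdgeCut g G F) {U} (U≗ : Indicates U (Part.members (part isCut))) where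
    open Part (part isCut)

    private
      remaining⇒same : ∀ {u v} → Graph._~_ (G ∖ F) u v → U u ≡ U v
      remaining⇒same {u} {v} u~v with _∈?_ V u members
      ... | yes u∈ = trans (member⇒true U≗ u∈) (sym (member⇒true U≗ (proj₁ (closed u~v) u∈)))
      ... | no u∉  = trans (non-member⇒false U≗ u∉) (sym (non-member⇒false U≗ (u∉ ∘ proj₂ (closed u~v))))

    separated⇒cut : ∀ {u v} (u~v : u ~ v) → U u ≢ U v → edge u~v ∈ᴱ edgeList F
    separated⇒cut u~v U≢ = decidable-stable (edge u~v ∈ᴱ? edgeList F) λ e∉F → U≢ (remaining⇒same (u~v , e∉F))

    size-boundary-≤ : size (boundary U) ≤ size F
    size-boundary-≤ = length-⊆ _≈ᴱ_ (λ {e} {f} → Setoid.sym edgeSetoid {e} {f}) (λ {e} {f} {h} → Setoid.trans edgeSetoid {e} {f} {h})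
      (EdgeSet.unique (boundary U)) (in-F (All.all-filter (separated? U) (cartesianProduct list list)))
      where
      in-F : ∀ {uvs} (ps : All (Separated U) uvs) → All (_∈ᴱ edgeList F) (toEdges ps)
      in-F []                     = []
      in-F ((_ , u~v , U≢) ∷ ps) = separated⇒cut u~v U≢ ∷ in-F ps

    count-≥ : suc g ≤ count V U
    count-≥ = ≤-trans large (length-≤-count V U distinct (All.tabulate (λ v∈ → member⇒true {U} U≗ v∈)))

    count-not-≥ : suc g ≤ count V (not ∘ U)
    count-not-≥ = ≤-trans large′ (length-≤-count V (not ∘ U) distinct′
      (All.map (λ v∉ → cong not (non-member⇒false U≗ v∉)) disjoint))

    -- An edge surviving the removal of `F` joins vertices on the same side of `U`, so every
    -- component of `G ∖ F` lies inside one of `G ∖ boundary U` and orders can only grow.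
    boundary-extra : IsExtraEdgeCut g G (boundary U)
    boundary-extra = (proj₁ (proj₁ isCut) , disconnected) , λ v →
      let S , all , k≤ = proj₂ isCut v in
      record { elements = VertexSet.elements S ; unique = VertexSet.unique S } , All.map keep all , k≤
      where
      keep : ∀ {u v} → Star (Graph._~_ (G ∖ F)) u v → Star _~[ U ]_ u v
      keep = gmap id λ u~v → same-side {U} (proj₁ u~v) (remaining⇒same u~v)
      head : ∀ {A : Set} {P : A → Set} (xs : List A) → suc g ≤ length xs → All P xs → ∃ P
      head (x ∷ _) _ (px ∷ _) = x , px
      disconnected : ¬ Connected (G ∖ boundary U)
      disconnected conn =
        let u , u∈ = head members large (All.tabulate id)
            v , v∉ = head other large′ disjoint
        in case trans (sym (member⇒true U≗ u∈)) (trans (Star-preserves {U} (conn u v)) (non-member⇒false U≗ v∉)) of λ ()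

  -- Vertex sets are encoded as `Subset`s because those can be searched exhaustively with
  -- `anySubset?`.
  indicator : (s : Subset (proj₁ (Graph.finite G))) → Vertex → Bool
  indicator s v = lookup s (Inverse.to (proj₂ (Graph.finite G)) v)

  indicate : ∀ S → ∃ λ s → Indicates (indicator s) S
  indicate S = tabulate (λ i → does (_∈?_ V (from i) S)) , λ v →
    trans (lookup∘tabulate _ (to v)) (cong (λ w → does (_∈?_ V w S)) (strictlyInverseʳ v))
    where open Inverse (proj₂ (Graph.finite G))

  connectivity-exists : Connected G → ∀ g F₀ → IsExtraEdgeCut g G F₀ →
                        ∃ λ k → IsExtraEdgeConnectivity g G k × k ≤ size F₀
  connectivity-exists conn g F₀ isCut₀ =
    let k₀ , q₀ , k₀≤ = reduce F₀ isCut₀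
        k , (s , isCut , size≡) , k≤k₀ , minimal = least attained? k₀ q₀
    in k , ((boundary (indicator s) , isCut , size≡) ,
            λ F isCutF → let j , q , j≤ = reduce F isCutF in ≤-trans (minimal j q) j≤) ,
       ≤-trans k≤k₀ k₀≤
    where
    Attained : ℕ → Set
    Attained k = ∃ λ s → IsExtraEdgeCut g G (boundary (indicator s)) × size (boundary (indicator s)) ≡ k
    attained? : ∀ k → Dec (Attained k)
    attained? k = anySubset? λ s → extraEdgeCut? conn g (boundary (indicator s)) ×-dec (size (boundary (indicator s)) ℕ.≟ k)
    reduce : ∀ F → IsExtraEdgeCut g G F → ∃ λ k → Attained k × k ≤ size F
    reduce F isCut = let s , U≗ = indicate (Part.members (part isCut)) in
      size (boundary (indicator s)) , (s , boundary-extra isCut U≗ , refl) , size-boundary-≤ isCut U≗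

  -- A vertex outside U reaches its outer neighbours and those of one of them, which have the opposite
  -- parity; this gives components of order at least D + D.
  module _ {U : Vertex → Bool} where

    outerNeighbours : Vertex → List Vertex
    outerNeighbours w = filter (λ x → (w ~? x) ×-dec (U x ≟ᵇ false)) list

    boundary-extra-cut : Connected G → ∀ g D (c w₀ : Vertex) → U c ≡ true → U w₀ ≡ false →
      suc g ≤ count V U → (∀ v → U v ≡ true → Star _~[ U ]_ v c) →
      0 < D → suc g ≤ D + D → (∀ w → U w ≡ false → D ≤ length (outerNeighbours w)) →
      IsExtraEdgeCut g G (boundary U)
    boundary-extra-cut conn g D c w₀ Uc Uw₀ g<U to-c 0<D g<2D outer = (conn , disconnected) , large
      where
      disconnected : ¬ Connected (G ∖ boundary U)
      disconnected conn′ = case trans (sym Uc) (trans (Star-preserves {U} (conn′ c w₀)) Uw₀) of λ ()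

      back : ∀ {u v} → Star _~[ U ]_ u v → Star _~[ U ]_ v u
      back = reverse (Graph.~-sym (G ∖ boundary U))

      outer-∈ : ∀ w {x} → x ∈ outerNeighbours w → w ~ x × U x ≡ false
      outer-∈ w x∈ = proj₂ (∈-filter⁻ (λ x → (w ~? x) ×-dec (U x ≟ᵇ false)) {xs = list} x∈)

      outer-unique : ∀ w → Unique (outerNeighbours w)
      outer-unique w = Unique.filter⁺ (λ x → (w ~? x) ×-dec (U x ≟ᵇ false)) unique

      large : ∀ v → HasAtLeast (G ∖ boundary U) (suc g) (Component (G ∖ boundary U) v)
      large v with U v in Uv
      ... | true = record { elements = filter (λ x → U x ≟ᵇ true) list ; unique = Unique.filter⁺ (λ x → U x ≟ᵇ true) unique }
        , All.map (λ Ux → to-c v Uv ◅◅ back (to-c _ Ux)) (All.all-filter (λ x → U x ≟ᵇ true) list)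
        , subst (suc g ≤_) (sym (length-filter≡∑ (λ x → U x ≟ᵇ true) list)) g<U
      ... | false = record { elements = outerNeighbours v ++ outerNeighbours x ; unique = Unique.++⁺ (outer-unique v) (outer-unique x) separate }
        , All.++⁺ (All.tabulate (λ y∈ → let v~y , Uy = outer-∈ v y∈ in same-side {U} v~y (trans Uv (sym Uy)) ◅ ε))
                  (All.tabulate (λ y∈ → let x~y , Uy = outer-∈ x y∈ in
                     same-side {U} v~x (trans Uv (sym Ux)) ◅ same-side {U} x~y (trans Ux (sym Uy)) ◅ ε))
        , ≤-trans g<2D (subst (D + D ≤_) (sym (length-++ (outerNeighbours v))) (+-mono-≤ (outer v Uv) (outer x Ux)))
        where
        nonempty : ∀ {xs : List Vertex} → 0 < length xs → ∃ λ x → x ∈ xs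
        nonempty {x ∷ _} _ = x , here refl
        step : ∃ λ x → x ∈ outerNeighbours v
        step = nonempty (≤-trans 0<D (outer v Uv))
        x = proj₁ step
        v~x = proj₁ (outer-∈ v (proj₂ step))
        Ux = proj₂ (outer-∈ v (proj₂ step))
        separate : ∀ {y} → ¬ (y ∈ outerNeighbours v × y ∈ outerNeighbours x)
        separate {y} (p , q) = same-parity (even v) (even x) (even y) (bipartite _ _ v~x)
          (bipartite _ _ (proj₁ (outer-∈ v p))) (bipartite _ _ (proj₁ (outer-∈ x q)))
          where
          same-parity : ∀ a b c → b ≡ not a → c ≡ not a → ¬ c ≡ not b
          same-parity false _ _ refl refl ()
          same-parity true  _ _ refl refl ()

-- Vertex sets of the balanced hypercube as weights on twin classes

𝟙-⇔ : ∀ {P Q : Set} (p : Dec P) (q : Dec Q) → (P → Q) → (Q → P) → 𝟙 p ≡ 𝟙 q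
𝟙-⇔ p (yes q) _  from = 𝟙-yes p (from q)
𝟙-⇔ p (no ¬q) to _    = 𝟙-no p (¬q ∘ to)

𝟙-× : ∀ {P Q : Set} (p : Dec P) (q : Dec Q) → 𝟙 (p ×-dec q) ≡ 𝟙 p * 𝟙 q
𝟙-× (yes _) (yes _) = refl
𝟙-× (yes _) (no _)  = refl
𝟙-× (no _)  _       = refl

𝟙-×-× : ∀ {P Q R : Set} (p : Dec P) (q : Dec Q) (r : Dec R) → 𝟙 (p ×-dec (q ×-dec r)) ≡ 𝟙 p * (𝟙 q * 𝟙 r)
𝟙-×-× p q r = trans (𝟙-× p (q ×-dec r)) (cong (𝟙 p *_) (𝟙-× q r))

even₄ : Fin 4 → Bool
even₄ 0F = true
even₄ 1F = false
even₄ 2F = true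
even₄ 3F = false

isEven : ∀ {m} → Vec (Fin 4) (suc m) → Bool
isEven (a ∷ _) = even₄ a

even₄-inc : ∀ a → even₄ (inc a) ≡ not (even₄ a)
even₄-inc 0F = refl
even₄-inc 1F = refl
even₄-inc 2F = refl
even₄-inc 3F = refl

even₄-dec : ∀ a → even₄ (dec a) ≡ not (even₄ a)
even₄-dec 0F = refl
even₄-dec 1F = refl
even₄-dec 2F = refl
even₄-dec 3F = refl

BHAdj-bipartite : ∀ {m} (u v : Vec (Fin 4) (suc m)) → BHAdj u v → isEven v ≡ not (isEven u)
BHAdj-bipartite (a ∷ _) (_ ∷ _) (inj₁ refl , _) = even₄-inc a
BHAdj-bipartite (a ∷ _) (_ ∷ _) (inj₂ refl , _) = even₄-dec a

module BHBoundary (m : ℕ) = Boundary (BH (suc m)) (vecs (suc m)) isEven BHAdj-bipartite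

Near⇒BHAdj : ∀ {m} a b {t s : Vec (Fin 4) m} → even₄ a ≡ true → even₄ b ≡ false → Near t s → BHAdj (a ∷ t) (b ∷ s)
Near⇒BHAdj 0F 1F _ _ near = inj₁ refl , near
Near⇒BHAdj 0F 3F _ _ near = inj₂ refl , near
Near⇒BHAdj 2F 1F _ _ near = inj₂ refl , near
Near⇒BHAdj 2F 3F _ _ near = inj₁ refl , near
Near⇒BHAdj 3F _ ()

BHAdj⇒Near : ∀ {m} a b {t s : Vec (Fin 4) m} → even₄ a ≡ true → BHAdj (a ∷ t) (b ∷ s) → Near t s
BHAdj⇒Near 0F _ _ (_ , near) = near
BHAdj⇒Near 2F _ _ (_ , near) = near
BHAdj⇒Near 3F _ ()

Near⇒BHAdj′ : ∀ {m} a b {t s : Vec (Fin 4) m} → even₄ a ≡ true → even₄ b ≡ false → Near t s → BHAdj (b ∷ s) (a ∷ t)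
Near⇒BHAdj′ a b {t} {s} pa pb near = BHAdj-sym {x = a ∷ t} {b ∷ s} (Near⇒BHAdj a b pa pb near)

⟦_⟧ : Bool → ℕ
⟦ x ⟧ = 𝟙 (x ≟ᵇ true)

module _ {m} (U : Vec (Fin 4) (suc m) → Bool) where

  evens odds : Vec (Fin 4) m → ℕ
  evens t = ⟦ U (0F ∷ t) ⟧ + ⟦ U (2F ∷ t) ⟧
  odds s  = ⟦ U (1F ∷ s) ⟧ + ⟦ U (3F ∷ s) ⟧

  bounded-weights : Bounded (tails m) evens odds
  bounded-weights = bounded (λ t → +-mono-≤ (𝟙≤1 (U (0F ∷ t) ≟ᵇ true)) (𝟙≤1 (U (2F ∷ t) ≟ᵇ true)))
                            (λ s → +-mono-≤ (𝟙≤1 (U (1F ∷ s) ≟ᵇ true)) (𝟙≤1 (U (3F ∷ s) ≟ᵇ true)))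

  count≡weight : count (vecs (suc m)) U ≡ weight (tails m) evens odds
  count≡weight = begin
    count (vecs (suc m)) U
      ≡⟨ Σᵛ-∷ (λ v → ⟦ U v ⟧) ⟩
    w 0F + (w 1F + (w 2F + (w 3F + 0)))
      ≡⟨ regroup (w 0F) (w 1F) (w 2F) (w 3F) ⟩
    w 0F + w 2F + (w 1F + w 3F)
      ≡⟨ sym (cong₂ _+_ (∑-distrib-+ (allVecs m) (λ t → ⟦ U (0F ∷ t) ⟧) (λ t → ⟦ U (2F ∷ t) ⟧))
                        (∑-distrib-+ (allVecs m) (λ t → ⟦ U (1F ∷ t) ⟧) (λ t → ⟦ U (3F ∷ t) ⟧))) ⟩
    weight (tails m) evens odds ∎
    where
    open ≡-Reasoning
    w : Fin 4 → ℕ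
    w a = Σᵛ λ t → ⟦ U (a ∷ t) ⟧
    regroup : ∀ a b c d → a + (b + (c + (d + 0))) ≡ a + c + (b + d)
    regroup = solve-∀

  private
    absent : Vec (Fin 4) (suc m) → ℕ
    absent x = 𝟙 (U x ≟ᵇ false)

    absent-pair : ∀ u v → absent u + absent v ≡ 2 ∸ (⟦ U u ⟧ + ⟦ U v ⟧)
    absent-pair u v with U u | U v
    ... | true  | true  = refl
    ... | true  | false = refl
    ... | false | true  = refl
    ... | false | false = refl

    p q : Fin 4 → ℕ
    p a = 𝟙 (even₄ a ≟ᵇ true)
    q b = 𝟙 (even₄ b ≟ᵇ false)

  open BHBoundary m

  Σᵛ-regroup : (f : Vec (Fin 4) (suc m) → ℕ) → Σᵛ f ≡ Σᵛ λ t → Σ₄ λ a → f (a ∷ t)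
  Σᵛ-regroup f = trans (Σᵛ-∷ f) (∑-swap (allFin 4) (allVecs m) (λ a t → f (a ∷ t)))

  private
    differ : Vec (Fin 4) (suc m) → Vec (Fin 4) (suc m) → ℕ
    differ u v = 𝟙 (¬? (U u ≟ᵇ U v))

    κ-differ : ∀ u u′ v v′ → differ u v + differ u v′ + (differ u′ v + differ u′ v′) ≡
                             κ (⟦ U u ⟧ + ⟦ U u′ ⟧) (⟦ U v ⟧ + ⟦ U v′ ⟧)
    κ-differ u u′ v v′ with U u | U u′ | U v | U v′
    ... | true  | true  | true  | true  = refl
    ... | true  | true  | true  | false = refl
    ... | true  | true  | false | true  = refl
    ... | true  | true  | false | false = refl
    ... | true  | false | true  | true  = refl
    ... | true  | false | true  | false = refl
    ... | true  | false | false | true  = refl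
    ... | true  | false | false | false = refl
    ... | false | true  | true  | true  = refl
    ... | false | true  | true  | false = refl
    ... | false | true  | false | true  = refl
    ... | false | true  | false | false = refl
    ... | false | false | true  | true  = refl
    ... | false | false | true  | false = refl
    ... | false | false | false | true  = refl
    ... | false | false | false | false = refl

    separated-∷ : ∀ a t b s → 𝟙 (separated? U (a ∷ t , b ∷ s)) ≡ p a * (q b * (𝟙 (near? t s) * differ (a ∷ t) (b ∷ s)))
    separated-∷ a t b s = trans
      (𝟙-⇔ (separated? U (a ∷ t , b ∷ s))
           ((even₄ a ≟ᵇ true) ×-dec ((even₄ b ≟ᵇ false) ×-dec (near? t s ×-dec ¬? (U (a ∷ t) ≟ᵇ U (b ∷ s)))))
        (λ (pa , adj , U≢) → pa , trans (BHAdj-bipartite (a ∷ t) (b ∷ s) adj) (cong not pa) , BHAdj⇒Near a b {t} {s} pa adj , U≢)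
        (λ (pa , pb , near , U≢) → pa , Near⇒BHAdj a b {t} {s} pa pb near , U≢))
      (trans (𝟙-× (even₄ a ≟ᵇ true) ((even₄ b ≟ᵇ false) ×-dec (near? t s ×-dec ¬? (U (a ∷ t) ≟ᵇ U (b ∷ s)))))
             (cong (p a *_) (𝟙-×-× (even₄ b ≟ᵇ false) (near? t s) (¬? (U (a ∷ t) ≟ᵇ U (b ∷ s))))))

  size-boundary≡cut : EdgeSet.size (boundary U) ≡ cut m evens odds
  size-boundary≡cut = begin
    EdgeSet.size (boundary U)
      ≡⟨ size-boundary U ⟩
    Σᵛ (λ u → Σᵛ λ v → f u v)
      ≡⟨ Σᵛ-regroup (λ u → Σᵛ (f u)) ⟩
    Σᵛ (λ t → Σ₄ λ a → Σᵛ λ v → f (a ∷ t) v)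
      ≡⟨ ∑-cong (allVecs m) (λ t → trans (∑-cong (allFin 4) (λ a → Σᵛ-regroup (f (a ∷ t))))
           (∑-swap (allFin 4) (allVecs m) (λ a s → Σ₄ λ b → f (a ∷ t) (b ∷ s)))) ⟩
    Σᵛ (λ t → Σᵛ λ s → Σ₄ λ a → Σ₄ λ b → f (a ∷ t) (b ∷ s))
      ≡⟨ ∑-cong (allVecs m) (λ t → ∑-cong (allVecs m) (λ s → classes t s)) ⟩
    cut m evens odds ∎
    where
    open ≡-Reasoning
    f : Vec (Fin 4) (suc m) → Vec (Fin 4) (suc m) → ℕ
    f u v = 𝟙 (separated? U (u , v))
    -- The zeros are the terms with `a` odd or `b` even, which the parity indicators have already
    -- reduced.
    collect : ∀ n a b c d →
      (0 + (1 * (1 * (n * a)) + (0 + (1 * (1 * (n * b)) + 0)))) + (0 + ((0 + (1 * (1 * (n * c)) + (0 + (1 * (1 * (n * d)) + 0)))) + (0 + 0)))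
      ≡ n * (a + b + (c + d))
    collect = solve-∀
    classes : ∀ t s → Σ₄ (λ a → Σ₄ λ b → f (a ∷ t) (b ∷ s)) ≡ 𝟙 (near? t s) * κ (evens t) (odds s)
    classes t s = trans (∑-cong (allFin 4) (λ a → ∑-cong (allFin 4) (λ b → separated-∷ a t b s)))
      (trans (collect (𝟙 (near? t s)) (differ (0F ∷ t) (1F ∷ s)) (differ (0F ∷ t) (3F ∷ s))
                      (differ (2F ∷ t) (1F ∷ s)) (differ (2F ∷ t) (3F ∷ s)))
             (cong (𝟙 (near? t s) *_) (κ-differ (0F ∷ t) (2F ∷ t) (1F ∷ s) (3F ∷ s))))

  private
    complementary-degree : ∀ (near f : Vec (Fin 4) m → ℕ) → (∀ t → f t ≤ 2) →
      Σᵛ (λ t → near t * (2 ∸ f t)) + Σᵛ (λ t → f t * near t) ≡ 2 * Σᵛ near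
    complementary-degree near f f≤2 = trans (sym (∑-distrib-+ (allVecs m) (λ t → near t * (2 ∸ f t)) (λ t → f t * near t)))
      (trans (∑-cong (allVecs m) λ t → trans (collect (near t) (2 ∸ f t) (f t)) (cong (_* near t) (m+[n∸m]≡n (f≤2 t))))
             (∑-*ˡ (allVecs m) 2 near))
      where
      collect : ∀ n a b → n * a + b * n ≡ (b + a) * n
      collect = solve-∀

  outer-even : ∀ a t → even₄ a ≡ true → length (outerNeighbours {U} (a ∷ t)) + degree (tails m) odds t ≡ 2 * suc m
  outer-even a t pa = begin
    length (outerNeighbours {U} (a ∷ t)) + degree (tails m) odds t
      ≡⟨ cong (_+ degree (tails m) odds t) outer ⟩
    Σᵛ (λ s → 𝟙 (near? t s) * (2 ∸ odds s)) + degree (tails m) odds t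
      ≡⟨ complementary-degree (λ s → 𝟙 (near? t s)) odds (Bounded.right≤2 bounded-weights) ⟩
    2 * Σᵛ (λ s → 𝟙 (near? t s))
      ≡⟨ cong (2 *_) (degree-of-even t) ⟩
    2 * suc m ∎
    where
    open ≡-Reasoning
    outer? : ∀ x → Dec (BHAdj (a ∷ t) x × U x ≡ false)
    outer? x = BHAdj? (a ∷ t) x ×-dec (U x ≟ᵇ false)
    entry : ∀ b s → 𝟙 (outer? (b ∷ s)) ≡ q b * (𝟙 (near? t s) * absent (b ∷ s))
    entry b s = trans
      (𝟙-⇔ (outer? (b ∷ s)) ((even₄ b ≟ᵇ false) ×-dec (near? t s ×-dec (U (b ∷ s) ≟ᵇ false)))
        (λ (adj , Ux) → trans (BHAdj-bipartite (a ∷ t) (b ∷ s) adj) (cong not pa) , BHAdj⇒Near a b {t} {s} pa adj , Ux)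
        (λ (pb , near , Ux) → Near⇒BHAdj a b {t} {s} pa pb near , Ux))
      (𝟙-×-× (even₄ b ≟ᵇ false) (near? t s) (U (b ∷ s) ≟ᵇ false))
    collect : ∀ n x y → 0 + (1 * (n * x) + (0 + (1 * (n * y) + 0))) ≡ n * (x + y)
    collect = solve-∀
    outer : length (outerNeighbours {U} (a ∷ t)) ≡ Σᵛ (λ s → 𝟙 (near? t s) * (2 ∸ odds s))
    outer = trans (length-filter≡∑ outer? (allVecs (suc m)))
      (trans (Σᵛ-regroup (λ x → 𝟙 (outer? x)))
      (∑-cong (allVecs m) λ s → trans (∑-cong (allFin 4) (λ b → entry b s))
        (trans (collect (𝟙 (near? t s)) (absent (1F ∷ s)) (absent (3F ∷ s)))
               (cong (𝟙 (near? t s) *_) (absent-pair (1F ∷ s) (3F ∷ s))))))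

  outer-odd : ∀ b s → even₄ b ≡ false → length (outerNeighbours {U} (b ∷ s)) + degree (tails m ᵀ) evens s ≡ 2 * suc m
  outer-odd b s pb = begin
    length (outerNeighbours {U} (b ∷ s)) + degree (tails m ᵀ) evens s
      ≡⟨ cong (_+ degree (tails m ᵀ) evens s) outer ⟩
    Σᵛ (λ t → 𝟙 (near? t s) * (2 ∸ evens t)) + degree (tails m ᵀ) evens s
      ≡⟨ complementary-degree (λ t → 𝟙 (near? t s)) evens (Bounded.left≤2 bounded-weights) ⟩
    2 * Σᵛ (λ t → 𝟙 (near? t s))
      ≡⟨ cong (2 *_) (degree-of-odd s) ⟩
    2 * suc m ∎
    where
    open ≡-Reasoning
    outer? : ∀ x → Dec (BHAdj (b ∷ s) x × U x ≡ false)
    outer? x = BHAdj? (b ∷ s) x ×-dec (U x ≟ᵇ false)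
    even-neighbour : ∀ a t → BHAdj (b ∷ s) (a ∷ t) → even₄ a ≡ true
    even-neighbour a t adj = trans (BHAdj-bipartite (b ∷ s) (a ∷ t) adj) (cong not pb)
    entry : ∀ a t → 𝟙 (outer? (a ∷ t)) ≡ p a * (𝟙 (near? t s) * absent (a ∷ t))
    entry a t = trans
      (𝟙-⇔ (outer? (a ∷ t)) ((even₄ a ≟ᵇ true) ×-dec (near? t s ×-dec (U (a ∷ t) ≟ᵇ false)))
        (λ (adj , Ux) → let pa = even-neighbour a t adj in
          pa , BHAdj⇒Near a b {t} {s} pa (BHAdj-sym {x = b ∷ s} {a ∷ t} adj) , Ux)
        (λ (pa , near , Ux) → Near⇒BHAdj′ a b {t} {s} pa pb near , Ux))
      (𝟙-×-× (even₄ a ≟ᵇ true) (near? t s) (U (a ∷ t) ≟ᵇ false))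
    collect : ∀ n x y → 1 * (n * x) + (0 + (1 * (n * y) + 0)) ≡ n * (x + y)
    collect = solve-∀
    outer : length (outerNeighbours {U} (b ∷ s)) ≡ Σᵛ (λ t → 𝟙 (near? t s) * (2 ∸ evens t))
    outer = trans (length-filter≡∑ outer? (allVecs (suc m)))
      (trans (Σᵛ-regroup (λ x → 𝟙 (outer? x)))
      (∑-cong (allVecs m) λ t → trans (∑-cong (allFin 4) (λ a → entry a t))
        (trans (collect (𝟙 (near? t s)) (absent (0F ∷ t)) (absent (2F ∷ t)))
               (cong (𝟙 (near? t s) *_) (absent-pair (0F ∷ t) (2F ∷ t))))))

⟦not⟧ : ∀ x y → ⟦ not x ⟧ + ⟦ not y ⟧ ≡ 2 ∸ (⟦ x ⟧ + ⟦ y ⟧)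
⟦not⟧ true  true  = refl
⟦not⟧ true  false = refl
⟦not⟧ false true  = refl
⟦not⟧ false false = refl

count-not≡weight : ∀ {m} (U : Vec (Fin 4) (suc m) → Bool) →
  count (vecs (suc m)) (not ∘ U) ≡ weight (tails m) (complement (evens U)) (complement (odds U))
count-not≡weight {m} U = trans (count≡weight (not ∘ U)) (cong₂ _+_
  (∑-cong (allVecs m) λ t → ⟦not⟧ (U (0F ∷ t)) (U (2F ∷ t)))
  (∑-cong (allVecs m) λ s → ⟦not⟧ (U (1F ∷ s)) (U (3F ∷ s))))

-- The first coordinate turns freely around its 4-cycle. Raising a tail coordinate moves `0F` to
-- `1F`, which is then turned back.
BH-connected : ∀ m → Connected (BH (suc m))
BH-connected m (a ∷ t) (b ∷ s) = turn a 0F t ◅◅ (lift (tails-connected t s) ◅◅ turn 0F b s)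
  where
  _↦_ : Fin 4 → Fin 4 → Set
  a ↦ b = b ≡ inc a

  _⇝_ : ∀ {k} → Vec (Fin 4) k → Vec (Fin 4) k → Set
  t ⇝ s = ∃ λ i → s ≡ t [ i ]%= inc

  to-0 : ∀ a → Star _↦_ a 0F
  to-0 0F = ε
  to-0 1F = refl ◅ refl ◅ refl ◅ ε
  to-0 2F = refl ◅ refl ◅ ε
  to-0 3F = refl ◅ ε

  from-0 : ∀ a → Star _↦_ 0F a
  from-0 0F = ε
  from-0 1F = refl ◅ ε
  from-0 2F = refl ◅ refl ◅ ε
  from-0 3F = refl ◅ refl ◅ refl ◅ ε

  tails-connected : ∀ {k} (t s : Vec (Fin 4) k) → Star _⇝_ t s
  tails-connected []      []      = ε
  tails-connected (a ∷ t) (b ∷ s) =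
    gmap (a ∷_) (λ (i , eq) → suc i , cong (a ∷_) eq) (tails-connected t s) ◅◅
    gmap (_∷ s) (λ eq → zero , cong (_∷ s) eq) (to-0 a ◅◅ from-0 b)

  turn : ∀ a b (t : Vec (Fin 4) m) → Star BHAdj (a ∷ t) (b ∷ t)
  turn a b t = gmap (_∷ t) (λ eq → inj₁ eq , inj₁ refl) (to-0 a ◅◅ from-0 b)

  lift : ∀ {t s : Vec (Fin 4) m} → Star _⇝_ t s → Star BHAdj (0F ∷ t) (0F ∷ s)
  lift ε                       = ε
  lift (_◅_ {j = t} (i , eq) p) = (inj₁ refl , inj₂ (i , eq)) ◅ (turn 1F 0F t ◅◅ lift p)

-- Lower bound and extremal vertex sets

extraEdgeCut-size-≥ : ∀ {m g T} → Isoperimetric m (suc g) T →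
                      ∀ F → IsExtraEdgeCut g (BH (suc m)) F → T ≤ EdgeSet.size F
extraEdgeCut-size-≥ {m} {g} {T} iso F isCut = begin
  T                               ≤⟨ iso (bounded-weights U) (subst (suc g ≤_) (count≡weight U) (count-≥ isCut U≗))
                                       (subst (suc g ≤_) (count-not≡weight U) (count-not-≥ isCut U≗)) ⟩
  cut m (evens U) (odds U)        ≡⟨ sym (size-boundary≡cut U) ⟩
  EdgeSet.size (boundary U)       ≤⟨ size-boundary-≤ isCut U≗ ⟩
  EdgeSet.size F                  ∎
  where
  open ≤-Reasoning
  open BHBoundary m
  U = indicator (proj₁ (indicate (Part.members (part isCut))))
  U≗ = proj₂ (indicate (Part.members (part isCut)))

-- The twins `0F` and `1F` are taken first, so they represent every class of positive weight; paths
-- inside the set can therefore go through them.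
fromWeights : ∀ {m} → (Vec (Fin 4) m → ℕ) → (Vec (Fin 4) m → ℕ) → Vec (Fin 4) (suc m) → Bool
fromWeights e o (0F ∷ t) = 1 ≤ᵇ e t
fromWeights e o (1F ∷ t) = 1 ≤ᵇ o t
fromWeights e o (2F ∷ t) = 2 ≤ᵇ e t
fromWeights e o (3F ∷ t) = 2 ≤ᵇ o t

⟦≤ᵇ⟧ : ∀ k → k ≤ 2 → ⟦ 1 ≤ᵇ k ⟧ + ⟦ 2 ≤ᵇ k ⟧ ≡ k
⟦≤ᵇ⟧ 0 _ = refl
⟦≤ᵇ⟧ 1 _ = refl
⟦≤ᵇ⟧ 2 _ = refl
⟦≤ᵇ⟧ (suc (suc (suc _))) (s≤s (s≤s ()))

1≤ᵇ : ∀ {k} → 0 < k → (1 ≤ᵇ k) ≡ true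
1≤ᵇ (s≤s _) = refl

≤ᵇ-positive : ∀ j k → (suc j ≤ᵇ k) ≡ true → 0 < k
≤ᵇ-positive j (suc k) _ = s≤s z≤n

≤ᵇ-false : ∀ j k → j ≤ 1 → (suc j ≤ᵇ k) ≡ false → k ≤ 1
≤ᵇ-false _ 0 _ _ = z≤n
≤ᵇ-false _ 1 _ _ = s≤s z≤n
≤ᵇ-false 0 (suc (suc k)) _ ()
≤ᵇ-false 1 (suc (suc k)) _ ()
≤ᵇ-false (suc (suc _)) (suc (suc k)) (s≤s ()) _

-- z is the tail of a class from which all chosen vertices are reached.
record Configuration (m g d : ℕ) : Set where
  field
    e o      : Vec (Fin 4) m → ℕ
    bounds   : Bounded (tails m) e o
    weight≡  : weight (tails m) e o ≡ suc g
    z z̄      : Vec (Fin 4) m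
    0<z      : 0 < e z
    z̄-absent : e z̄ ≡ 0
    even-near : ∀ t → 0 < e t → ∃ λ s → 0 < o s × Near t s × Near z s
    odd-near  : ∀ s → 0 < o s → ∃ λ t → 0 < e t × Near t s
    -- Weight at most 1 means that some twin of the class lies outside the set; it then keeps at
    -- least `2 (m + 1) − d` outer neighbours.
    even-degree : ∀ t → e t ≤ 1 → degree (tails m) o t ≤ d
    odd-degree  : ∀ s → o s ≤ 1 → degree (tails m ᵀ) e s ≤ d

module _ {m g d} (C : Configuration m g d) where
  open Configuration C
  open BHBoundary m

  private
    U : Vec (Fin 4) (suc m) → Bool
    U = fromWeights e o

    evens≡ : ∀ t → evens U t ≡ e t
    evens≡ t = ⟦≤ᵇ⟧ (e t) (Bounded.left≤2 bounds t)

    odds≡ : ∀ s → odds U s ≡ o s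
    odds≡ s = ⟦≤ᵇ⟧ (o s) (Bounded.right≤2 bounds s)

    Vs = allVecs m

    degree-odds≡ : ∀ t → degree (tails m) (odds U) t ≡ degree (tails m) o t
    degree-odds≡ t = ∑-cong Vs λ s → cong (_* 𝟙 (near? t s)) (odds≡ s)

    degree-evens≡ : ∀ s → degree (tails m ᵀ) (evens U) s ≡ degree (tails m ᵀ) e s
    degree-evens≡ s = ∑-cong Vs λ t → cong (_* 𝟙 (near? t s)) (evens≡ t)

    hub : Vec (Fin 4) (suc m)
    hub = 0F ∷ z

    infixr 5 _via_
    _via_ : ∀ {u v} → BHAdj u v × U u ≡ true × U v ≡ true → Star _~[ U ]_ v hub → Star _~[ U ]_ u hub
    _via_ {u} {v} (adj , Uu , Uv) p = same-side {U} {u} {v} adj (trans Uu (sym Uv)) ◅ p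

    even-to-hub : ∀ a t → even₄ a ≡ true → U (a ∷ t) ≡ true → 0 < e t → Star _~[ U ]_ (a ∷ t) hub
    even-to-hub a t pa Uat 0<et = let s , 0<os , ts , zs = even-near t 0<et in
      (Near⇒BHAdj a 1F {t} {s} pa refl ts , Uat , 1≤ᵇ 0<os) via
      (Near⇒BHAdj′ 0F 1F {z} {s} refl refl zs , 1≤ᵇ 0<os , 1≤ᵇ 0<z) via ε

    odd-to-hub : ∀ b s → even₄ b ≡ false → U (b ∷ s) ≡ true → 0 < o s → Star _~[ U ]_ (b ∷ s) hub
    odd-to-hub b s pb Ubs 0<os = let t , 0<et , ts = odd-near s 0<os in
      (Near⇒BHAdj′ 0F b {t} {s} refl pb ts , Ubs , 1≤ᵇ 0<et) via even-to-hub 0F t refl (1≤ᵇ 0<et) 0<et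

    to-hub : ∀ v → U v ≡ true → Star _~[ U ]_ v hub
    to-hub (0F ∷ t) Uv = even-to-hub 0F t refl Uv (≤ᵇ-positive 0 (e t) Uv)
    to-hub (2F ∷ t) Uv = even-to-hub 2F t refl Uv (≤ᵇ-positive 1 (e t) Uv)
    to-hub (1F ∷ s) Uv = odd-to-hub 1F s refl Uv (≤ᵇ-positive 0 (o s) Uv)
    to-hub (3F ∷ s) Uv = odd-to-hub 3F s refl Uv (≤ᵇ-positive 1 (o s) Uv)

    outer-≥ : ∀ {D x y} → D + d ≤ 2 * suc m → x + y ≡ 2 * suc m → y ≤ d → D ≤ x
    outer-≥ {D} {x} {y} D+d≤ x+y≡ y≤d = +-cancelʳ-≤ d D x
      (≤-trans D+d≤ (≤-trans (≤-reflexive (sym x+y≡)) (+-monoʳ-≤ x y≤d)))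

    even-outer : ∀ {D} a t → even₄ a ≡ true → D + d ≤ 2 * suc m → e t ≤ 1 → D ≤ length (outerNeighbours {U} (a ∷ t))
    even-outer a t pa D≤ et≤1 = outer-≥ D≤ (outer-even U a t pa)
      (subst (_≤ d) (sym (degree-odds≡ t)) (even-degree t et≤1))

    odd-outer : ∀ {D} b s → even₄ b ≡ false → D + d ≤ 2 * suc m → o s ≤ 1 → D ≤ length (outerNeighbours {U} (b ∷ s))
    odd-outer b s pb D≤ os≤1 = outer-≥ D≤ (outer-odd U b s pb)
      (subst (_≤ d) (sym (degree-evens≡ s)) (odd-degree s os≤1))

    outer : ∀ {D} → D + d ≤ 2 * suc m → ∀ w → U w ≡ false → D ≤ length (outerNeighbours {U} w)
    outer D≤ (0F ∷ t) Uw = even-outer 0F t refl D≤ (≤ᵇ-false 0 (e t) z≤n Uw)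
    outer D≤ (2F ∷ t) Uw = even-outer 2F t refl D≤ (≤ᵇ-false 1 (e t) ≤-refl Uw)
    outer D≤ (1F ∷ s) Uw = odd-outer 1F s refl D≤ (≤ᵇ-false 0 (o s) z≤n Uw)
    outer D≤ (3F ∷ s) Uw = odd-outer 3F s refl D≤ (≤ᵇ-false 1 (o s) ≤-refl Uw)

  configuration-cut : ∀ D → 0 < D → suc g ≤ D + D → D + d ≤ 2 * suc m →
    ∃ λ F → IsExtraEdgeCut g (BH (suc m)) F × EdgeSet.size F ≡ cut m e o
  configuration-cut D 0<D g< D≤ = boundary U ,
    boundary-extra-cut {U} (BH-connected m) g D hub (0F ∷ z̄) (1≤ᵇ 0<z) (cong (1 ≤ᵇ_) z̄-absent)
      (≤-reflexive (sym count≡)) to-hub 0<D g< (outer D≤) ,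
    trans (size-boundary≡cut U) (∑-cong Vs λ t → ∑-cong Vs λ s →
      cong₂ (λ a b → 𝟙 (near? t s) * κ a b) (evens≡ t) (odds≡ s))
    where
    count≡ : count (vecs (suc m)) U ≡ suc g
    count≡ = trans (count≡weight U) (trans (cong₂ _+_ (∑-cong Vs evens≡) (∑-cong Vs odds≡)) weight≡)

codegree-≤1 : ∀ {m} {t t′ : Vec (Fin 4) m} → t ≢ t′ → Σᵛ (λ s → 𝟙 (near? t s) * 𝟙 (near? t′ s)) ≤ 1
codegree-≤1 {m} {t} {t′} t≢t′ with Enumeration.any-dec (vecs m) (λ s → near? t s ×-dec near? t′ s)
... | no none = ≤-trans (≤-reflexive (trans (∑-cong (allVecs m) λ s →
    trans (sym (𝟙-× (near? t s) (near? t′ s))) (𝟙-no (near? t s ×-dec near? t′ s) λ p → none (s , p))) (∑-zero (allVecs m)))) z≤n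
... | yes (s , ts , t′s) = subst (λ k → Σᵛ (λ s → 𝟙 (near? t s) * 𝟙 (near? t′ s)) ≤ k + 1) (∑-zero (allVecs m))
  (Enumeration.∑-mono-except (vecs m) s {g = λ _ → 0} 1 (*-mono-≤ (𝟙≤1 (near? t s)) (𝟙≤1 (near? t′ s)))
    λ y s≢y → ≤-reflexive (trans (sym (𝟙-× (near? t y) (near? t′ y)))
      (𝟙-no (near? t y ×-dec near? t′ y) λ (ty , t′y) → [ t≢t′ , s≢y ]′ (Near-C₄-free ts ty t′s t′y))))

record Star-weights (m k : ℕ) (z : Vec (Fin 4) m) (f : Vec (Fin 4) m → ℕ) : Set where
  field
    supported : ∀ s → f s ≤ 2 * 𝟙 (near? z s)
    total≡    : Σᵛ f ≡ k

  ≤2 : ∀ s → f s ≤ 2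
  ≤2 s = ≤-trans (supported s) (*-monoʳ-≤ 2 (𝟙≤1 (near? z s)))

  near : ∀ s → 0 < f s → Near z s
  near s 0<fs = 𝟙-positive (near? z s) (*-cancelˡ-< 2 0 _ (≤-trans 0<fs (supported s)))

  degree-centre : degree (tails m) f z ≡ k
  degree-centre = trans (∑-cong (allVecs m) λ s → absorb (near? z s) (supported s)) total≡
    where
    absorb : ∀ {P : Set} {x} (p : Dec P) → x ≤ 2 * 𝟙 p → x * 𝟙 p ≡ x
    absorb {x = x} (yes _) _ = *-identityʳ x
    absorb {x = x} (no _) x≤0 = trans (*-zeroʳ x) (sym (n≤0⇒n≡0 x≤0))

  -- Without 4-cycles, `t` shares at most one neighbouring class with `z`, and that class has weight
  -- at most 2, however the weights are distributed.
  degree-≤2 : ∀ {t} → z ≢ t → degree (tails m) f t ≤ 2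
  degree-≤2 {t} z≢t = begin
    Σᵛ (λ s → f s * 𝟙 (near? t s))
      ≤⟨ ∑-mono (allVecs m) (λ s → *-monoˡ-≤ (𝟙 (near? t s)) (supported s)) ⟩
    Σᵛ (λ s → 2 * 𝟙 (near? z s) * 𝟙 (near? t s))
      ≡⟨ ∑-cong (allVecs m) (λ s → *-assoc 2 (𝟙 (near? z s)) (𝟙 (near? t s))) ⟩
    Σᵛ (λ s → 2 * (𝟙 (near? z s) * 𝟙 (near? t s)))
      ≡⟨ ∑-*ˡ (allVecs m) 2 (λ s → 𝟙 (near? z s) * 𝟙 (near? t s)) ⟩
    2 * Σᵛ (λ s → 𝟙 (near? z s) * 𝟙 (near? t s))
      ≤⟨ *-monoʳ-≤ 2 (codegree-≤1 z≢t) ⟩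
    2 ∎
    where open ≤-Reasoning

Σᵛ-closed-neighbourhood : ∀ {m} (z : Vec (Fin 4) m) → Σᵛ (λ s → 2 * 𝟙 (near? z s)) ≡ 2 * suc m
Σᵛ-closed-neighbourhood {m} z = trans (∑-*ˡ (allVecs m) 2 (λ s → 𝟙 (near? z s))) (cong (2 *_) (degree-of-even z))

δ-positive : ∀ {m} (z t : Vec (Fin 4) m) {c} → 0 < 𝟙 (z ≟ᵛ t) * c → z ≡ t
δ-positive z t 0<δ = 𝟙-positive (z ≟ᵛ t) (proj₁ (0<* (𝟙 (z ≟ᵛ t)) 0<δ))

δ-self : ∀ {m} (z : Vec (Fin 4) m) c → 𝟙 (z ≟ᵛ z) * c ≡ c
δ-self z c = trans (cong (_* c) (𝟙-yes (z ≟ᵛ z) refl)) (*-identityˡ c)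

δ-other : ∀ {m} {z t : Vec (Fin 4) m} → z ≢ t → ∀ c → 𝟙 (z ≟ᵛ t) * c ≡ 0
δ-other {z = z} {t} z≢t c = cong (_* c) (𝟙-no (z ≟ᵛ t) z≢t)

-- A pair of twins together with g − 1 of its neighbours, where g = k + 2.
module _ (l k : ℕ) (k< : suc k ≤ 2 * suc (suc l)) where

  private
    m = suc l
    z z̄ : Vec (Fin 4) m
    z = replicate m 0F
    z̄ = 2F ∷ replicate l 0F

    e : Vec (Fin 4) m → ℕ
    e t = 𝟙 (z ≟ᵛ t) * 2

    leaves : ∃ λ o → (∀ s → o s ≤ 2 * 𝟙 (near? z s)) × Σᵛ o ≡ suc k
    leaves = Enumeration.intermediate (vecs m) (λ s → 2 * 𝟙 (near? z s)) (suc k)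
      (subst (suc k ≤_) (sym (Σᵛ-closed-neighbourhood z)) k<)

    o : Vec (Fin 4) m → ℕ
    o = proj₁ leaves

    star : Star-weights m (suc k) z o
    star = record { supported = proj₁ (proj₂ leaves) ; total≡ = proj₂ (proj₂ leaves) }

    open Star-weights star

    Σe : Σᵛ e ≡ 2
    Σe = Enumeration.∑-point (vecs m) z (λ _ → 2)

    leaf : ∃ λ s → 0 < o s
    leaf = let s , _ , 0<os = ∑-positive (allVecs m) o (subst (0 <_) (sym total≡) (s≤s z≤n)) in s , 0<os

  twin-star : Configuration m (2 + k) 2
  twin-star = record
    { e = e ; o = o ; z = z ; z̄ = z̄
    ; bounds = bounded (λ t → *-monoˡ-≤ 2 (𝟙≤1 (z ≟ᵛ t))) ≤2
    ; weight≡ = cong₂ _+_ Σe total≡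
    ; 0<z = subst (0 <_) (sym (δ-self z 2)) (s≤s z≤n)
    ; z̄-absent = δ-other {z = z} {z̄} (λ ()) 2
    ; even-near = λ t 0<et → let s , 0<os = leaf in
        s , 0<os , subst (λ t → Near t s) (δ-positive z t 0<et) (near s 0<os) , near s 0<os
    ; odd-near = λ s 0<os → z , subst (0 <_) (sym (δ-self z 2)) (s≤s z≤n) , near s 0<os
    ; even-degree = λ t et≤1 → degree-≤2 λ z≡t →
        contradiction (subst (_≤ 1) (trans (cong (λ t → 𝟙 (z ≟ᵛ t) * 2) (sym z≡t)) (δ-self z 2)) et≤1) λ { (s≤s ()) }
    ; odd-degree = λ s _ → ≤-trans (degree-≤ (tails m ᵀ) e s) (≤-reflexive Σe)
    }

  -- The `k + 1` leaves are adjacent to both twins, so a set of order `k + 3` spans `2 (k + 1)`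
  -- edges, meeting the linear bound.
  twin-star-cut : cut m e o ≡ 2 * suc (2 + k) * l + 8
  twin-star-cut = +-cancelʳ-≡ (2 * (2 * suc k)) _ _ (begin
    cut m e o + 2 * (2 * suc k)             ≡⟨ cong (λ q → cut m e o + 2 * q) (sym edges≡) ⟩
    cut m e o + 2 * edges (tails m) e o     ≡⟨ cut-edges (Configuration.bounds twin-star) ⟩
    2 * suc m * weight (tails m) e o        ≡⟨ cong (2 * suc m *_) (Configuration.weight≡ twin-star) ⟩
    2 * suc (suc l) * suc (2 + k)           ≡⟨ arithmetic l k ⟩
    2 * suc (2 + k) * l + 8 + 2 * (2 * suc k) ∎)
    where
    open ≡-Reasoning
    edges≡ : edges (tails m) e o ≡ 2 * suc k
    edges≡ = trans (∑-cong (allVecs m) (λ t → *-assoc (𝟙 (z ≟ᵛ t)) 2 _))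
      (trans (Enumeration.∑-point (vecs m) z (λ t → 2 * degree (tails m) o t)) (cong (2 *_) degree-centre))
    arithmetic : ∀ l k → 2 * suc (suc l) * suc (2 + k) ≡ 2 * suc (2 + k) * l + 8 + 2 * (2 * suc k)
    arithmetic = solve-∀


-- The hexagon of classes even z, odd p, even q, odd q, even w, odd z, of sizes 2, 2, 2, 1, 1, 2,
-- together with j further neighbours of the even class z.
module Hexagon {m} (z p q w z̄ : Vec (Fin 4) m)
  (zp : Near z p) (qp : Near q p) (wz : Near w z) (wq : Near w q) (¬zq : ¬ Near z q)
  (z≢p : z ≢ p) (z≢w : z ≢ w) (q≢w : q ≢ w) (z≢z̄ : z ≢ z̄) (q≢z̄ : q ≢ z̄) (w≢z̄ : w ≢ z̄)
  (j : ℕ) (j+4≤ : j + 4 ≤ 2 * suc m) where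

  private
    zz : Near z z
    zz = inj₁ refl
    qq : Near q q
    qq = inj₁ refl
    z≢q : z ≢ q
    z≢q z≡q = ¬zq (inj₁ (sym z≡q))
    p≢q : p ≢ q
    p≢q p≡q = ¬zq (subst (Near z) p≡q zp)
    both : ∀ {u v t : Vec (Fin 4) m} → u ≢ v → u ≡ t → v ≢ t
    both u≢v u≡t v≡t = u≢v (trans u≡t (sym v≡t))

    δ : Vec (Fin 4) m → ℕ → Vec (Fin 4) m → ℕ
    δ u c t = 𝟙 (u ≟ᵛ t) * c

    Σδ : ∀ u c → Σᵛ (δ u c) ≡ c
    Σδ u c = Enumeration.∑-point (vecs m) u (λ _ → c)

    e : Vec (Fin 4) m → ℕ
    e t = δ z 2 t + (δ q 2 t + δ w 1 t)

    Σe : Σᵛ e ≡ 5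
    Σe = trans (∑-distrib-+ (allVecs m) (δ z 2) (λ t → δ q 2 t + δ w 1 t))
      (cong₂ _+_ (Σδ z 2) (trans (∑-distrib-+ (allVecs m) (δ q 2) (δ w 1)) (cong₂ _+_ (Σδ q 2) (Σδ w 1))))

    e≤2 : ∀ t → e t ≤ 2
    e≤2 t = three (z ≟ᵛ t) (q ≟ᵛ t) (w ≟ᵛ t) (both z≢q) (both z≢w) (both q≢w)
      where
      three : ∀ {P Q R : Set} (a : Dec P) (b : Dec Q) (c : Dec R) → (P → ¬ Q) → (P → ¬ R) → (Q → ¬ R) →
              𝟙 a * 2 + (𝟙 b * 2 + 𝟙 c * 1) ≤ 2
      three (yes a) (yes b) _       ¬ab _ _ = contradiction b (¬ab a)
      three (yes a) (no _)  (yes c) _ ¬ac _ = contradiction c (¬ac a)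
      three (yes _) (no _)  (no _)  _ _ _   = ≤-refl
      three (no _)  (yes b) (yes c) _ _ ¬bc = contradiction c (¬bc b)
      three (no _)  (yes _) (no _)  _ _ _   = ≤-refl
      three (no _)  (no _)  (yes _) _ _ _   = s≤s z≤n
      three (no _)  (no _)  (no _)  _ _ _   = z≤n

    base : Vec (Fin 4) m → ℕ
    base s = δ z 2 s + δ p 2 s

    Σbase : Σᵛ base ≡ 4
    Σbase = trans (∑-distrib-+ (allVecs m) (δ z 2) (δ p 2)) (cong₂ _+_ (Σδ z 2) (Σδ p 2))

    room : Vec (Fin 4) m → ℕ
    room s = 2 * 𝟙 (near? z s) ∸ base s

    base-≤ : ∀ s → base s ≤ 2 * 𝟙 (near? z s)
    base-≤ s = two (z ≟ᵛ s) (p ≟ᵛ s) (near? z s) (both z≢p) (λ { refl → zz }) (λ { refl → zp })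
      where
      two : ∀ {P Q R : Set} (a : Dec P) (b : Dec Q) (c : Dec R) → (P → ¬ Q) → (P → R) → (Q → R) →
            𝟙 a * 2 + 𝟙 b * 2 ≤ 2 * 𝟙 c
      two (yes a) (yes b) _       ¬ab _ _ = contradiction b (¬ab a)
      two (yes _) (no _)  (yes _) _ _ _   = ≤-refl
      two (yes a) _       (no ¬c) _ f _   = contradiction (f a) ¬c
      two (no _)  (yes _) (yes _) _ _ _   = ≤-refl
      two (no _)  (yes b) (no ¬c) _ _ f   = contradiction (f b) ¬c
      two (no _)  (no _)  _       _ _ _   = z≤n

    Σroom : 4 + Σᵛ room ≡ 2 * suc m
    Σroom = begin
      4 + Σᵛ room                       ≡⟨ cong (_+ Σᵛ room) (sym Σbase) ⟩
      Σᵛ base + Σᵛ room                 ≡⟨ sym (∑-distrib-+ (allVecs m) base room) ⟩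
      Σᵛ (λ s → base s + room s)        ≡⟨ ∑-cong (allVecs m) (λ s → m+[n∸m]≡n (base-≤ s)) ⟩
      Σᵛ (λ s → 2 * 𝟙 (near? z s))      ≡⟨ Σᵛ-closed-neighbourhood z ⟩
      2 * suc m                         ∎
      where open ≡-Reasoning

    abstract
      extra : ∃ λ f → (∀ s → f s ≤ room s) × Σᵛ f ≡ j
      extra = Enumeration.intermediate (vecs m) room j
        (+-cancelʳ-≤ 4 j (Σᵛ room) (≤-trans j+4≤ (≤-reflexive (trans (sym Σroom) (+-comm 4 (Σᵛ room))))))

    f o₁ o : Vec (Fin 4) m → ℕ
    f = proj₁ extra
    o₁ s = base s + f s
    o s = o₁ s + δ q 1 s

    star : Star-weights m (4 + j) z o₁
    star = record
      { supported = λ s → ≤-trans (+-monoʳ-≤ (base s) (proj₁ (proj₂ extra) s)) (≤-reflexive (m+[n∸m]≡n (base-≤ s)))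
      ; total≡ = trans (∑-distrib-+ (allVecs m) base f) (cong₂ _+_ Σbase (proj₂ (proj₂ extra))) }

    open Star-weights star

    Σo : Σᵛ o ≡ 5 + j
    Σo = trans (∑-distrib-+ (allVecs m) o₁ (δ q 1)) (trans (cong₂ _+_ total≡ (Σδ q 1)) (+-comm (4 + j) 1))

    o≤2 : ∀ s → o s ≤ 2
    -- `q` is not adjacent to `z`, so `o₁` vanishes there and the extra unit does no harm.
    o≤2 s = add (q ≟ᵛ s) (≤2 s) λ q≡s → n≤0⇒n≡0 (≤-trans (supported s)
      (≤-reflexive (cong (2 *_) (𝟙-no (near? z s) (λ zs → ¬zq (subst (Near z) (sym q≡s) zs))))))
      where
      add : ∀ {P : Set} {x} (a : Dec P) → x ≤ 2 → (P → x ≡ 0) → x + 𝟙 a * 1 ≤ 2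
      add {x = x} (no _)  x≤2 _ = ≤-trans (≤-reflexive (+-identityʳ x)) x≤2
      add         (yes a) _   f = ≤-trans (≤-reflexive (cong (_+ 1) (f a))) (s≤s z≤n)

    o-z : 2 ≤ o z
    o-z = ≤-trans (≤-reflexive (sym (δ-self z 2)))
      (≤-trans (m≤m+n _ (δ p 2 z)) (≤-trans (m≤m+n _ (f z)) (m≤m+n _ (δ q 1 z))))

    o-p : 2 ≤ o p
    o-p = ≤-trans (≤-reflexive (sym (δ-self p 2)))
      (≤-trans (m≤n+m _ (δ z 2 p)) (≤-trans (m≤m+n _ (f p)) (m≤m+n _ (δ q 1 p))))

    o-q : 1 ≤ o q
    o-q = ≤-trans (≤-reflexive (sym (δ-self q 1))) (m≤n+m _ (o₁ q))

    e-z : 2 ≤ e z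
    e-z = ≤-trans (≤-reflexive (sym (δ-self z 2))) (m≤m+n _ _)

    e-q : 1 ≤ e q
    e-q = ≤-trans (≤-trans (s≤s z≤n) (≤-reflexive (sym (δ-self q 2))))
      (≤-trans (m≤m+n _ (δ w 1 q)) (m≤n+m _ (δ z 2 q)))

    0<+ : ∀ a {b} → 0 < a + b → 0 < a ⊎ 0 < b
    0<+ zero    0<b = inj₂ 0<b
    0<+ (suc a) _   = inj₁ (s≤s z≤n)

    even-near : ∀ t → 0 < e t → ∃ λ s → 0 < o s × Near t s × Near z s
    even-near t 0<et with 0<+ (δ z 2 t) 0<et
    ... | inj₁ p₁ with refl ← δ-positive z t p₁ = z , ≤-trans (s≤s z≤n) o-z , zz , zz
    ... | inj₂ p₂ with 0<+ (δ q 2 t) p₂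
    ...   | inj₁ p₃ with refl ← δ-positive q t p₃ = p , ≤-trans (s≤s z≤n) o-p , qp , zp
    ...   | inj₂ p₃ with refl ← δ-positive w t p₃ = z , ≤-trans (s≤s z≤n) o-z , wz , zz

    odd-near : ∀ s → 0 < o s → ∃ λ t → 0 < e t × Near t s
    odd-near s 0<os with 0<+ (o₁ s) 0<os
    ... | inj₁ p₁ = z , ≤-trans (s≤s z≤n) e-z , near s p₁
    ... | inj₂ p₁ with refl ← δ-positive q s p₁ = q , e-q , qq

    degree-o : ∀ t → degree (tails m) o t ≡ degree (tails m) o₁ t + 𝟙 (near? t q)
    degree-o t = trans (∑-cong (allVecs m) (λ s → expand (o₁ s) (𝟙 (q ≟ᵛ s)) (𝟙 (near? t s))))
      (trans (∑-distrib-+ (allVecs m) (λ s → o₁ s * 𝟙 (near? t s)) (λ s → 𝟙 (q ≟ᵛ s) * 𝟙 (near? t s)))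
             (cong (degree (tails m) o₁ t +_) (Enumeration.∑-point (vecs m) q (λ s → 𝟙 (near? t s)))))
      where
      expand : ∀ a b c → (a + b * 1) * c ≡ a * c + b * c
      expand = solve-∀

  -- The 5 is the total even weight, which bounds all odd degrees. An even class other than `z` has
  -- degree at most 3: 2 around `z` and 1 from the odd class `q`.
  hexagon : Configuration m (9 + j) 5
  hexagon = record
    { e = e ; o = o ; z = z ; z̄ = z̄
    ; bounds = bounded e≤2 o≤2
    ; weight≡ = cong₂ _+_ Σe Σo
    ; 0<z = ≤-trans (s≤s z≤n) e-z
    ; z̄-absent = cong₂ _+_ (δ-other z≢z̄ 2) (cong₂ _+_ (δ-other q≢z̄ 2) (δ-other w≢z̄ 1))
    ; even-near = even-near
    ; odd-near = odd-near
    ; even-degree = λ t et≤1 → ≤-trans (≤-reflexive (degree-o t))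
        (≤-trans (+-mono-≤ (degree-≤2 {t} λ { refl → contradiction (≤-trans e-z et≤1) λ { (s≤s ()) } }) (𝟙≤1 (near? t q)))
                 (≤-check {3} {5}))
    ; odd-degree = λ s _ → ≤-trans (degree-≤ (tails m ᵀ) e s) (≤-reflexive Σe)
    }

  -- Around the hexagon the products of consecutive sizes are 4, 4, 2, 1, 2, 4, with sum 17, and
  -- each further neighbour of `z` sees both twins. A lower bound is enough for bounding the cut
  -- from above.
  hexagon-edges : 17 + 2 * j ≤ edges (tails m) e o
  hexagon-edges = begin
    17 + 2 * j                                    ≡⟨ arithmetic j ⟩
    2 * (4 + j) + (2 * 3 + 1 * 3)                 ≤⟨ +-mono-≤ (*-monoʳ-≤ 2 deg-z) (+-mono-≤ (*-monoʳ-≤ 2 deg-q) (*-monoʳ-≤ 1 deg-w)) ⟩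
    2 * deg z + (2 * deg q + 1 * deg w)           ≡⟨ sym (cong₂ _+_ (point z 2) (cong₂ _+_ (point q 2) (point w 1))) ⟩
    part z 2 + (part q 2 + part w 1)              ≡⟨ cong (part z 2 +_) (sym (∑-distrib-+ (allVecs m) (λ t → δ q 2 t * deg t) (λ t → δ w 1 t * deg t))) ⟩
    part z 2 + Σᵛ (λ t → δ q 2 t * deg t + δ w 1 t * deg t) ≡⟨ sym (∑-distrib-+ (allVecs m) (λ t → δ z 2 t * deg t) (λ t → δ q 2 t * deg t + δ w 1 t * deg t)) ⟩
    Σᵛ (λ t → δ z 2 t * deg t + (δ q 2 t * deg t + δ w 1 t * deg t))
      ≡⟨ ∑-cong (allVecs m) (λ t → sym (distrib (δ z 2 t) (δ q 2 t) (δ w 1 t) (deg t))) ⟩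
    edges (tails m) e o                           ∎
    where
    open ≤-Reasoning
    deg : Vec (Fin 4) m → ℕ
    deg = degree (tails m) o
    part : Vec (Fin 4) m → ℕ → ℕ
    part u c = Σᵛ λ t → δ u c t * deg t
    point : ∀ u c → part u c ≡ c * deg u
    point u c = trans (∑-cong (allVecs m) (λ t → *-assoc (𝟙 (u ≟ᵛ t)) c (deg t)))
                      (Enumeration.∑-point (vecs m) u (λ t → c * deg t))
    present : ∀ {t s} → Near t s → 0 < 𝟙 (near? t s)
    present {t} {s} ts = ≤-reflexive (sym (𝟙-yes (near? t s) ts))
    deg-z : 4 + j ≤ deg z
    deg-z = ≤-trans (≤-reflexive (sym degree-centre)) (≤-trans (m≤m+n _ _) (≤-reflexive (sym (degree-o z))))
    deg-q : 3 ≤ deg q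
    deg-q = ≤-trans (+-mono-≤ o-p o-q) (degree-≥-pair (tails m) o q {p} {q} p≢q (present qp) (present qq))
    deg-w : 3 ≤ deg w
    deg-w = ≤-trans (+-mono-≤ o-z o-q) (degree-≥-pair (tails m) o w {z} {q} z≢q (present wz) (present wq))
    arithmetic : ∀ j → 17 + 2 * j ≡ 2 * (4 + j) + (2 * 3 + 1 * 3)
    arithmetic = solve-∀
    distrib : ∀ a b c d → (a + (b + c)) * d ≡ a * d + (b * d + c * d)
    distrib = solve-∀

  hexagon-cut : cut m e o + 2 * (17 + 2 * j) ≤ 2 * suc m * (10 + j)
  hexagon-cut = ≤-trans (+-monoʳ-≤ (cut m e o) (*-monoʳ-≤ 2 hexagon-edges))
    (≤-reflexive (trans (cut-edges (Configuration.bounds hexagon)) (cong (2 * suc m *_) (Configuration.weight≡ hexagon))))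

open import Data.Integer using (+_)

-- From the bounds to the two statements

-- The first inequality makes the components outside the twin star large enough; the second gives
-- its centre enough neighbours.
reach-≤ : ∀ l → reach l ≤ (2 * l + 2) + (2 * l + 2) × reach l ≤ 2 * suc (suc l) + 2
reach-≤ 0 = ≤-check , ≤-check
reach-≤ 1 = ≤-check , ≤-check
reach-≤ 2 = ≤-check , ≤-check
reach-≤ (suc (suc (suc j))) =
  ≤-by 9 _ (7 + 4 * j) (z≤n {0}) (first j) , ≤-by 9 _ (3 + 2 * j) (z≤n {0}) (second j)
  where
  first : ∀ j → 9 + 0 + (7 + 4 * j) ≡ 0 + ((2 * (3 + j) + 2) + (2 * (3 + j) + 2))
  first = solve-∀
  second : ∀ j → 9 + 0 + (3 + 2 * j) ≡ 0 + (2 * suc (suc (3 + j)) + 2)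
  second = solve-∀

connectivity-small : ∀ l k → 3 + k ≤ reach l → IsExtraEdgeConnectivity (2 + k) (BH (suc (suc l))) (2 * suc (2 + k) * l + 8)
connectivity-small l k g<r =
  let F , isCut , size≡ = configuration-cut (twin-star l k k<) (2 * l + 2) (≤-trans (m≤n+m 1 (2 * l + 1)) (≤-reflexive (one l)))
                            (≤-trans g<r (proj₁ (reach-≤ l))) (≤-reflexive (degree≡ l))
  in (F , isCut , trans size≡ (twin-star-cut l k k<)) ,
     extraEdgeCut-size-≥ (isoperimetric l (suc (2 + k)) (m≤m+n 3 k) g<r)
  where
  one : ∀ l → 2 * l + 1 + 1 ≡ 2 * l + 2
  one = solve-∀
  degree≡ : ∀ l → 2 * l + 2 + 2 ≡ 2 * suc (suc l)
  degree≡ = solve-∀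
  k< : suc k ≤ 2 * suc (suc l)
  k< = +-cancelʳ-≤ 2 (suc k) _ (≤-trans (≤-reflexive (+-comm (suc k) 2)) (≤-trans g<r (proj₂ (reach-≤ l))))

Admissible : ℕ → ℕ → Set
Admissible n g = + 6 / 1 ℚᵘ.- + 12 / suc g ℚᵘ.≤ + n / 1

admissible? : ∀ n g → Dec (Admissible n g)
admissible? n g = (+ 6 / 1 ℚᵘ.- + 12 / suc g) ℚᵘ.≤? (+ n / 1)

-- With `K = g + 1` the hypothesis reads `K (6 − n) ≤ 12`: impossible for `K ≥ 3` and `n ≤ 1`, and
-- `K ≤ 3`, `4`, `6` for `n = 2`, `3`, `4`. From `n = 5` on only `g ≤ 8` limits `K`. As `g` is
-- bounded, the small dimensions are checked by evaluation.
admissible⇒reach : ∀ n g → 2 ≤ g → g ≤ 8 → Admissible n g → ∃ λ l → n ≡ suc (suc l) × suc g ≤ reach l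
admissible⇒reach 0 g 2≤g g≤8 h = contradiction h (none (s≤s g≤8) 2≤g)
  where
  none : ∀ {g} → g < 9 → 2 ≤ g → ¬ Admissible 0 g
  none = from-yes (allUpTo? (λ g → (2 ≤? g) →-dec ¬? (admissible? 0 g)) 9)
admissible⇒reach 1 g 2≤g g≤8 h = contradiction h (none (s≤s g≤8) 2≤g)
  where
  none : ∀ {g} → g < 9 → 2 ≤ g → ¬ Admissible 1 g
  none = from-yes (allUpTo? (λ g → (2 ≤? g) →-dec ¬? (admissible? 1 g)) 9)
admissible⇒reach 2 g 2≤g g≤8 h = 0 , refl , small (s≤s g≤8) 2≤g h
  where
  small : ∀ {g} → g < 9 → 2 ≤ g → Admissible 2 g → suc g ≤ 3
  small = from-yes (allUpTo? (λ g → (2 ≤? g) →-dec (admissible? 2 g →-dec (suc g ≤? 3))) 9)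
admissible⇒reach 3 g 2≤g g≤8 h = 1 , refl , small (s≤s g≤8) 2≤g h
  where
  small : ∀ {g} → g < 9 → 2 ≤ g → Admissible 3 g → suc g ≤ 4
  small = from-yes (allUpTo? (λ g → (2 ≤? g) →-dec (admissible? 3 g →-dec (suc g ≤? 4))) 9)
admissible⇒reach 4 g 2≤g g≤8 h = 2 , refl , small (s≤s g≤8) 2≤g h
  where
  small : ∀ {g} → g < 9 → 2 ≤ g → Admissible 4 g → suc g ≤ 6
  small = from-yes (allUpTo? (λ g → (2 ≤? g) →-dec (admissible? 4 g →-dec (suc g ≤? 6))) 9)
admissible⇒reach (suc (suc (suc (suc (suc j))))) g _ g≤8 _ = 3 + j , refl , s≤s g≤8

-- `10 + j ≤ 2 n` forces `n ≥ 5`, so there are two tail coordinates in which to draw the hexagon.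
connectivity-large : ∀ m j → 10 + j ≤ 2 * suc m →
  ∃ λ k → IsExtraEdgeConnectivity (9 + j) (BH (suc m)) k × k + 2 * (17 + 2 * j) ≤ 2 * suc m * (10 + j)
connectivity-large 0 j h = contradiction (≤-trans (m≤m+n 10 j) h) (<⇒≱ (≤-check {3} {10}))
connectivity-large 1 j h = contradiction (≤-trans (m≤m+n 10 j) h) (<⇒≱ (≤-check {5} {10}))
connectivity-large (suc (suc k)) j h =
  let F , isCut , size≡ = configuration-cut H.hexagon D 0<D g< (≤-reflexive D+5≡)
      c , isConnectivity , c≤ = BHBoundary.connectivity-exists (suc (suc k)) (BH-connected (suc (suc k))) (9 + j) F isCut
  in c , isConnectivity , ≤-trans (+-monoˡ-≤ (2 * (17 + 2 * j)) (≤-trans c≤ (≤-reflexive size≡))) H.hexagon-cut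
  where
  r : Vec (Fin 4) k
  r = replicate k 0F
  ¬zq : ¬ Near (0F ∷ 0F ∷ r) (1F ∷ 3F ∷ r)
  ¬zq near with Near-∷⁻ near
  ... | inj₁ (() , _)
  ... | inj₂ (_ , ())
  N = 2 * suc (suc (suc k))
  -- In these two coordinates `z = (0,0)`, `p = (1,0)`, `q = (1,3)` and `w = (0,3)`: each required
  -- adjacency raises one coordinate, with `3 + 1 = 0`. The tail `(2,0)` is a class left out of the
  -- set.
  module H = Hexagon {suc (suc k)} (0F ∷ 0F ∷ r) (1F ∷ 0F ∷ r) (1F ∷ 3F ∷ r) (0F ∷ 3F ∷ r) (2F ∷ 0F ∷ r)
    (inj₂ (zero , refl)) (inj₂ (suc zero , refl)) (inj₂ (suc zero , refl)) (inj₂ (zero , refl)) ¬zq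
    (λ ()) (λ ()) (λ ()) (λ ()) (λ ()) (λ ()) j
    (≤-trans (≤-trans (≤-reflexive (+-comm j 4)) (+-monoˡ-≤ j (≤-check {4} {10}))) h)
  D : ℕ
  -- An outside vertex has `2 n` neighbours, at most 5 of them chosen. From `10 + j ≤ 2 n` follows
  -- `D ≥ 5 + j`, so `D + D` reaches the required order.
  D = N ∸ 5
  D+5≡ : D + 5 ≡ N
  D+5≡ = m∸n+n≡m (≤-trans (≤-trans (≤-check {5} {10}) (m≤m+n 10 j)) h)
  5+j≤D : 5 + j ≤ D
  5+j≤D = +-cancelʳ-≤ 5 (5 + j) D (≤-trans (≤-reflexive (eq j)) (≤-trans h (≤-reflexive (sym D+5≡))))
    where
    eq : ∀ j → 5 + j + 5 ≡ 10 + j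
    eq = solve-∀
  0<D : 0 < D
  0<D = ≤-trans (s≤s z≤n) 5+j≤D
  g< : suc (9 + j) ≤ D + D
  g< = ≤-trans (≤-by (10 + j) (5 + j + (5 + j)) j (z≤n {0}) (eq j)) (+-mono-≤ 5+j≤D 5+j≤D)
    where
    eq : ∀ j → 10 + j + 0 + j ≡ 0 + (5 + j + (5 + j))
    eq = solve-∀

theorem3p6 :
    (∀ (n g : ℕ) .{{_ : NonZero n}} →
       2 ≤ g → g ≤ 8 →
       + 6 / 1 ℚᵘ.- + 12 / suc g ℚᵘ.≤ + n / 1 →
       IsExtraEdgeConnectivity g (BH n) (2 * (g + 1) * n ∸ 4 * g + 4))
    ×
    (∀ (n g : ℕ) .{{_ : NonZero n}} →
       9 ≤ g → g ≤ 2 * n ∸ 1 →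
       (∀ e → IsMaxInducedEdges g (BH n) e →
          + (3 * e) / suc g ℚᵘ.≤ + n / 1 →
          ∃ λ k → IsExtraEdgeConnectivity g (BH n) k × k < 2 * (g + 1) * n ∸ 4 * g + 4))
theorem3p6 = equality , strict
  where
  equality : ∀ (n g : ℕ) .{{_ : NonZero n}} → 2 ≤ g → g ≤ 8 → Admissible n g →
             IsExtraEdgeConnectivity g (BH n) (2 * (g + 1) * n ∸ 4 * g + 4)
  equality (suc n) (suc zero) (s≤s ()) _ _
  equality (suc n) (suc (suc k)) 2≤g g≤8 h with admissible⇒reach (suc n) (suc (suc k)) 2≤g g≤8 h
  ... | l , refl , g<r = subst (IsExtraEdgeConnectivity (2 + k) (BH (suc (suc l)))) (sym value)
                                             (connectivity-small l k g<r)
    where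
    expand : ∀ k l → 2 * (2 + k + 1) * suc (suc l) ≡ 2 * suc (2 + k) * l + 4 + 4 * (2 + k)
    expand = solve-∀
    value : 2 * (2 + k + 1) * suc (suc l) ∸ 4 * (2 + k) + 4 ≡ 2 * suc (2 + k) * l + 8
    value = trans (cong (λ x → x ∸ 4 * (2 + k) + 4) (expand k l))
      (trans (cong (_+ 4) (m+n∸n≡m (2 * suc (2 + k) * l + 4) (4 * (2 + k)))) (+-assoc (2 * suc (2 + k) * l) 4 4))

  strict : ∀ (n g : ℕ) .{{_ : NonZero n}} → 9 ≤ g → g ≤ 2 * n ∸ 1 → ∀ e → IsMaxInducedEdges g (BH n) e →
           + (3 * e) / suc g ℚᵘ.≤ + n / 1 →
           ∃ λ k → IsExtraEdgeConnectivity g (BH n) k × k < 2 * (g + 1) * n ∸ 4 * g + 4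
  strict (suc m) g 9≤g g≤ _ _ _ with g ∸ 9 | sym (m+[n∸m]≡n 9≤g)
  ... | j | refl = let k , isConnectivity , k≤ = connectivity-large m j (s≤s g≤) in
    k , isConnectivity ,
    -- The extra edge makes the cut at least 2 below the stated value, hence slack 1 for a strict
    -- inequality. `m≤n+m∸n` holds whether or not the subtraction truncates.
    ≤-by (suc k) (X ∸ 4 * (9 + j) + 4) 1 (+-mono-≤ k≤ (m≤n+m∸n X (4 * (9 + j))))
      (arithmetic k m j (X ∸ 4 * (9 + j)))
    where
    X = 2 * (9 + j + 1) * suc m
    arithmetic : ∀ k m j Y → suc k + (2 * suc m * (10 + j) + (4 * (9 + j) + Y)) + 1 ≡
                             k + 2 * (17 + 2 * j) + 2 * (9 + j + 1) * suc m + (Y + 4)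
    arithmetic = solve-∀
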